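{- Let $A\subseteq\mathbb{R}\setminus\{0\}$ be finite. Then there are sets $X,Y\subseteq A$ with $X\cup Y=A$ and $|X|,|Y|\ge |A|/2$ such that \[ E_3^+(X)^4\,E^\times(Y)^3\lesssim |A|^{22}. \]
   Context: $E_3^+(X)=\sum_x r_{X-X}(x)^3$ where $r_{X-X}(x)=\#\{(a,b)\in X^2:a-b=x\}$; $E^\times(Y)=\#\{(y_1,y_2,y_3,y_4)\in Y^4: y_1y_2=y_3y_4\}$. Notation: $P\lesssim Q$ means $P\le C\,Q(\log(2+|A|))^{c}$ for absolute constants $C,c>0$. -}

module Defs where

open import Axiom.ExcludedMiddle using (ExcludedMiddle)
open import Data.List.Base using (List; map; filter; length; sum; deduplicate; cartesianProduct)
open import Data.Nat.Base as ℕ using (ℕ)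
import Data.Nat.Properties as ℕ
open import Data.Nat.Logarithm using (⌊log₂_⌋)
open import Data.Product.Base using (_×_; _,_; ∃-syntax; uncurry)
open import Data.Rational.Base as ℚ using (ℚ; 0ℚ; 1ℚ; ½; ∣_∣; positive)
import Data.Rational.Properties as ℚ
open import Data.Rational.Solver using (module +-*-Solver)
open import Level using (0ℓ)
open import Relation.Binary.Bundles using (Setoid)
open import Relation.Binary.Definitions using (Decidable)
open import Relation.Binary.PropositionalEquality using (_≡_; refl; sym; trans; cong; subst; subst₂)

------------------------------------------------------------------------
-- The real numbers: Cauchy sequences of rationals, with equality _≈_
-- meaning that the difference tends to 0.

IsCauchy : (ℕ → ℚ) → Set
IsCauchy x = ∀ ε → 0ℚ ℚ.< ε →
  ∃[ N ] (∀ m n → N ℕ.≤ m → N ℕ.≤ n → ∣ x m ℚ.- x n ∣ ℚ.< ε)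

record ℝ : Set where
  constructor mkℝ
  field
    seq    : ℕ → ℚ
    cauchy : IsCauchy seq

open ℝ public

infix 4 _≈_

-- A record, so that x and y can be inferred from x ≈ y.
record _≈_ (x y : ℝ) : Set where
  constructor mk≈
  field
    limit : ∀ ε → 0ℚ ℚ.< ε → ∃[ N ] (∀ n → N ℕ.≤ n → ∣ seq x n ℚ.- seq y n ∣ ℚ.< ε)

open _≈_ public

half-pos : ∀ {ε} → 0ℚ ℚ.< ε → 0ℚ ℚ.< ½ ℚ.* ε
half-pos {ε} ε>0 = ℚ.positive⁻¹ _ {{ℚ.pos*pos⇒pos ½ ε {{positive ε>0}}}}

half+half : ∀ ε → ½ ℚ.* ε ℚ.+ ½ ℚ.* ε ≡ ε
half+half ε = trans (sym (ℚ.*-distribʳ-+ ε ½ ½)) (ℚ.*-identityˡ ε)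

∣∣-sym : ∀ p q → ∣ p ℚ.- q ∣ ≡ ∣ q ℚ.- p ∣
∣∣-sym p q = trans (sym (ℚ.∣-p∣≡∣p∣ (p ℚ.- q))) (cong ∣_∣ eq)
  where
  open +-*-Solver
  eq : ℚ.- (p ℚ.- q) ≡ q ℚ.- p
  eq = solve 2 (λ a b → :- (a :- b) := b :- a) refl p q

∣sum∣< : ∀ {p q r ε} → r ≡ p ℚ.+ q → ∣ p ∣ ℚ.< ½ ℚ.* ε → ∣ q ∣ ℚ.< ½ ℚ.* ε → ∣ r ∣ ℚ.< ε
∣sum∣< {p} {q} {ε = ε} refl p< q< =
  subst (∣ p ℚ.+ q ∣ ℚ.<_) (half+half ε)
    (ℚ.≤-<-trans (ℚ.∣p+q∣≤∣p∣+∣q∣ p q) (ℚ.+-mono-< p< q<))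

max-left : ∀ {M N n} → M ℕ.⊔ N ℕ.≤ n → M ℕ.≤ n
max-left {M} {N} = ℕ.m⊔n≤o⇒m≤o M N

max-right : ∀ {M N n} → M ℕ.⊔ N ℕ.≤ n → N ℕ.≤ n
max-right {M} {N} = ℕ.m⊔n≤o⇒n≤o M N

+-cauchy : ∀ {x y} → IsCauchy x → IsCauchy y → IsCauchy (λ n → x n ℚ.+ y n)
+-cauchy {x} {y} cx cy ε ε>0 =
  let M , hM = cx (½ ℚ.* ε) (half-pos ε>0)
      N , hN = cy (½ ℚ.* ε) (half-pos ε>0)
  in M ℕ.⊔ N , λ m n m≥ n≥ →
       ∣sum∣< (eq (x m) (y m) (x n) (y n))
         (hM m n (max-left m≥) (max-left n≥))
         (hN m n (max-right {M} m≥) (max-right {M} n≥))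
  where
  open +-*-Solver
  eq : ∀ a b c d → (a ℚ.+ b) ℚ.- (c ℚ.+ d) ≡ (a ℚ.- c) ℚ.+ (b ℚ.- d)
  eq = solve 4 (λ a b c d → (a :+ b) :- (c :+ d) := (a :- c) :+ (b :- d)) refl

neg-cauchy : ∀ {x} → IsCauchy x → IsCauchy (λ n → ℚ.- x n)
neg-cauchy {x} cx ε ε>0 =
  let N , hN = cx ε ε>0
  in N , λ m n m≥ n≥ → subst (ℚ._< ε) (cong ∣_∣ (eq (x n) (x m))) (hN n m n≥ m≥)
  where
  open +-*-Solver
  eq : ∀ a b → a ℚ.- b ≡ (ℚ.- b) ℚ.- (ℚ.- a)
  eq = solve 2 (λ a b → a :- b := (:- b) :- (:- a)) refl

eventually-bounded : ∀ {x} → IsCauchy x →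
  ∃[ B ] (0ℚ ℚ.< B × ∃[ N ] (∀ n → N ℕ.≤ n → ∣ x n ∣ ℚ.< B))
eventually-bounded {x} cx =
  let N , hN = cx 1ℚ (ℚ.positive⁻¹ 1ℚ)
      B      = 1ℚ ℚ.+ ∣ x N ∣
      bound  = λ n n≥ → ℚ.≤-<-trans
        (subst (λ t → ∣ t ∣ ℚ.≤ ∣ x n ℚ.- x N ∣ ℚ.+ ∣ x N ∣) (eq (x n) (x N))
          (ℚ.∣p+q∣≤∣p∣+∣q∣ (x n ℚ.- x N) (x N)))
        (ℚ.+-monoˡ-< ∣ x N ∣ (hN n N n≥ ℕ.≤-refl))
  in B , ℚ.≤-<-trans (ℚ.0≤∣p∣ (x N)) (bound N ℕ.≤-refl) , N , bound
  where
  open +-*-Solver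
  eq : ∀ a b → (a ℚ.- b) ℚ.+ b ≡ a
  eq = solve 2 (λ a b → (a :- b) :+ b := a) refl

shrink : ∀ B ε → 0ℚ ℚ.< B → 0ℚ ℚ.< ε → ∃[ δ ] (0ℚ ℚ.< δ ×
  (∀ p q → ∣ p ∣ ℚ.< B → ∣ q ∣ ℚ.< δ → ∣ p ℚ.* q ∣ ℚ.< ε))
shrink B ε B>0 ε>0 = δ , δ>0 , bound
  where
  instance
    _ = positive B>0
    _ = positive ε>0
    B≢0 = ℚ.pos⇒nonZero B
    _ = ℚ.1/pos⇒pos B
  δ = (ℚ.1/ B) ℚ.* ε
  δ>0 : 0ℚ ℚ.< δ
  δ>0 = ℚ.positive⁻¹ δ {{ℚ.pos*pos⇒pos (ℚ.1/ B) ε}}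
  Bδ≡ε : B ℚ.* δ ≡ ε
  Bδ≡ε = trans (sym (ℚ.*-assoc B (ℚ.1/ B) ε))
        (trans (cong (ℚ._* ε) (ℚ.*-inverseʳ B)) (ℚ.*-identityˡ ε))
  bound : ∀ p q → ∣ p ∣ ℚ.< B → ∣ q ∣ ℚ.< δ → ∣ p ℚ.* q ∣ ℚ.< ε
  bound p q p< q< = subst₂ ℚ._<_ (sym (ℚ.∣p*q∣≡∣p∣*∣q∣ p q)) Bδ≡ε
    (ℚ.≤-<-trans
      (ℚ.*-monoʳ-≤-nonNeg ∣ q ∣ {{ℚ.nonNegative (ℚ.0≤∣p∣ q)}} (ℚ.<⇒≤ p<))
      (ℚ.*-monoʳ-<-pos B q<))

*-cauchy : ∀ {x y} → IsCauchy x → IsCauchy y → IsCauchy (λ n → x n ℚ.* y n)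
*-cauchy {x} {y} cx cy ε ε>0 =
  let Bx , Bx>0 , N₁ , h₁ = eventually-bounded cx
      By , By>0 , N₂ , h₂ = eventually-bounded cy
      δx , δx>0 , kx = shrink Bx (½ ℚ.* ε) Bx>0 (half-pos ε>0)
      δy , δy>0 , ky = shrink By (½ ℚ.* ε) By>0 (half-pos ε>0)
      N₃ , h₃ = cy δx δx>0
      N₄ , h₄ = cx δy δy>0
  in (N₁ ℕ.⊔ N₂) ℕ.⊔ (N₃ ℕ.⊔ N₄) , λ m n m≥ n≥ →
       let m₁₂ = max-left {N₁ ℕ.⊔ N₂} m≥
           n₁₂ = max-left {N₁ ℕ.⊔ N₂} n≥
           m₃₄ = max-right {N₁ ℕ.⊔ N₂} m≥
           n₃₄ = max-right {N₁ ℕ.⊔ N₂} n≥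
       in ∣sum∣< (eq (x m) (y m) (x n) (y n))
            (kx (x m) (y m ℚ.- y n) (h₁ m (max-left {N₁} m₁₂))
              (h₃ m n (max-left {N₃} m₃₄) (max-left {N₃} n₃₄)))
            (ky (y n) (x m ℚ.- x n) (h₂ n (max-right {N₁} n₁₂))
              (h₄ m n (max-right {N₃} m₃₄) (max-right {N₃} n₃₄)))
  where
  open +-*-Solver
  eq : ∀ a b c d → (a ℚ.* b) ℚ.- (c ℚ.* d) ≡ a ℚ.* (b ℚ.- d) ℚ.+ d ℚ.* (a ℚ.- c)
  eq = solve 4 (λ a b c d → (a :* b) :- (c :* d) := a :* (b :- d) :+ d :* (a :- c)) refl

≈-refl : ∀ {x} → x ≈ x
≈-refl {x} = mk≈ λ ε ε>0 → 0 , λ n _ →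
  subst (ℚ._< ε) (cong ∣_∣ (sym (ℚ.+-inverseʳ (seq x n)))) ε>0

≈-sym : ∀ {x y} → x ≈ y → y ≈ x
≈-sym {x} {y} (mk≈ h) = mk≈ λ ε ε>0 → let N , hN = h ε ε>0 in
  N , λ n n≥ → subst (ℚ._< ε) (∣∣-sym (seq x n) (seq y n)) (hN n n≥)

≈-trans : ∀ {x y z} → x ≈ y → y ≈ z → x ≈ z
≈-trans {x} {y} {z} (mk≈ h) (mk≈ k) = mk≈ λ ε ε>0 →
  let M , hM = h (½ ℚ.* ε) (half-pos ε>0)
      N , hN = k (½ ℚ.* ε) (half-pos ε>0)
  in M ℕ.⊔ N , λ n n≥ →
       ∣sum∣< (eq (seq x n) (seq y n) (seq z n))
         (hM n (max-left n≥)) (hN n (max-right {M} n≥))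
  where
  open +-*-Solver
  eq : ∀ a b c → a ℚ.- c ≡ (a ℚ.- b) ℚ.+ (b ℚ.- c)
  eq = solve 3 (λ a b c → a :- c := (a :- b) :+ (b :- c)) refl

ℝ-setoid : Setoid 0ℓ 0ℓ
ℝ-setoid = record
  { Carrier       = ℝ
  ; _≈_           = _≈_
  ; isEquivalence = record { refl = ≈-refl ; sym = ≈-sym ; trans = ≈-trans }
  }

infixl 6 _+_ _-_
infixl 7 _*_
infix  8 -_

_+_ : ℝ → ℝ → ℝ
x + y = mkℝ (λ n → seq x n ℚ.+ seq y n) (+-cauchy {seq x} {seq y} (cauchy x) (cauchy y))

-_ : ℝ → ℝ
- x = mkℝ (λ n → ℚ.- seq x n) (neg-cauchy {seq x} (cauchy x))

_-_ : ℝ → ℝ → ℝ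
x - y = x + (- y)

_*_ : ℝ → ℝ → ℝ
x * y = mkℝ (λ n → seq x n ℚ.* seq y n) (*-cauchy {seq x} {seq y} (cauchy x) (cauchy y))

0ℝ : ℝ
0ℝ = mkℝ (λ _ → 0ℚ) (λ ε ε>0 → 0 , λ _ _ _ _ → ε>0)

------------------------------------------------------------------------
-- Finite sets of reals are lists without repetition up to _≈_;
-- membership and inclusion are likewise up to _≈_.

open import Data.List.Membership.Setoid ℝ-setoid public using (_∈_)
open import Data.List.Relation.Binary.Subset.Setoid ℝ-setoid public using (_⊆_)
open import Data.List.Relation.Unary.Unique.Setoid ℝ-setoid public using (Unique)

-- Equality of reals is decidable only classically, so excluded middle is
-- needed to count solutions of equations by natural numbers.

module Energies (em : ExcludedMiddle 0ℓ) where

  infix 4 _≟_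

  _≟_ : Decidable _≈_
  x ≟ y = em

  r₋ : List ℝ → ℝ → ℕ
  r₋ X x = length (filter (λ (a , b) → (a - b) ≟ x) (cartesianProduct X X))

  -- X - X with repetitions removed; r₋ X vanishes off this set.
  differences : List ℝ → List ℝ
  differences X = deduplicate _≟_ (map (uncurry _-_) (cartesianProduct X X))

  E₃⁺ : List ℝ → ℕ
  E₃⁺ X = sum (map (λ x → r₋ X x ℕ.^ 3) (differences X))

  E× : List ℝ → ℕ
  E× Y = length (filter (λ ((y₁ , y₂) , (y₃ , y₄)) → (y₁ * y₂) ≟ (y₃ * y₄))
                        (cartesianProduct (cartesianProduct Y Y) (cartesianProduct Y Y)))

-- The inequality P ≤ C Q (log (2 + n))ᶜ hidden in P ≲ Q, where n = |A|.
-- Rounding the logarithm down to an integer makes the inequality stronger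
-- than with log₂, and since 1 ≤ log₂ (2 + n) ≤ 2 ⌊log₂ (2 + n)⌋ the rounding,
-- the base of the logarithm and the restriction to natural C and c
-- only affect the values of the constants.
LogBound : (C c n P Q : ℕ) → Set
LogBound C c n P Q = P ℕ.≤ C ℕ.* Q ℕ.* ⌊log₂ (2 ℕ.+ n) ⌋ ℕ.^ c

{-# OPTIONS --safe #-}
module Submission where

-- Every nonempty set Z of nonzero reals contains a nonempty set Y with
-- E×(Y)³ E₃⁺(Z)⁴ ≲ |Y|¹² |Z|¹⁰.  Dyadic pigeonholing gives popular differences D with |D| τ³ ≈ E₃⁺(Z),
-- then the set Y of those y which are of the form z - d in at least q ways, where q |Y| ≈ |D| τ, and then
-- popular ratios L of Y with |L| t² ≈ E×(Y).  If y = λ y′ with λ ∈ L, y = z - d and y′ = z′ - d′, then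
-- z - λ z′ = d - λ d′, so that q² t |L| is at most the number of pairs from Z² × D² on a common line of slope
-- in L.  Hölder's inequality and the Szemerédi–Trotter bound on rich lines, for both grids Z² and D², give
-- (q² t |L|)⁶ ≲ |L|³ |Z|¹⁰ |D|⁸, and the parameters q, t, L and D cancel.  For grids that bound follows by
-- cutting the grid into r × r blocks: a line of nonzero slope is monotone, so it meets fewer than 2r of them.
--
-- Removing such sets Y from A until less than half of A is left, let X be the last set of at least half the
-- size, and Y the union of the removed sets.  As E₃⁺ is monotone and the fourth root of E× is subadditive,
-- E₃⁺(X)⁴ E×(Y)³ ≲ |A|²².

open import Defs renaming (_+_ to _+ᵣ_; _*_ to _*ᵣ_; _-_ to _-ᵣ_; -_ to -ᵣ_)
open import Axiom.ExcludedMiddle using (ExcludedMiddle)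
open import Data.Bool.Base using (true; false; if_then_else_)
open import Data.Empty using (⊥)
open import Data.List.Base using (List; []; _∷_; length; map; filter; cartesianProduct; concatMap; _++_; upTo)
open import Data.List.Membership.Propositional using (find; lose) renaming (_∈_ to _∈ₚ_)
open import Data.List.Membership.Propositional.Properties
  using (∈-upTo⁺; ∈-filter⁺; ∈-filter⁻; ∈-map⁺; ∈-map⁻; ∈-concatMap⁻; ∈-cartesianProduct⁺; ∈-cartesianProduct⁻; ∈-++⁺ˡ; ∈-++⁺ʳ; ∈-++⁻)
open import Data.List.Properties using (length-++; length-map; length-filter; length-upTo; length-deduplicate)
open import Data.List.Relation.Unary.All as All using (All; []; _∷_)
import Data.List.Relation.Unary.All.Properties as All
open import Data.List.Relation.Unary.AllPairs as AllPairs using (AllPairs; []; _∷_)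
import Data.List.Relation.Unary.AllPairs.Properties as AllPairs
open import Data.List.Relation.Unary.Any using (here; there)
import Data.List.Relation.Unary.Any.Properties as Any
open import Data.List.Relation.Unary.Unique.DecSetoid.Properties using (deduplicate-!)
open import Data.List.Relation.Unary.Unique.Propositional.Properties using (upTo⁺)
open import Data.Nat.Base as ℕ using (ℕ; zero; suc; _+_; _*_; _∸_; _^_; _≤_; _<_; z≤n; s≤s; s≤s⁻¹; NonZero)
open import Data.Nat.DivMod using (_/_; _%_; m≡m%n+[m/n]*n; m%n<n; /-monoˡ-≤; m<n*o⇒m/o<n; m/n*n≤m)
open import Data.Nat.ListAction using (sum)
open import Data.Nat.Logarithm using (⌊log₂_⌋; ⌊log₂⌋-mono-≤; ⌊log₂[2^n]⌋≡n)
open import Data.Nat.Properties as ℕ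
open import Data.Nat.Solver using (module +-*-Solver)
open import Data.Product.Base using (_×_; _,_; ∃-syntax; proj₁; proj₂; uncurry)
open import Data.Rational.Base as ℚ using (ℚ; 0ℚ; 1ℚ; ½; ∣_∣; positive)
import Data.Rational.Properties as ℚ
open import Data.Rational.Solver using () renaming (module +-*-Solver to ℚ-Solver)
open import Data.Sum.Base using (_⊎_; inj₁; inj₂)
open import Function.Base using (_∘_)
open import Level using (0ℓ)
open import Relation.Binary.Bundles using (DecSetoid)
open import Relation.Binary.PropositionalEquality using (_≡_; refl; sym; trans; cong; cong₂; subst; subst₂; module ≡-Reasoning)
open import Relation.Nullary.Decidable.Core using (Dec; does; yes; no; dec⇒maybe)
open import Relation.Nullary.Negation using (¬_; contradiction)
open import Tactic.RingSolver using (solve-∀)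
open import Tactic.RingSolver.Core.AlmostCommutativeRing using (AlmostCommutativeRing; fromCommutativeRing)

-- Inequalities between natural numbers

-- Third moments of the number of points per line govern the incidence bound, because there the
-- estimate for k-rich lines contributes the same amount at every dyadic scale of k, so that summing
-- over scales costs only a logarithm. With w and v the richness of a line in Z² and in D², J = ∑ w
-- v satisfies J² ≤ (∑ w) (∑ w v²) and (∑ w v²)³ ≤ (∑ v³)² (∑ w³). Then ∑ w ≤ |L| |Z|², ∑ w³ ≲ |Z|⁴
-- and ∑ v³ ≲ |D|⁴ produce the exponents 3, 6 + 4 and 8. One extraction does not suffice, since Y
-- may be far smaller than A. But |Y|¹² is the trivial order of E×(Y)³: the estimate says that the
-- fourth root of E×(Y) is at most c |Y|, with c depending on |A| and E₃⁺ alone. Such estimates add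
-- up over disjoint sets with the same c, so the number of removals never enters. The reals here
-- have no division and all counts are natural numbers. Hence ratios are pairs with cleared
-- denominators, and the irrational c is approached through fractions.

^-cancelˡ-≤ : ∀ k .{{_ : NonZero k}} {x y} → x ^ k ≤ y ^ k → x ≤ y
^-cancelˡ-≤ k {x} {y} le with x ≤? y
... | yes x≤y = x≤y
... | no  x≰y = contradiction le (<⇒≱ (^-monoˡ-< k (≰⇒> x≰y)))

square-cancel-≤ : ∀ x y → x * x ≤ y * y → x ≤ y
square-cancel-≤ x y le with x ≤? y
... | yes x≤y = x≤y
... | no  x≰y = contradiction le (<⇒≱ (*-mono-< (≰⇒> x≰y) (≰⇒> x≰y)))

^-distribʳ-* : ∀ k x y → (x * y) ^ k ≡ x ^ k * y ^ k
^-distribʳ-* zero    x y = refl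
^-distribʳ-* (suc k) x y = trans (cong (x * y *_) (^-distribʳ-* k x y))
  (solve 4 (λ x y a b → x :* y :* (a :* b) := x :* a :* (y :* b)) refl x y (x ^ k) (y ^ k))
  where open +-*-Solver

am-gm : ∀ x a b → x * x ≤ a * b → 2 * x ≤ a + b
am-gm x a b le = square-cancel-≤ (2 * x) (a + b) (begin
  2 * x * (2 * x)   ≡⟨ solve 1 (λ x → con 2 :* x :* (con 2 :* x) := con 4 :* (x :* x)) refl x ⟩
  4 * (x * x)       ≤⟨ *-monoʳ-≤ 4 le ⟩
  4 * (a * b)       ≤⟨ 4ab≤ (≤-total a b) ⟩
  (a + b) * (a + b) ∎)
  where
  open ≤-Reasoning
  open +-*-Solver
  -- With d the gap between the two numbers, the square of the sum exceeds four times the product by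
  -- exactly d². The numbers are ordered beforehand because subtraction on ℕ truncates.
  ordered : ∀ a d → 4 * (a * (a + d)) ≤ (a + (a + d)) * (a + (a + d))
  ordered a d = ≤-trans (m≤m+n _ (d * d)) (≤-reflexive
    (solve 2 (λ a d → con 4 :* (a :* (a :+ d)) :+ d :* d
       := (a :+ (a :+ d)) :* (a :+ (a :+ d))) refl a d))
  4ab≤ : _ → 4 * (a * b) ≤ (a + b) * (a + b)
  4ab≤ (inj₁ a≤b) = subst (λ t → 4 * (a * t) ≤ (a + t) * (a + t)) (m+[n∸m]≡n a≤b) (ordered a (b ∸ a))
  4ab≤ (inj₂ b≤a) = subst₂ _≤_ (cong (4 *_) (*-comm b a)) (cong₂ _*_ (+-comm b a) (+-comm b a))
    (subst (λ t → 4 * (b * t) ≤ (b + t) * (b + t)) (m+[n∸m]≡n b≤a) (ordered b (a ∸ b)))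

-- Sums over lists

∑ : {X : Set} → List X → (X → ℕ) → ℕ
∑ xs f = sum (map f xs)

infixr 5 ∑
syntax ∑ xs (λ x → e) = ∑[ x ∈ xs ] e

module _ {X : Set} where

  ∑-mono-∈ : ∀ xs {f g : X → ℕ} → (∀ {x} → x ∈ₚ xs → f x ≤ g x) → ∑ xs f ≤ ∑ xs g
  ∑-mono-∈ []       le = z≤n
  ∑-mono-∈ (x ∷ xs) le = +-mono-≤ (le (here refl)) (∑-mono-∈ xs (le ∘ there))

  ∑-mono : ∀ xs {f g : X → ℕ} → (∀ x → f x ≤ g x) → ∑ xs f ≤ ∑ xs g
  ∑-mono xs le = ∑-mono-∈ xs (λ {x} _ → le x)

  ∑-cong : ∀ xs {f g : X → ℕ} → (∀ x → f x ≡ g x) → ∑ xs f ≡ ∑ xs g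
  ∑-cong []       eq = refl
  ∑-cong (x ∷ xs) eq = cong₂ _+_ (eq x) (∑-cong xs eq)

  ∑-distrib-+ : ∀ xs (f g : X → ℕ) → ∑[ x ∈ xs ] (f x + g x) ≡ ∑ xs f + ∑ xs g
  ∑-distrib-+ []       f g = refl
  ∑-distrib-+ (x ∷ xs) f g = trans (cong (f x + g x +_) (∑-distrib-+ xs f g))
    (solve 4 (λ a b c d → a :+ b :+ (c :+ d) := a :+ c :+ (b :+ d)) refl (f x) (g x) (∑ xs f) (∑ xs g))
    where open +-*-Solver

  *-distribˡ-∑ : ∀ k xs (f : X → ℕ) → k * ∑ xs f ≡ ∑[ x ∈ xs ] (k * f x)
  *-distribˡ-∑ k []       f = *-zeroʳ k
  *-distribˡ-∑ k (x ∷ xs) f = trans (*-distribˡ-+ k (f x) _) (cong (k * f x +_) (*-distribˡ-∑ k xs f))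

  *-distribʳ-∑ : ∀ k xs (f : X → ℕ) → ∑ xs f * k ≡ ∑[ x ∈ xs ] (f x * k)
  *-distribʳ-∑ k []       f = refl
  *-distribʳ-∑ k (x ∷ xs) f = trans (*-distribʳ-+ k (f x) _) (cong (f x * k +_) (*-distribʳ-∑ k xs f))

  ∑-const : ∀ xs k → ∑[ x ∈ xs ] k ≡ length {A = X} xs * k
  ∑-const []       k = refl
  ∑-const (x ∷ xs) k = cong (k +_) (∑-const xs k)

  ∑-bound : ∀ xs {f : X → ℕ} {k} → (∀ {x} → x ∈ₚ xs → f x ≤ k) → ∑ xs f ≤ length xs * k
  ∑-bound xs {k = k} le = ≤-trans (∑-mono-∈ xs le) (≤-reflexive (∑-const xs k))

  ∑-++ : ∀ xs ys (f : X → ℕ) → ∑ (xs ++ ys) f ≡ ∑ xs f + ∑ ys f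
  ∑-++ []       ys f = refl
  ∑-++ (x ∷ xs) ys f = trans (cong (f x +_) (∑-++ xs ys f)) (sym (+-assoc (f x) _ _))

  term≤∑ : ∀ {xs x} (f : X → ℕ) → x ∈ₚ xs → f x ≤ ∑ xs f
  term≤∑ f (here refl)       = m≤m+n _ _
  term≤∑ {y ∷ _} f (there i) = ≤-trans (term≤∑ f i) (m≤n+m _ (f y))

  -- Pigeonhole. The seed `x₀` makes the empty list harmless; it may also be the witness for other
  -- lists, so the witness need not occur in `xs`.
  ∑-max : X → ∀ xs (f : X → ℕ) → ∃[ x ] ∑ xs f ≤ length xs * f x
  ∑-max x₀ []       f = x₀ , z≤n
  ∑-max x₀ (x ∷ xs) f with ∑-max x₀ xs f
  ... | y , le with ≤-total (f x) (f y)
  ...   | inj₁ x≤y = y , +-mono-≤ x≤y le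
  ...   | inj₂ y≤x = x , +-monoʳ-≤ (f x) (≤-trans le (*-monoʳ-≤ (length xs) y≤x))

  -- The pointwise hypothesis f² ≤ g h avoids square roots. By induction: the cross term 2 f F is
  -- controlled by `am-gm` for g H and G h, whose product dominates (f F)².
  cauchy-schwarz : ∀ xs {f g h : X → ℕ} → (∀ x → f x * f x ≤ g x * h x) →
                   ∑ xs f * ∑ xs f ≤ ∑ xs g * ∑ xs h
  cauchy-schwarz []       le = z≤n
  cauchy-schwarz (x ∷ xs) {f} {g} {h} le = begin
    (f x + F) * (f x + F)                         ≡⟨ expand (f x) F ⟩
    f x * f x + 2 * (f x * F) + F * F             ≤⟨ +-mono-≤ (+-mono-≤ (le x) cross) ih ⟩
    g x * h x + (g x * H + G * h x) + G * H       ≡⟨ solve 4 (λ a b c d → a :* b :+ (a :* d :+ c :* b) :+ c :* d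
                                                       := (a :+ c) :* (b :+ d)) refl (g x) (h x) G H ⟩
    (g x + G) * (h x + H)                         ∎
    where
    open ≤-Reasoning
    open +-*-Solver
    F = ∑ xs f
    G = ∑ xs g
    H = ∑ xs h
    ih : F * F ≤ G * H
    ih = cauchy-schwarz xs le
    expand : ∀ a b → (a + b) * (a + b) ≡ a * a + 2 * (a * b) + b * b
    expand = solve 2 (λ a b → (a :+ b) :* (a :+ b) := a :* a :+ con 2 :* (a :* b) :+ b :* b) refl
    cross : 2 * (f x * F) ≤ g x * H + G * h x
    cross = am-gm (f x * F) (g x * H) (G * h x) (begin
      f x * F * (f x * F)   ≡⟨ solve 2 (λ a b → a :* b :* (a :* b) := a :* a :* (b :* b)) refl (f x) F ⟩
      f x * f x * (F * F)   ≤⟨ *-mono-≤ (le x) ih ⟩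
      g x * h x * (G * H)   ≡⟨ solve 4 (λ a b c d → a :* b :* (c :* d) := a :* d :* (c :* b)) refl (g x) (h x) G H ⟩
      g x * H * (G * h x)   ∎)

  -- Hölder with exponents 3 and 3/2, from two uses of Cauchy-Schwarz: P² ≤ V Q and Q² ≤ W P give P⁴
  -- ≤ V² Q² ≤ V² W P, and one factor P cancels.
  hölder : ∀ xs (w v : X → ℕ) →
           (∑[ x ∈ xs ] (w x * v x ^ 2)) ^ 3 ≤ (∑[ x ∈ xs ] v x ^ 3) ^ 2 * (∑[ x ∈ xs ] w x ^ 3)
  hölder xs w v = cancel P P⁴≤
    where
    open ≤-Reasoning
    open +-*-Solver
    P = ∑[ x ∈ xs ] (w x * v x ^ 2)
    Q = ∑[ x ∈ xs ] (w x ^ 2 * v x)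
    V = ∑[ x ∈ xs ] (v x ^ 3)
    W = ∑[ x ∈ xs ] (w x ^ 3)
    PP≤ : P * P ≤ V * Q
    PP≤ = cauchy-schwarz xs λ x → ≤-reflexive
      (solve 2 (λ w v → w :* v :^ 2 :* (w :* v :^ 2) := v :^ 3 :* (w :^ 2 :* v)) refl (w x) (v x))
    QQ≤ : Q * Q ≤ W * P
    QQ≤ = cauchy-schwarz xs λ x → ≤-reflexive
      (solve 2 (λ w v → w :^ 2 :* v :* (w :^ 2 :* v) := w :^ 3 :* (w :* v :^ 2)) refl (w x) (v x))
    P⁴≤ : P * P ^ 3 ≤ P * (V ^ 2 * W)
    P⁴≤ = begin
      P * P ^ 3           ≡⟨ solve 1 (λ p → p :* p :^ 3 := p :* p :* (p :* p)) refl P ⟩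
      P * P * (P * P)     ≤⟨ *-mono-≤ PP≤ PP≤ ⟩
      V * Q * (V * Q)     ≡⟨ solve 2 (λ v q → v :* q :* (v :* q) := v :^ 2 :* (q :* q)) refl V Q ⟩
      V ^ 2 * (Q * Q)     ≤⟨ *-monoʳ-≤ (V ^ 2) QQ≤ ⟩
      V ^ 2 * (W * P)     ≡⟨ solve 3 (λ v w p → v :^ 2 :* (w :* p) := p :* (v :^ 2 :* w)) refl V W P ⟩
      P * (V ^ 2 * W)     ∎
    cancel : ∀ p → p * p ^ 3 ≤ p * (V ^ 2 * W) → p ^ 3 ≤ V ^ 2 * W
    cancel zero      _  = z≤n
    cancel p@(suc _) le = *-cancelˡ-≤ p le

module _ {X Y : Set} where

  ∑-swap : ∀ xs ys (f : X → Y → ℕ) →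
           ∑[ x ∈ xs ] ∑[ y ∈ ys ] f x y ≡ ∑[ y ∈ ys ] ∑[ x ∈ xs ] f x y
  ∑-swap []       ys f = sym (trans (∑-const ys 0) (*-zeroʳ (length ys)))
  ∑-swap (x ∷ xs) ys f = trans (cong (∑ ys (f x) +_) (∑-swap xs ys f))
    (sym (∑-distrib-+ ys (f x) (λ y → ∑[ x′ ∈ xs ] f x′ y)))

  ∑-map : ∀ (h : X → Y) xs f → ∑ (map h xs) f ≡ ∑ xs (f ∘ h)
  ∑-map h []       f = refl
  ∑-map h (x ∷ xs) f = cong (f (h x) +_) (∑-map h xs f)

module _ {X Y : Set} where

  ∑-cartesianProduct : ∀ (xs : List X) (ys : List Y) f →
    ∑ (cartesianProduct xs ys) f ≡ ∑[ x ∈ xs ] ∑[ y ∈ ys ] f (x , y)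
  ∑-cartesianProduct []       ys f = refl
  ∑-cartesianProduct (x ∷ xs) ys f =
    trans (∑-++ (map (x ,_) ys) (cartesianProduct xs ys) f)
      (cong₂ _+_ (∑-map (x ,_) ys f) (∑-cartesianProduct xs ys f))

  ∑-* : ∀ (xs : List X) (ys : List Y) f g →
        ∑ xs f * ∑ ys g ≡ ∑[ x ∈ xs ] ∑[ y ∈ ys ] (f x * g y)
  ∑-* xs ys f g = trans (*-distribʳ-∑ (∑ ys g) xs f) (∑-cong xs λ x → *-distribˡ-∑ (f x) ys g)

-- Indicators of decidable propositions

χ : {P : Set} → Dec P → ℕ
χ d = if does d then 1 else 0

module _ {P : Set} where

  χ-yes : (d : Dec P) → P → χ d ≡ 1
  χ-yes (yes _) _ = refl
  χ-yes (no ¬p) p = contradiction p ¬p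

  χ≤1 : (d : Dec P) → χ d ≤ 1
  χ≤1 (yes _) = ≤-refl
  χ≤1 (no  _) = z≤n

  χ*-≤ : ∀ (d : Dec P) {k m} → (P → k ≤ m) → χ d * k ≤ m
  χ*-≤ (yes p) {k} le = ≤-trans (≤-reflexive (*-identityˡ k)) (le p)
  χ*-≤ (no  _)     le = z≤n

  χ-≤ : ∀ (d : Dec P) {m} → (P → 1 ≤ m) → χ d ≤ m
  χ-≤ (yes p) le = le p
  χ-≤ (no  _) le = z≤n

χ-mono : ∀ {P Q : Set} (d : Dec P) (e : Dec Q) → (P → Q) → χ d ≤ χ e
χ-mono d e imp = χ-≤ d (λ p → ≤-reflexive (sym (χ-yes e (imp p))))

χ-*-mono : ∀ {P Q R : Set} (d : Dec P) (e : Dec Q) (f : Dec R) → (P → Q → R) → χ d * χ e ≤ χ f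
χ-*-mono d e f imp = χ*-≤ d λ p → χ-mono e f (imp p)

module _ {X : Set} {P : X → Set} (P? : ∀ x → Dec (P x)) where

  length-filter-χ : ∀ xs → length (filter P? xs) ≡ ∑[ x ∈ xs ] χ (P? x)
  length-filter-χ []       = refl
  length-filter-χ (x ∷ xs) with does (P? x)
  ... | true  = cong suc (length-filter-χ xs)
  ... | false = length-filter-χ xs

  ∑-filter : ∀ xs f → ∑ (filter P? xs) f ≡ ∑[ x ∈ xs ] (χ (P? x) * f x)
  ∑-filter []       f = refl
  ∑-filter (x ∷ xs) f with does (P? x)
  ... | true  = cong₂ _+_ (sym (*-identityˡ (f x))) (∑-filter xs f)
  ... | false = ∑-filter xs f

  1≤∑χ : ∀ {xs x} → x ∈ₚ xs → P x → 1 ≤ ∑[ x ∈ xs ] χ (P? x)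
  1≤∑χ {x = x} i p = ≤-trans (≤-reflexive (sym (χ-yes (P? x) p))) (term≤∑ (χ ∘ P?) i)

  -- The common form of all uniqueness arguments below: entries are pairwise related by some R, such
  -- as being different, and two entries with property P cannot be.
  ∑χ≤1 : ∀ {R : X → X → Set} {xs} → AllPairs R xs →
         (∀ {x y} → x ∈ₚ xs → y ∈ₚ xs → P x → P y → ¬ R x y) → ∑[ x ∈ xs ] χ (P? x) ≤ 1
  ∑χ≤1 []                          _  = z≤n
  ∑χ≤1 {xs = x ∷ xs} (Rx ∷ Rxs) ne = bound (P? x)
    where
    vanish : P x → ∀ {y} → y ∈ₚ xs → χ (P? y) ≤ 0
    vanish px {y} i = χ-≤ (P? y) λ py → contradiction (All.lookup Rx i) (ne (here refl) (there i) px py)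
    bound : (d : Dec (P x)) → χ d + ∑ xs (χ ∘ P?) ≤ 1
    bound (yes px) = s≤s (≤-trans (∑-bound xs (vanish px)) (≤-reflexive (*-zeroʳ (length xs))))
    bound (no  _)  = ∑χ≤1 Rxs (λ i j → ne (there i) (there j))

  ∑χ≤length : ∀ xs → ∑[ x ∈ xs ] χ (P? x) ≤ length xs
  ∑χ≤length xs = ≤-trans (∑-bound xs (λ {x} _ → χ≤1 (P? x))) (≤-reflexive (*-identityʳ _))

-- Superlevel sets

level : {X : Set} → (X → ℕ) → ℕ → List X → List X
level f t = filter (λ x → t ≤? f x)

module _ {X : Set} (f : X → ℕ) where

  level-∈ : ∀ t xs {x} → x ∈ₚ level f t xs → t ≤ f x
  level-∈ t xs i = proj₂ (∈-filter⁻ (λ x → t ≤? f x) {xs = xs} i)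

  level-⊆ : ∀ t xs {x} → x ∈ₚ level f t xs → x ∈ₚ xs
  level-⊆ t xs i = proj₁ (∈-filter⁻ (λ x → t ≤? f x) {xs = xs} i)

  private
    dyadic : ∀ h {y} → 0 < y → y < 2 ^ h → ∃[ j ] (j < h × 2 ^ j ≤ y × y ≤ 2 * 2 ^ j)
    dyadic zero    0<y y<1 = contradiction (s≤s⁻¹ y<1) (<⇒≱ 0<y)
    dyadic (suc h) {y} 0<y y< with y <? 2 ^ h
    ... | yes y<2^h = let j , j<h , lo , hi = dyadic h 0<y y<2^h in j , m≤n⇒m≤1+n j<h , lo , hi
    ... | no  y≮2^h = h , ≤-refl , ≮⇒≥ y≮2^h , <⇒≤ y<

  -- A nonzero value lies between some 2ʲ and 2ʲ⁺¹ with j < h, so its p-th power is at most 2ᵖ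
  -- (2ʲ)ᵖ; one of the h scales then carries at least the average. Superlevel sets replace dyadic
  -- layers, as later arguments use only the lower bound t on the values.
  dyadic-pigeonhole : ∀ p .{{_ : NonZero p}} h xs → (∀ {x} → x ∈ₚ xs → f x < 2 ^ h) →
    ∃[ t ] ∑[ x ∈ xs ] f x ^ p ≤ 2 ^ p * h * (t ^ p * length (level f t xs))
  dyadic-pigeonhole p h xs bound with ∑-max 0 (upTo h) (λ j → (2 ^ j) ^ p * length (level f (2 ^ j) xs))
  ... | j , le = 2 ^ j , (begin
    ∑[ x ∈ xs ] f x ^ p                                           ≤⟨ ∑-mono-∈ xs (λ {x} i → pointwise x (bound i)) ⟩
    ∑[ x ∈ xs ] ∑[ i ∈ upTo h ] (2 ^ p * (2 ^ i) ^ p * reach i x) ≡⟨ ∑-swap xs (upTo h) _ ⟩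
    ∑[ i ∈ upTo h ] ∑[ x ∈ xs ] (2 ^ p * (2 ^ i) ^ p * reach i x) ≡⟨ ∑-cong (upTo h) collect ⟩
    ∑[ i ∈ upTo h ] (2 ^ p * ((2 ^ i) ^ p * length (level f (2 ^ i) xs)))
                                                                  ≡⟨ *-distribˡ-∑ (2 ^ p) (upTo h) _ ⟨
    2 ^ p * (∑[ i ∈ upTo h ] (2 ^ i) ^ p * length (level f (2 ^ i) xs)) ≤⟨ *-monoʳ-≤ (2 ^ p) le ⟩
    2 ^ p * (length (upTo h) * m)                                 ≡⟨ cong (λ l → 2 ^ p * (l * m)) (length-upTo h) ⟩
    2 ^ p * (h * m)                                               ≡⟨ *-assoc (2 ^ p) h m ⟨
    2 ^ p * h * m                                                 ∎)
    where
    open ≤-Reasoning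
    m = (2 ^ j) ^ p * length (level f (2 ^ j) xs)
    reach : ℕ → X → ℕ
    reach i x = χ (2 ^ i ≤? f x)
    collect : ∀ i → ∑[ x ∈ xs ] (2 ^ p * (2 ^ i) ^ p * reach i x)
                  ≡ 2 ^ p * ((2 ^ i) ^ p * length (level f (2 ^ i) xs))
    collect i = begin-equality
      ∑[ x ∈ xs ] (2 ^ p * (2 ^ i) ^ p * reach i x)  ≡⟨ *-distribˡ-∑ (2 ^ p * (2 ^ i) ^ p) xs _ ⟨
      2 ^ p * (2 ^ i) ^ p * (∑[ x ∈ xs ] reach i x)  ≡⟨ cong (2 ^ p * (2 ^ i) ^ p *_) (length-filter-χ (λ x → 2 ^ i ≤? f x) xs) ⟨
      2 ^ p * (2 ^ i) ^ p * length (level f (2 ^ i) xs) ≡⟨ *-assoc (2 ^ p) _ _ ⟩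
      2 ^ p * ((2 ^ i) ^ p * length (level f (2 ^ i) xs)) ∎
    0^p : ∀ p .{{_ : NonZero p}} → 0 ^ p ≡ 0
    0^p (suc _) = refl
    -- The value 0 belongs to no scale; its p-th power vanishes since p is nonzero.
    pointwise : ∀ x → f x < 2 ^ h → f x ^ p ≤ ∑[ i ∈ upTo h ] (2 ^ p * (2 ^ i) ^ p * reach i x)
    pointwise x f<2^h with f x in eq
    ... | zero  = ≤-trans (≤-reflexive (0^p p)) z≤n
    ... | suc y rewrite sym eq = let i , i<h , lo , hi = dyadic h (subst (0 <_) (sym eq) (s≤s z≤n)) f<2^h in begin
      f x ^ p                                  ≤⟨ ^-monoˡ-≤ p hi ⟩
      (2 * 2 ^ i) ^ p                          ≡⟨ ^-distribʳ-* p 2 (2 ^ i) ⟩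
      2 ^ p * (2 ^ i) ^ p                      ≡⟨ *-identityʳ _ ⟨
      2 ^ p * (2 ^ i) ^ p * 1                  ≡⟨ cong (2 ^ p * (2 ^ i) ^ p *_) (χ-yes (2 ^ i ≤? f x) lo) ⟨
      2 ^ p * (2 ^ i) ^ p * reach i x       ≤⟨ term≤∑ (λ i → 2 ^ p * (2 ^ i) ^ p * reach i x) (∈-upTo⁺ i<h) ⟩
      ∑[ i ∈ upTo h ] (2 ^ p * (2 ^ i) ^ p * reach i x) ∎

∑-filter≤ : {X : Set} {P : X → Set} (P? : ∀ x → Dec (P x)) (xs : List X) (g : X → ℕ) → ∑ (filter P? xs) g ≤ ∑ xs g
∑-filter≤ P? xs g = ≤-trans (≤-reflexive (∑-filter P? xs g)) (∑-mono xs λ x → χ*-≤ (P? x) λ _ → ≤-refl)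

∑-level≤ : {X : Set} (f : X → ℕ) (t : ℕ) (xs : List X) (g : X → ℕ) → ∑ (level f t xs) g ≤ ∑ xs g
∑-level≤ f t = ∑-filter≤ (λ x → t ≤? f x)

length-cartesianProduct : {X Y : Set} (xs : List X) (ys : List Y) → length (cartesianProduct xs ys) ≡ length xs * length ys
length-cartesianProduct []       ys = refl
length-cartesianProduct (x ∷ xs) ys = trans (length-++ (map (x ,_) ys))
  (cong₂ _+_ (length-map (x ,_) ys) (length-cartesianProduct xs ys))

module _ {X : Set} (f : X → ℕ) (q : ℕ) where

  below : List X → List X
  below = filter (λ x → f x <? q)

  level+below : ∀ xs → length (level f q xs) + length (below xs) ≡ length xs
  level+below xs = begin
    length (level f q xs) + length (below xs)
      ≡⟨ cong₂ _+_ (length-filter-χ (λ x → q ≤? f x) xs) (length-filter-χ (λ x → f x <? q) xs) ⟩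
    (∑[ x ∈ xs ] χ (q ≤? f x)) + (∑[ x ∈ xs ] χ (f x <? q))
      ≡⟨ ∑-distrib-+ xs _ _ ⟨
    ∑[ x ∈ xs ] (χ (q ≤? f x) + χ (f x <? q))
      ≡⟨ ∑-cong xs (λ x → χ-complement (q ≤? f x) (f x <? q) ≤⇒≯ ≰⇒>) ⟩
    ∑[ x ∈ xs ] 1
      ≡⟨ trans (∑-const xs 1) (*-identityʳ _) ⟩
    length xs ∎
    where
    open ≡-Reasoning
    χ-complement : ∀ {P Q : Set} (d : Dec P) (e : Dec Q) → (P → ¬ Q) → (¬ P → Q) → χ d + χ e ≡ 1
    χ-complement (yes p) (yes q) ¬q _ = contradiction q (¬q p)
    χ-complement (yes _) (no  _) _  _ = refl
    χ-complement (no  _) (yes _) _  _ = refl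
    χ-complement (no ¬p) (no ¬q) _  q = contradiction (q ¬p) ¬q

module _ {X : Set} where

  -- Cauchy–Schwarz over the K classes of κ.
  collisions : ∀ (xs : List X) (f : X → ℕ) (κ : X → ℕ) K → (∀ {x} → x ∈ₚ xs → 1 ≤ f x → κ x ℕ.< K) →
    ∑ xs f * ∑ xs f ≤ K * (∑[ x ∈ xs ] ∑[ y ∈ xs ] (f x * f y * χ (κ x ≟ κ y)))
  collisions xs f κ K κ<K = begin
    ∑ xs f * ∑ xs f                                       ≤⟨ *-mono-≤ split split ⟩
    ∑ (upTo K) part * ∑ (upTo K) part                     ≤⟨ cauchy-schwarz (upTo K) {part} {λ _ → 1} {λ k → part k * part k}
                                                               (λ k → ≤-reflexive (sym (*-identityˡ _))) ⟩
    (∑[ k ∈ upTo K ] 1) * (∑[ k ∈ upTo K ] part k * part k) ≤⟨ *-mono-≤ (≤-reflexive (trans (∑-const (upTo K) 1)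
                                                               (trans (*-identityʳ _) (length-upTo K)))) pairs ⟩
    K * (∑[ x ∈ xs ] ∑[ y ∈ xs ] (f x * f y * χ (κ x ≟ κ y))) ∎
    where
    open ≤-Reasoning
    open +-*-Solver
    part : ℕ → ℕ
    part k = ∑[ x ∈ xs ] (f x * χ (κ x ≟ k))
    one : ∀ {x} → x ∈ₚ xs → f x ≤ ∑[ k ∈ upTo K ] (f x * χ (κ x ≟ k))
    one {x} i with f x in eq
    ... | zero  = z≤n
    ... | suc n = ≤-trans (≤-reflexive (sym (*-identityʳ (suc n))))
      (≤-trans (*-monoʳ-≤ (suc n) (1≤∑χ (λ k → κ x ≟ k) (∈-upTo⁺ (κ<K i (subst (1 ≤_) (sym eq) (s≤s z≤n)))) refl))
        (≤-reflexive (*-distribˡ-∑ (suc n) (upTo K) _)))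
    split : ∑ xs f ≤ ∑ (upTo K) part
    split = ≤-trans (∑-mono-∈ xs one) (≤-reflexive (∑-swap xs (upTo K) _))
    same : ∀ x y k → χ (κ x ≟ k) * χ (κ y ≟ k) ≤ χ (κ x ≟ κ y) * χ (κ x ≟ k)
    same x y k = χ*-≤ (κ x ≟ k) λ x∈k → χ-≤ (κ y ≟ k) λ y∈k →
      ≤-reflexive (sym (cong₂ _*_ (χ-yes (κ x ≟ κ y) (trans x∈k (sym y∈k))) (χ-yes (κ x ≟ k) x∈k)))
    pairs : ∑[ k ∈ upTo K ] part k * part k ≤ ∑[ x ∈ xs ] ∑[ y ∈ xs ] (f x * f y * χ (κ x ≟ κ y))
    pairs = begin
      ∑[ k ∈ upTo K ] part k * part k
        ≡⟨ ∑-cong (upTo K) (λ k → ∑-* xs xs _ _) ⟩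
      ∑[ k ∈ upTo K ] ∑[ x ∈ xs ] ∑[ y ∈ xs ] (f x * χ (κ x ≟ k) * (f y * χ (κ y ≟ k)))
        ≡⟨ ∑-swap (upTo K) xs _ ⟩
      ∑[ x ∈ xs ] ∑[ k ∈ upTo K ] ∑[ y ∈ xs ] (f x * χ (κ x ≟ k) * (f y * χ (κ y ≟ k)))
        ≡⟨ ∑-cong xs (λ x → ∑-swap (upTo K) xs _) ⟩
      ∑[ x ∈ xs ] ∑[ y ∈ xs ] ∑[ k ∈ upTo K ] (f x * χ (κ x ≟ k) * (f y * χ (κ y ≟ k)))
        ≤⟨ ∑-mono xs (λ x → ∑-mono xs (pair x)) ⟩
      ∑[ x ∈ xs ] ∑[ y ∈ xs ] (f x * f y * χ (κ x ≟ κ y)) ∎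
      where
      pair : ∀ x y → ∑[ k ∈ upTo K ] (f x * χ (κ x ≟ k) * (f y * χ (κ y ≟ k))) ≤ f x * f y * χ (κ x ≟ κ y)
      pair x y = begin
        ∑[ k ∈ upTo K ] (f x * χ (κ x ≟ k) * (f y * χ (κ y ≟ k)))
          ≡⟨ ∑-cong (upTo K) (λ k → solve 4 (λ a b c d → a :* b :* (c :* d) := a :* c :* (b :* d)) refl
               (f x) (χ (κ x ≟ k)) (f y) (χ (κ y ≟ k))) ⟩
        ∑[ k ∈ upTo K ] (f x * f y * (χ (κ x ≟ k) * χ (κ y ≟ k)))
          ≡⟨ *-distribˡ-∑ (f x * f y) (upTo K) _ ⟨
        f x * f y * (∑[ k ∈ upTo K ] (χ (κ x ≟ k) * χ (κ y ≟ k)))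
          ≤⟨ *-monoʳ-≤ (f x * f y) (∑-mono (upTo K) (same x y)) ⟩
        f x * f y * (∑[ k ∈ upTo K ] (χ (κ x ≟ κ y) * χ (κ x ≟ k)))
          ≡⟨ cong (f x * f y *_) (*-distribˡ-∑ (χ (κ x ≟ κ y)) (upTo K) _) ⟨
        f x * f y * (χ (κ x ≟ κ y) * (∑[ k ∈ upTo K ] χ (κ x ≟ k)))
          ≤⟨ *-monoʳ-≤ (f x * f y) (*-monoʳ-≤ (χ (κ x ≟ κ y))
               (∑χ≤1 (λ k → κ x ≟ k) (upTo⁺ K) λ _ _ eq eq′ ne → ne (trans (sym eq) eq′))) ⟩
        f x * f y * (χ (κ x ≟ κ y) * 1)
          ≡⟨ cong (f x * f y *_) (*-identityʳ _) ⟩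
        f x * f y * χ (κ x ≟ κ y) ∎

-- Eventual behaviour of rational sequences

Null : (ℕ → ℚ) → Set
Null f = ∀ ε → 0ℚ ℚ.< ε → ∃[ N ] (∀ n → N ℕ.≤ n → ∣ f n ∣ ℚ.< ε)

-- The bound ε is uniform, because a sequence of positive terms may still represent 0.
EventuallyPos : (ℕ → ℚ) → Set
EventuallyPos f = ∃[ ε ] (0ℚ ℚ.< ε × ∃[ N ] (∀ n → N ℕ.≤ n → ε ℚ.≤ f n))

Null-cong : ∀ {f g} → (∀ n → f n ≡ g n) → Null f → Null g
Null-cong eq nf ε ε>0 = let N , h = nf ε ε>0 in
  N , λ n n≥ → subst (λ t → ∣ t ∣ ℚ.< ε) (eq n) (h n n≥)

Null-+ : ∀ {f g} → Null f → Null g → Null (λ n → f n ℚ.+ g n)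
Null-+ nf ng ε ε>0 =
  let M , h = nf (½ ℚ.* ε) (half-pos ε>0)
      N , k = ng (½ ℚ.* ε) (half-pos ε>0)
  in M ℕ.⊔ N , λ n n≥ → ∣sum∣< refl (h n (max-left n≥)) (k n (max-right {M} n≥))

Null-* : ∀ (x : ℝ) {f} → Null f → Null (λ n → seq x n ℚ.* f n)
Null-* x {f} nf ε ε>0 =
  let B , B>0 , M , h = eventually-bounded (cauchy x)
      δ , δ>0 , k     = shrink B ε B>0 ε>0
      N , l           = nf δ δ>0
  in M ℕ.⊔ N , λ n n≥ → k (seq x n) (f n) (h n (max-left n≥)) (l n (max-right {M} n≥))

pos-cong : ∀ {f g} → (∀ n → f n ≡ g n) → EventuallyPos f → EventuallyPos g
pos-cong eq (ε , ε>0 , N , h) = ε , ε>0 , N , λ n n≥ → subst (ε ℚ.≤_) (eq n) (h n n≥)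

pos-+ : ∀ {f g} → EventuallyPos f → EventuallyPos g → EventuallyPos (λ n → f n ℚ.+ g n)
pos-+ {f} (ε , ε>0 , M , h) (δ , δ>0 , N , k) = ε ℚ.+ δ , ℚ.+-mono-< ε>0 δ>0 , M ℕ.⊔ N ,
  λ n n≥ → ℚ.+-mono-≤ (h n (max-left n≥)) (k n (max-right {M} n≥))

pos-* : ∀ {f g} → EventuallyPos f → EventuallyPos g → EventuallyPos (λ n → f n ℚ.* g n)
pos-* {f} {g} (ε , ε>0 , M , h) (δ , δ>0 , N , k) =
  ε ℚ.* δ , ℚ.positive⁻¹ _ {{ℚ.pos*pos⇒pos ε δ}} , M ℕ.⊔ N , λ n n≥ → bound n (h n (max-left n≥)) (k n (max-right {M} n≥))
  where
  instance
    _ = positive ε>0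
    _ = positive δ>0
    _ = ℚ.pos⇒nonNeg ε
  bound : ∀ n → ε ℚ.≤ f n → δ ℚ.≤ g n → ε ℚ.* δ ℚ.≤ f n ℚ.* g n
  bound n ε≤ δ≤ = ℚ.≤-trans (ℚ.*-monoˡ-≤-nonNeg ε δ≤)
    (ℚ.*-monoʳ-≤-nonNeg (g n) {{ℚ.nonNegative (ℚ.≤-trans (ℚ.<⇒≤ δ>0) δ≤)}} ε≤)

p≤∣p∣ : ∀ p → p ℚ.≤ ∣ p ∣
p≤∣p∣ p with ℚ.≤-total p 0ℚ
... | inj₁ p≤0 = ℚ.≤-trans p≤0 (ℚ.0≤∣p∣ p)
... | inj₂ 0≤p = ℚ.≤-reflexive (sym (ℚ.0≤p⇒∣p∣≡p 0≤p))

pos⇒¬Null : ∀ {f} → EventuallyPos f → ¬ Null f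
pos⇒¬Null {f} (ε , ε>0 , M , h) nf =
  let N , k = nf ε ε>0
      n = M ℕ.⊔ N
      ε≤∣f∣ = ℚ.≤-trans (h n (ℕ.m≤m⊔n M N)) (p≤∣p∣ (f n))
  in ℚ.<-irrefl refl (ℚ.<-≤-trans (k n (ℕ.m≤n⊔m M N)) ε≤∣f∣)

pos-exclusive : ∀ {f g h} → EventuallyPos f → EventuallyPos g → Null h → (∀ n → f n ℚ.+ g n ≡ h n) → ⊥
pos-exclusive pf pg nh eq = pos⇒¬Null (pos-cong eq (pos-+ pf pg)) nh

-- The substitute for division by a nonzero real: once |f n| ≥ ε, the estimate |f n g n| < ε δ
-- forces |g n| < δ.
Null-cancel : ∀ {f g} → EventuallyPos f ⊎ EventuallyPos (λ n → ℚ.- f n) →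
              Null (λ n → f n ℚ.* g n) → Null g
Null-cancel {f} {g} (inj₁ (ε , ε>0 , M , h)) nfg δ δ>0 =
  let N , k = nfg (ε ℚ.* δ) (ℚ.positive⁻¹ _ {{ℚ.pos*pos⇒pos ε δ}})
  in M ℕ.⊔ N , λ n n≥ → bound n (h n (max-left n≥)) (k n (max-right {M} n≥))
  where
  instance
    _ = positive ε>0
    _ = positive δ>0
    _ = ℚ.pos⇒nonNeg ε
  bound : ∀ n → ε ℚ.≤ f n → ∣ f n ℚ.* g n ∣ ℚ.< ε ℚ.* δ → ∣ g n ∣ ℚ.< δ
  bound n ε≤ fg< = ℚ.≰⇒> λ δ≤ → ℚ.<-irrefl refl (ℚ.<-≤-trans fg< (subst (ε ℚ.* δ ℚ.≤_) (sym (ℚ.∣p*q∣≡∣p∣*∣q∣ (f n) (g n)))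
    (ℚ.≤-trans (ℚ.*-monoˡ-≤-nonNeg ε δ≤)
      (ℚ.*-monoʳ-≤-nonNeg (∣ g n ∣) {{ℚ.nonNegative (ℚ.0≤∣p∣ (g n))}}
        (ℚ.≤-trans ε≤ (ℚ.≤-reflexive (sym (ℚ.0≤p⇒∣p∣≡p (ℚ.≤-trans (ℚ.<⇒≤ ε>0) ε≤)))))))))
Null-cancel {f} {g} (inj₂ neg) nfg = Null-cancel (inj₁ neg)
  (λ ε ε>0 → let N , k = nfg ε ε>0 in N , λ n n≥ →
    subst (ℚ._< ε) (trans (sym (ℚ.∣-p∣≡∣p∣ (f n ℚ.* g n))) (cong ∣_∣ (ℚ.neg-distribˡ-* (f n) (g n)))) (k n n≥))

-- The order of the reals

infix 4 _≺_ _≉_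

opaque

  _≺_ : ℝ → ℝ → Set
  x ≺ y = EventuallyPos (λ n → seq y n ℚ.- seq x n)

  ≺⁺ : ∀ {x y} → EventuallyPos (λ n → seq y n ℚ.- seq x n) → x ≺ y
  ≺⁺ h = h

  ≺⁻ : ∀ {x y} → x ≺ y → EventuallyPos (λ n → seq y n ℚ.- seq x n)
  ≺⁻ h = h

_≉_ : ℝ → ℝ → Set
x ≉ y = ¬ (x ≈ y)

≺⇒≉ : ∀ {x y} → x ≺ y → x ≉ y
≺⇒≉ {x} {y} x<y (mk≈ x≈y) = pos⇒¬Null (≺⁻ x<y) λ ε ε>0 → let N , h = x≈y ε ε>0 in
  N , λ n n≥ → subst (ℚ._< ε) (∣∣-sym (seq x n) (seq y n)) (h n n≥)

≺-asym : ∀ {x y} → x ≺ y → ¬ (y ≺ x)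
≺-asym {x} {y} x<y y<x = pos-exclusive (≺⁻ x<y) (≺⁻ y<x) (λ ε ε>0 → 0 , λ _ _ → ε>0) λ n → eq (seq x n) (seq y n)
  where
  open ℚ-Solver
  eq : ∀ a b → (b ℚ.- a) ℚ.+ (a ℚ.- b) ≡ 0ℚ
  eq = solve 2 (λ a b → (b :- a) :+ (a :- b) := con 0ℚ) refl

≺-trans : ∀ {x y z} → x ≺ y → y ≺ z → x ≺ z
≺-trans {x} {y} {z} x<y y<z = ≺⁺ (pos-cong (λ n → eq (seq x n) (seq y n) (seq z n)) (pos-+ (≺⁻ x<y) (≺⁻ y<z)))
  where
  open ℚ-Solver
  eq : ∀ a b c → (b ℚ.- a) ℚ.+ (c ℚ.- b) ≡ c ℚ.- a
  eq = solve 3 (λ a b c → (b :- a) :+ (c :- b) := c :- a) refl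

≺-respʳ-≈ : ∀ {x y z} → y ≈ z → x ≺ y → x ≺ z
≺-respʳ-≈ {x} {y} {z} (mk≈ y≈z) x<y =
  let ε , ε>0 , M , h = ≺⁻ x<y
      N , k = y≈z (½ ℚ.* ε) (half-pos ε>0)
  in ≺⁺ (½ ℚ.* ε , half-pos ε>0 , M ℕ.⊔ N , λ n n≥ → bound ε n (h n (max-left n≥)) (k n (max-right {M} n≥)))
  where
  open ℚ-Solver
  open ℚ.≤-Reasoning
  bound : ∀ ε n → ε ℚ.≤ seq y n ℚ.- seq x n → ∣ seq y n ℚ.- seq z n ∣ ℚ.< ½ ℚ.* ε → ½ ℚ.* ε ℚ.≤ seq z n ℚ.- seq x n
  bound ε n ε≤ d< = begin
    ½ ℚ.* ε                                 ≡⟨ solve 1 (λ e → con ½ :* e := e :- con ½ :* e) refl ε ⟩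
    ε ℚ.- ½ ℚ.* ε                           ≤⟨ ℚ.+-mono-≤ ε≤ (ℚ.neg-antimono-≤ (ℚ.≤-trans (p≤∣p∣ _) (ℚ.<⇒≤ d<))) ⟩
    (seq y n ℚ.- seq x n) ℚ.- (seq y n ℚ.- seq z n) ≡⟨ solve 3 (λ a b c → (b :- a) :- (b :- c) := c :- a) refl (seq x n) (seq y n) (seq z n) ⟩
    seq z n ℚ.- seq x n                     ∎

-- Linear consequences of equations between reals

-- Reduces an equation between reals to a termwise rational identity that exhibits s - t as a
-- combination of two null sequences. Real coefficients are allowed since Cauchy sequences are
-- bounded.
≈-combine : ∀ {s t x y u v} (k l : ℝ) → x ≈ y → u ≈ v →
  (∀ n → seq k n ℚ.* (seq x n ℚ.- seq y n) ℚ.+ seq l n ℚ.* (seq u n ℚ.- seq v n) ≡ seq s n ℚ.- seq t n) →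
  s ≈ t
≈-combine k l (mk≈ x≈y) (mk≈ u≈v) eq = mk≈ (Null-cong eq (Null-+ (Null-* k x≈y) (Null-* l u≈v)))

1ℝ : ℝ
1ℝ = mkℝ (λ _ → 1ℚ) (λ ε ε>0 → 0 , λ _ _ _ _ → ε>0)

ℚ-ring : AlmostCommutativeRing 0ℓ 0ℓ
ℚ-ring = fromCommutativeRing ℚ.+-*-commutativeRing (λ p → dec⇒maybe (0ℚ ℚ.≟ p))

-- Rational identities behind the geometry of lines and ratios

private
  On-injˡ-identity : ∀ p q a b a′ b′ →
    q ℚ.* (a ℚ.- a′) ℚ.+ (ℚ.- 1ℚ) ℚ.* ((q ℚ.* a ℚ.- p ℚ.* b) ℚ.- (q ℚ.* a′ ℚ.- p ℚ.* b′)) ≡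
    p ℚ.* (b ℚ.- b′)
  On-injˡ-identity = solve-∀ ℚ-ring

  On-injʳ-identity : ∀ p q a b a′ b′ →
    p ℚ.* (b ℚ.- b′) ℚ.+ 1ℚ ℚ.* ((q ℚ.* a ℚ.- p ℚ.* b) ℚ.- (q ℚ.* a′ ℚ.- p ℚ.* b′)) ≡
    q ℚ.* (a ℚ.- a′)
  On-injʳ-identity = solve-∀ ℚ-ring

  slope-unique-identity : ∀ p q a b a′ b′ p₁ q₁ →
    p ℚ.* ((q₁ ℚ.* a ℚ.- p₁ ℚ.* b) ℚ.- (q₁ ℚ.* a′ ℚ.- p₁ ℚ.* b′)) ℚ.+
      ℚ.- p₁ ℚ.* ((q ℚ.* a ℚ.- p ℚ.* b) ℚ.- (q ℚ.* a′ ℚ.- p ℚ.* b′)) ≡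
    (a ℚ.- a′) ℚ.* (q₁ ℚ.* p ℚ.- p₁ ℚ.* q)
  slope-unique-identity = solve-∀ ℚ-ring

  On-increasing-identity : ∀ p q a b a′ b′ →
    p ℚ.* q ℚ.* (a′ ℚ.- a) ℚ.+ p ℚ.* p ℚ.* (b ℚ.- b′) ≡
    p ℚ.* ((q ℚ.* a′ ℚ.- p ℚ.* b′) ℚ.- (q ℚ.* a ℚ.- p ℚ.* b))
  On-increasing-identity = solve-∀ ℚ-ring

  On-decreasing-identity : ∀ p q a b a′ b′ →
    ℚ.- (p ℚ.* q) ℚ.* (a′ ℚ.- a) ℚ.+ p ℚ.* p ℚ.* (b′ ℚ.- b) ≡
    p ℚ.* ((q ℚ.* a ℚ.- p ℚ.* b) ℚ.- (q ℚ.* a′ ℚ.- p ℚ.* b′))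
  On-decreasing-identity = solve-∀ ℚ-ring

  translate-identity : ∀ p q z z′ y y′ d d′ →
    q ℚ.* (z ℚ.- y ℚ.- d) ℚ.+ ℚ.- p ℚ.* (z′ ℚ.- y′ ℚ.- d′) ≡
    (q ℚ.* z ℚ.- p ℚ.* z′) ℚ.- (q ℚ.* (y ℚ.+ d) ℚ.- p ℚ.* (y′ ℚ.+ d′))
  translate-identity = solve-∀ ℚ-ring

  parallel-identity : ∀ p q y y′ d d′ →
    1ℚ ℚ.* (q ℚ.* y ℚ.- p ℚ.* y′) ℚ.+ 0ℚ ℚ.* (q ℚ.* y ℚ.- p ℚ.* y′) ≡
    (q ℚ.* (y ℚ.+ d) ℚ.- p ℚ.* (y′ ℚ.+ d′)) ℚ.- (q ℚ.* d ℚ.- p ℚ.* d′)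
  parallel-identity = solve-∀ ℚ-ring

  ∥-trans-identity : ∀ p q r s a b →
    b ℚ.* (q ℚ.* r ℚ.- p ℚ.* s) ℚ.+ q ℚ.* (s ℚ.* a ℚ.- r ℚ.* b) ≡
    s ℚ.* (q ℚ.* a ℚ.- p ℚ.* b)
  ∥-trans-identity = solve-∀ ℚ-ring

-- Arithmetic of the constants

cube-root : ∀ m → ∃[ b ] (b ^ 3 ≤ m × m ℕ.< suc b ^ 3)
cube-root zero    = 0 , z≤n , s≤s z≤n
cube-root (suc m) = let b , lo , hi = cube-root m in choose b lo hi (m≤n⇒m<n∨m≡n hi)
  where
  choose : ∀ b → b ^ 3 ≤ m → m ℕ.< suc b ^ 3 → suc m ℕ.< suc b ^ 3 ⊎ suc m ≡ suc b ^ 3 →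
           ∃[ b ] (b ^ 3 ≤ suc m × suc m ℕ.< suc b ^ 3)
  choose b lo hi (inj₁ <) = b , m≤n⇒m≤1+n lo , <
  choose b lo hi (inj₂ eq) = suc b , ≤-reflexive (sym eq) , subst (ℕ._< suc (suc b) ^ 3) (sym eq) (^-monoˡ-< 3 (n<1+n (suc b)))

-- Multiplying by d⁸ completes e⁴ ≲ (τ³ d)⁴ to (d τ)¹², which is traded for (q s)¹²; the q¹² t⁶ N³
-- that arises is the incidence bound after cancelling N³. The exponent 28 is 3 + 4 from E³ e⁴, 12
-- from (d τ)¹² and 9 from the incidences. The cases d = 0 and N = 0, where cancellation fails, make
-- e or E vanish.
eliminate-parameters : ∀ E e n d N s q t τ K → e ≤ K * (τ ^ 3 * d) → d * τ ≤ K * (q * s) → E ≤ K * (t ^ 2 * N) →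
                       (q ^ 2 * t * N) ^ 6 ≤ K ^ 9 * (N ^ 3 * (n ^ 10 * d ^ 8)) →
                       E ^ 3 * e ^ 4 ≤ K ^ 28 * (s ^ 12 * n ^ 10)
eliminate-parameters E e n zero N s q t τ K e≤ _ _ _
  rewrite n≤0⇒n≡0 (≤-trans e≤ (≤-reflexive (trans (cong (K *_) (*-zeroʳ (τ ^ 3))) (*-zeroʳ K)))) =
  ≤-trans (≤-reflexive (*-zeroʳ (E ^ 3))) z≤n
eliminate-parameters E e n (suc _) zero s q t τ K _ _ E≤ _
  rewrite n≤0⇒n≡0 (≤-trans E≤ (≤-reflexive (trans (cong (K *_) (*-zeroʳ (t ^ 2))) (*-zeroʳ K)))) = z≤n
eliminate-parameters E e n d@(suc _) N@(suc _) s q t τ K e≤ dτ≤ E≤ J≤ =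
  *-cancelˡ-≤ (d ^ 8) {{m^n≢0 d 8}} (begin
    d ^ 8 * (E ^ 3 * e ^ 4)                                   ≤⟨ *-monoʳ-≤ (d ^ 8) (*-mono-≤ (^-monoˡ-≤ 3 E≤) (^-monoˡ-≤ 4 e≤)) ⟩
    d ^ 8 * ((K * (t ^ 2 * N)) ^ 3 * (K * (τ ^ 3 * d)) ^ 4)   ≡⟨ regroup d K t N τ ⟩
    K ^ 7 * (t ^ 6 * N ^ 3) * (d * τ) ^ 12                    ≤⟨ *-monoʳ-≤ (K ^ 7 * (t ^ 6 * N ^ 3)) (^-monoˡ-≤ 12 dτ≤) ⟩
    K ^ 7 * (t ^ 6 * N ^ 3) * (K * (q * s)) ^ 12              ≡⟨ regroup′ K t N q s ⟩
    K ^ 19 * s ^ 12 * (q ^ 12 * (t ^ 6 * N ^ 3))              ≤⟨ *-monoʳ-≤ (K ^ 19 * s ^ 12) cancelled ⟩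
    K ^ 19 * s ^ 12 * (K ^ 9 * (n ^ 10 * d ^ 8))              ≡⟨ regroup″ K s n d ⟩
    d ^ 8 * (K ^ 28 * (s ^ 12 * n ^ 10))                      ∎)
  where
  open ≤-Reasoning
  open +-*-Solver
  regroup : ∀ d K t N τ → d ^ 8 * ((K * (t ^ 2 * N)) ^ 3 * (K * (τ ^ 3 * d)) ^ 4) ≡ K ^ 7 * (t ^ 6 * N ^ 3) * (d * τ) ^ 12
  regroup = solve 5 (λ d K t N τ → d :^ 8 :* ((K :* (t :^ 2 :* N)) :^ 3 :* (K :* (τ :^ 3 :* d)) :^ 4)
    := K :^ 7 :* (t :^ 6 :* N :^ 3) :* (d :* τ) :^ 12) refl
  regroup′ : ∀ K t N q s → K ^ 7 * (t ^ 6 * N ^ 3) * (K * (q * s)) ^ 12 ≡ K ^ 19 * s ^ 12 * (q ^ 12 * (t ^ 6 * N ^ 3))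
  regroup′ = solve 5 (λ K t N q s → K :^ 7 :* (t :^ 6 :* N :^ 3) :* (K :* (q :* s)) :^ 12
    := K :^ 19 :* s :^ 12 :* (q :^ 12 :* (t :^ 6 :* N :^ 3))) refl
  regroup″ : ∀ K s n d → K ^ 19 * s ^ 12 * (K ^ 9 * (n ^ 10 * d ^ 8)) ≡ d ^ 8 * (K ^ 28 * (s ^ 12 * n ^ 10))
  regroup″ = solve 4 (λ K s n d → K :^ 19 :* s :^ 12 :* (K :^ 9 :* (n :^ 10 :* d :^ 8))
    := d :^ 8 :* (K :^ 28 :* (s :^ 12 :* n :^ 10))) refl
  split-sixth : ∀ q t N → (q ^ 2 * t * N) ^ 6 ≡ N ^ 3 * (q ^ 12 * (t ^ 6 * N ^ 3))
  split-sixth = solve 3 (λ q t N → (q :^ 2 :* t :* N) :^ 6 := N :^ 3 :* (q :^ 12 :* (t :^ 6 :* N :^ 3))) refl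
  swap-N : ∀ K N x → K ^ 9 * (N ^ 3 * x) ≡ N ^ 3 * (K ^ 9 * x)
  swap-N = solve 3 (λ K N x → K :^ 9 :* (N :^ 3 :* x) := N :^ 3 :* (K :^ 9 :* x)) refl
  cancelled : q ^ 12 * (t ^ 6 * N ^ 3) ≤ K ^ 9 * (n ^ 10 * d ^ 8)
  cancelled = *-cancelˡ-≤ (N ^ 3) {{m^n≢0 N 3}} (subst₂ _≤_ (split-sixth q t N) (swap-N K N (n ^ 10 * d ^ 8)) J≤)

1≤log₂ : ∀ n → 1 ≤ ⌊log₂ (2 + n) ⌋
1≤log₂ n = ⌊log₂⌋-mono-≤ {2} {2 + n} (m≤m+n 2 n)

n<2^[1+log₂] : ∀ n → n ℕ.< 2 ^ suc ⌊log₂ n ⌋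
n<2^[1+log₂] n = ≰⇒> λ le → 1+n≰n (≤-trans (≤-reflexive (sym (⌊log₂[2^n]⌋≡n (suc ⌊log₂ n ⌋)))) (⌊log₂⌋-mono-≤ le))

-- Opaque, so that the constant of the theorem is never evaluated.
opaque

  scale : ℕ
  scale = 8192

  8192≤scale : 8192 ≤ scale
  8192≤scale = ≤-refl

  constant : ℕ
  constant = 8 * scale ^ 28

  constant≡ : constant ≡ 8 * scale ^ 28
  constant≡ = refl

0<constant : 0 ℕ.< constant
0<constant = subst (0 ℕ.<_) (sym constant≡) (*-mono-≤ {1} {8} (s≤s z≤n)
  (m^n>0 scale {{ℕ.>-nonZero (≤-trans (s≤s z≤n) 8192≤scale)}} 28))

-- With L the logarithm, 4 (L + 1) scales are used and L + 1 ≤ 2 L, whence 8192 = 4 · 2 · 1024. The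
-- factor 1024 comes from `∑-count³≤`.
scale-log : ∀ n → 4 * suc ⌊log₂ (2 + n) ⌋ * 1024 ≤ scale * ⌊log₂ (2 + n) ⌋
scale-log n = go ⌊log₂ (2 + n) ⌋ (1≤log₂ n)
  where
  open ≤-Reasoning
  open +-*-Solver
  go : ∀ L → 1 ≤ L → 4 * suc L * 1024 ≤ scale * L
  go L 1≤L = begin
    4 * suc L * 1024       ≡⟨ solve 1 (λ L → con 4 :* (con 1 :+ L) :* con 1024 := (con 1 :+ L) :* con 4096) refl L ⟩
    suc L * 4096           ≤⟨ *-monoˡ-≤ 4096 (+-monoˡ-≤ L 1≤L) ⟩
    (L + L) * 4096         ≡⟨ solve 1 (λ L → (L :+ L) :* con 4096 := L :* con 8192) refl L ⟩
    L * 8192               ≤⟨ *-monoʳ-≤ L 8192≤scale ⟩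
    L * scale              ≡⟨ *-comm L scale ⟩
    scale * L              ∎

-- Moves the logarithm out of K. The factor 8 is the cost of rounding a cube root in
-- `energyBound-elim`.
extract-log : ∀ p s L K m {C P} → C ≡ 8 * s ^ p → K ≤ s * L → P ≤ 8 * (K ^ p * m) → P ≤ C * m * L ^ p
extract-log p s L K m {P = P} refl K≤ P≤ = begin
  P                         ≤⟨ P≤ ⟩
  8 * (K ^ p * m)           ≤⟨ *-monoʳ-≤ 8 (*-monoˡ-≤ m (^-monoˡ-≤ p K≤)) ⟩
  8 * ((s * L) ^ p * m)     ≡⟨ cong (λ x → 8 * (x * m)) (^-distribʳ-* p s L) ⟩
  8 * (s ^ p * L ^ p * m)   ≡⟨ solve 3 (λ x y z → con 8 :* (x :* y :* z) := con 8 :* x :* z :* y) refl (s ^ p) (L ^ p) m ⟩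
  8 * s ^ p * m * L ^ p     ∎
  where
  open ≤-Reasoning
  open +-*-Solver

-- The fourth power covers every quantity to be pigeonholed: the largest trivial bound is |D|² ≤ n⁴,
-- for points of D × D on a line.
n^4<2^ : ∀ n → n ^ 4 ℕ.< 2 ^ (4 * suc ⌊log₂ (2 + n) ⌋)
n^4<2^ n = go (suc ⌊log₂ (2 + n) ⌋) (≤-<-trans (m≤n+m n 2) (n<2^[1+log₂] (2 + n)))
  where
  go : ∀ l → n ℕ.< 2 ^ l → n ^ 4 ℕ.< 2 ^ (4 * l)
  go l n< = <-≤-trans (^-monoˡ-< 4 n<) (≤-reflexive (trans (^-*-assoc 2 l 4) (cong (2 ^_) (*-comm l 4))))

-- Signs and trichotomy of reals

module _ (em : ExcludedMiddle 0ℓ) where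

  open Energies em using (differences; r₋; E₃⁺; E×)

  -- If |f n| ≥ ε for one n past the Cauchy index of ε / 2, then f keeps that sign and stays at
  -- least ε / 2 away from 0 from that index on. So a sequence with neither sign is null.
  sign : ∀ f → IsCauchy f → EventuallyPos f ⊎ Null f ⊎ EventuallyPos (λ n → ℚ.- f n)
  sign f cf with em {EventuallyPos f} | em {EventuallyPos (λ n → ℚ.- f n)}
  ... | yes p | _     = inj₁ p
  ... | no  _ | yes q = inj₂ (inj₂ q)
  ... | no ¬p | no ¬q = inj₂ (inj₁ null)
    where
    open ℚ-Solver
    open ℚ.≤-Reasoning
    far : ∀ {ε} a b → ε ℚ.≤ a → ∣ a ℚ.- b ∣ ℚ.< ½ ℚ.* ε → ½ ℚ.* ε ℚ.≤ b
    far {ε} a b ε≤a d< = begin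
      ½ ℚ.* ε           ≡⟨ solve 1 (λ e → con ½ :* e := e :- con ½ :* e) refl ε ⟩
      ε ℚ.- ½ ℚ.* ε     ≤⟨ ℚ.+-mono-≤ ε≤a (ℚ.neg-antimono-≤ (ℚ.≤-trans (p≤∣p∣ _) (ℚ.<⇒≤ d<))) ⟩
      a ℚ.- (a ℚ.- b)   ≡⟨ solve 2 (λ a b → a :- (a :- b) := b) refl a b ⟩
      b                 ∎
    null : Null f
    null ε ε>0 = let N , h = cf (½ ℚ.* ε) (half-pos ε>0) in
      N , λ n n≥ → ℚ.≰⇒> λ ε≤ → big N h n n≥ ε≤ (ℚ.∣p∣≡p∨∣p∣≡-p (f n))
      where
      big : ∀ N → (∀ m n → N ℕ.≤ m → N ℕ.≤ n → ∣ f m ℚ.- f n ∣ ℚ.< ½ ℚ.* ε) →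
            ∀ n → N ℕ.≤ n → ε ℚ.≤ ∣ f n ∣ → ∣ f n ∣ ≡ f n ⊎ ∣ f n ∣ ≡ ℚ.- f n → ⊥
      big N h n n≥ ε≤ (inj₁ eq) = ¬p (½ ℚ.* ε , half-pos ε>0 , N , λ m m≥ →
        far (f n) (f m) (subst (ε ℚ.≤_) eq ε≤) (h n m n≥ m≥))
      big N h n n≥ ε≤ (inj₂ eq) = ¬q (½ ℚ.* ε , half-pos ε>0 , N , λ m m≥ →
        far (ℚ.- f n) (ℚ.- f m) (subst (ε ℚ.≤_) eq ε≤)
          (subst (λ t → ∣ t ∣ ℚ.< ½ ℚ.* ε)
            (solve 2 (λ a b → a :- b := :- b :- :- a) refl (f m) (f n)) (h m n m≥ n≥)))

  opaque

    compare : ∀ x y → x ≺ y ⊎ x ≈ y ⊎ y ≺ x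
    compare x y = decide (sign (λ n → seq y n ℚ.- seq x n) (cauchy (y -ᵣ x)))
      where
      open ℚ-Solver
      eq : ∀ a b → ℚ.- (a ℚ.- b) ≡ b ℚ.- a
      eq = solve 2 (λ a b → :- (a :- b) := b :- a) refl
      decide : EventuallyPos (λ n → seq y n ℚ.- seq x n) ⊎ Null (λ n → seq y n ℚ.- seq x n) ⊎
               EventuallyPos (λ n → ℚ.- (seq y n ℚ.- seq x n)) → x ≺ y ⊎ x ≈ y ⊎ y ≺ x
      decide (inj₁ x<y)        = inj₁ (≺⁺ x<y)
      decide (inj₂ (inj₁ y≈x)) = inj₂ (inj₁ (≈-sym (mk≈ y≈x)))
      decide (inj₂ (inj₂ y<x)) = inj₂ (inj₂ (≺⁺ (pos-cong (λ n → eq (seq y n) (seq x n)) y<x)))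

  sign-≉0 : ∀ x → x ≉ 0ℝ → EventuallyPos (seq x) ⊎ EventuallyPos (λ n → ℚ.- seq x n)
  sign-≉0 x x≉0 with sign (seq x) (cauchy x)
  ... | inj₁ p        = inj₁ p
  ... | inj₂ (inj₁ z) = contradiction (mk≈ (Null-cong (λ n → sym (ℚ.+-identityʳ (seq x n))) z)) x≉0
  ... | inj₂ (inj₂ q) = inj₂ q

  ≈-combine-cancel : ∀ {s t x y u v} (k a b : ℝ) → k ≉ 0ℝ → x ≈ y → u ≈ v →
    (∀ n → seq a n ℚ.* (seq x n ℚ.- seq y n) ℚ.+ seq b n ℚ.* (seq u n ℚ.- seq v n)
         ≡ seq k n ℚ.* (seq s n ℚ.- seq t n)) →
    s ≈ t
  ≈-combine-cancel k a b k≉0 (mk≈ x≈y) (mk≈ u≈v) eq =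
    mk≈ (Null-cancel (sign-≉0 k k≉0) (Null-cong eq (Null-+ (Null-* a x≈y) (Null-* b u≈v))))

  sameSign⊎oppositeSign : ∀ x y → x ≉ 0ℝ → y ≉ 0ℝ →
    EventuallyPos (λ n → seq x n ℚ.* seq y n) ⊎ EventuallyPos (λ n → ℚ.- (seq x n ℚ.* seq y n))
  sameSign⊎oppositeSign x y x≉0 y≉0 with sign-≉0 x x≉0 | sign-≉0 y y≉0
  ... | inj₁ p | inj₁ q = inj₁ (pos-* p q)
  ... | inj₁ p | inj₂ q = inj₂ (pos-cong (λ n → sym (ℚ.neg-distribʳ-* (seq x n) (seq y n))) (pos-* p q))
  ... | inj₂ p | inj₁ q = inj₂ (pos-cong (λ n → sym (ℚ.neg-distribˡ-* (seq x n) (seq y n))) (pos-* p q))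
  ... | inj₂ p | inj₂ q = inj₁ (pos-cong (λ n → eq (seq x n) (seq y n)) (pos-* p q))
    where
    open ℚ-Solver
    eq : ∀ a b → ℚ.- a ℚ.* ℚ.- b ≡ a ℚ.* b
    eq = solve 2 (λ a b → :- a :* :- b := a :* b) refl

  square-pos : ∀ x → x ≉ 0ℝ → EventuallyPos (λ n → seq x n ℚ.* seq x n)
  square-pos x x≉0 with sameSign⊎oppositeSign x x x≉0 x≉0 | sign-≉0 x x≉0
  ... | inj₁ p | _      = p
  ... | inj₂ _ | inj₁ p = pos-* p p
  ... | inj₂ _ | inj₂ p = pos-cong (λ n → eq (seq x n)) (pos-* p p)
    where
    open ℚ-Solver
    eq : ∀ a → ℚ.- a ℚ.* ℚ.- a ≡ a ℚ.* a
    eq = solve 1 (λ a → :- a :* :- a := a :* a) refl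

  -- Lines and ratios

  -- ((p , q) , c) stands for the line q a - p b = c in the (a , b)-plane.
  Line : Set
  Line = (ℝ × ℝ) × ℝ

  -- Opaque, so that real arithmetic is not unfolded when lines are compared.
  opaque

    On : Line → ℝ → ℝ → Set
    On ((p , q) , c) a b = q *ᵣ a -ᵣ p *ᵣ b ≈ c

    on : ∀ {p q c a b} → q *ᵣ a -ᵣ p *ᵣ b ≈ c → On ((p , q) , c) a b
    on h = h

    equation : ∀ {p q c a b} → On ((p , q) , c) a b → q *ᵣ a -ᵣ p *ᵣ b ≈ c
    equation h = h

  -- For the direction of a line this excludes vertical lines (p = 0) and horizontal ones (q = 0).
  NonZeroPair : ℝ × ℝ → Set
  NonZeroPair (p , q) = p ≉ 0ℝ × q ≉ 0ℝ

  infix 4 _∥_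

  opaque

    -- Equality of the ratios p / q and a / b with denominators cleared: ℝ has no division here.
    _∥_ : ℝ × ℝ → ℝ × ℝ → Set
    (p , q) ∥ (a , b) = q *ᵣ a ≈ p *ᵣ b

    par : ∀ {p q a b} → q *ᵣ a ≈ p *ᵣ b → (p , q) ∥ (a , b)
    par h = h

    ratio : ∀ {p q a b} → (p , q) ∥ (a , b) → q *ᵣ a ≈ p *ᵣ b
    ratio h = h

  module _ {p q c a b a′ b′ : ℝ} (h : On ((p , q) , c) a b) (h′ : On ((p , q) , c) a′ b′) where
    open ℚ-Solver

    private
      along : q *ᵣ a -ᵣ p *ᵣ b ≈ q *ᵣ a′ -ᵣ p *ᵣ b′
      along = ≈-trans {q *ᵣ a -ᵣ p *ᵣ b} {c} {q *ᵣ a′ -ᵣ p *ᵣ b′} (equation {p} {q} {c} {a} {b} h)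
        (≈-sym {q *ᵣ a′ -ᵣ p *ᵣ b′} {c} (equation {p} {q} {c} {a′} {b′} h′))

    On-injˡ : p ≉ 0ℝ → a ≈ a′ → b ≈ b′
    On-injˡ p≉0 a≈a′ = ≈-combine-cancel p q (-ᵣ 1ℝ) p≉0 a≈a′ along λ n →
      On-injˡ-identity (seq p n) (seq q n) (seq a n) (seq b n) (seq a′ n) (seq b′ n)

    On-injʳ : q ≉ 0ℝ → b ≈ b′ → a ≈ a′
    On-injʳ q≉0 b≈b′ = ≈-combine-cancel q p 1ℝ q≉0 b≈b′ along λ n →
      On-injʳ-identity (seq p n) (seq q n) (seq a n) (seq b n) (seq a′ n) (seq b′ n)

    -- Both directions are proportional to the vector joining the two points; its nonzero first
    -- coordinate a - a′ is cancelled.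
    slope-unique : ∀ {p₁ q₁ c₁} → On ((p₁ , q₁) , c₁) a b → On ((p₁ , q₁) , c₁) a′ b′ →
                   a ≉ a′ → (p₁ , q₁) ∥ (p , q)
    slope-unique {p₁} {q₁} h₁ h₁′ a≉a′ = par (
      ≈-combine-cancel (a -ᵣ a′) p (-ᵣ p₁) nonzero (≈-trans (equation h₁) (≈-sym (equation h₁′))) along λ n →
        slope-unique-identity (seq p n) (seq q n) (seq a n) (seq b n) (seq a′ n) (seq b′ n) (seq p₁ n) (seq q₁ n))
      where
      nonzero : a -ᵣ a′ ≉ 0ℝ
      nonzero (mk≈ z) = a≉a′ (mk≈ (Null-cong (λ n → ℚ.+-identityʳ (seq a n ℚ.- seq a′ n)) z))

    -- The sign of p q forbids one of the two relative orders of the coordinates.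
    On-increasing : p ≉ 0ℝ → EventuallyPos (λ n → seq p n ℚ.* seq q n) → a ≺ a′ → ¬ (b′ ≺ b)
    On-increasing p≉0 pq a<a′ b′<b = pos-exclusive (pos-* pq (≺⁻ a<a′)) (pos-* (square-pos p p≉0) (≺⁻ b′<b))
      (Null-* p (limit (≈-sym along))) λ n →
        On-increasing-identity (seq p n) (seq q n) (seq a n) (seq b n) (seq a′ n) (seq b′ n)

    On-decreasing : p ≉ 0ℝ → EventuallyPos (λ n → ℚ.- (seq p n ℚ.* seq q n)) → a ≺ a′ → ¬ (b ≺ b′)
    On-decreasing p≉0 pq a<a′ b<b′ = pos-exclusive (pos-* pq (≺⁻ a<a′)) (pos-* (square-pos p p≉0) (≺⁻ b<b′))
      (Null-* p (limit along)) λ n →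
        On-decreasing-identity (seq p n) (seq q n) (seq a n) (seq b n) (seq a′ n) (seq b′ n)

  opaque

    -- The sign of p q decides between increasing and decreasing. Subtract the equations at two
    -- points and multiply by p: in the forbidden order this null sequence would be a sum of two
    -- eventually positive ones, ± p q times a difference of first coordinates and p² times one of
    -- second coordinates.
    On-monotone : ∀ {ℓ} → NonZeroPair (proj₁ ℓ) →
      (∀ {a b a′ b′} → On ℓ a b → On ℓ a′ b′ → a ≺ a′ → ¬ (b′ ≺ b)) ⊎
      (∀ {a b a′ b′} → On ℓ a b → On ℓ a′ b′ → a ≺ a′ → ¬ (b ≺ b′))
    On-monotone {(p , q) , c} (p≉0 , q≉0) = decide (sameSign⊎oppositeSign p q p≉0 q≉0)
      where
      decide : EventuallyPos (λ n → seq p n ℚ.* seq q n) ⊎ EventuallyPos (λ n → ℚ.- (seq p n ℚ.* seq q n)) →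
        (∀ {a b a′ b′} → On ((p , q) , c) a b → On ((p , q) , c) a′ b′ → a ≺ a′ → ¬ (b′ ≺ b)) ⊎
        (∀ {a b a′ b′} → On ((p , q) , c) a b → On ((p , q) , c) a′ b′ → a ≺ a′ → ¬ (b ≺ b′))
      decide (inj₁ s) = inj₁ (λ h h′ → On-increasing h h′ p≉0 s)
      decide (inj₂ s) = inj₂ (λ h h′ → On-decreasing h h′ p≉0 s)

  module _ where
    open ℚ-Solver

    opaque

      Difference : ℝ → ℝ → ℝ → Set
      Difference z y d = z -ᵣ y ≈ d

      difference⁺ : ∀ z y d → z -ᵣ y ≈ d → Difference z y d
      difference⁺ _ _ _ h = h

      difference⁻ : ∀ z y d → Difference z y d → z -ᵣ y ≈ d
      difference⁻ _ _ _ h = h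

    difference-injective : ∀ {z y y′ d} → Difference z y d → Difference z y′ d → y ≈ y′
    difference-injective {z} {y} {y′} {d} h h′ = ≈-combine (-ᵣ 1ℝ) 1ℝ (difference⁻ z y d h) (difference⁻ z y′ d h′) λ n →
      solve 4 (λ z y y′ d → con (ℚ.- 1ℚ) :* (z :- y :- d) :+ con 1ℚ :* (z :- y′ :- d) := y :- y′)
        refl (seq z n) (seq y n) (seq y′ n) (seq d n)

    On-resp-≈ : ∀ {u c c′ a b} → c ≈ c′ → On (u , c) a b → On (u , c′) a b
    On-resp-≈ {p , q} {c} {c′} {a} {b} c≈c′ h = on {p} {q} {c′} {a} {b} (≈-trans {q *ᵣ a -ᵣ p *ᵣ b} {c} {c′} (equation {p} {q} {c} {a} {b} h) c≈c′)

    intercept-unique : ∀ {u c c′ a b} → On (u , c) a b → On (u , c′) a b → c ≈ c′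
    intercept-unique {p , q} {c} {c′} {a} {b} h h′ =
      ≈-trans {c} {q *ᵣ a -ᵣ p *ᵣ b} {c′} (≈-sym {q *ᵣ a -ᵣ p *ᵣ b} {c} (equation {p} {q} {c} {a} {b} h)) (equation {p} {q} {c′} {a} {b} h′)

    opaque

      intercept : ℝ × ℝ → ℝ × ℝ → ℝ
      intercept (p , q) (a , b) = q *ᵣ a -ᵣ p *ᵣ b

      On-intercept : ∀ {u a b} → On (u , intercept u (a , b)) a b
      On-intercept {p , q} {a} {b} = on {p} {q} {q *ᵣ a -ᵣ p *ᵣ b} {a} {b} (≈-refl {q *ᵣ a -ᵣ p *ᵣ b})

      -- If (y , y') lies on a line through the origin, its translates (z , z') and (d , d')
      -- lie on a common parallel line.
      translate-line : ∀ {u z z′ y y′ d d′} → Difference z y d → Difference z′ y′ d′ → u ∥ (y , y′) →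
                       On (u , intercept u (z , z′)) d d′
      translate-line {p , q} {z} {z′} {y} {y′} {d} {d′} h h′ r =
        on {p} {q} {q *ᵣ z -ᵣ p *ᵣ z′} {d} {d′} (≈-sym (≈-trans {q *ᵣ z -ᵣ p *ᵣ z′} {m} {q *ᵣ d -ᵣ p *ᵣ d′} shift cancel))
        where
        m : ℝ
        m = q *ᵣ (y +ᵣ d) -ᵣ p *ᵣ (y′ +ᵣ d′)
        eq : q *ᵣ y ≈ p *ᵣ y′
        eq = ratio {p} {q} {y} {y′} r
        shift : (q *ᵣ z -ᵣ p *ᵣ z′) ≈ m
        shift = ≈-combine q (-ᵣ p) (difference⁻ z y d h) (difference⁻ z′ y′ d′ h′) λ n →
          translate-identity (seq p n) (seq q n) (seq z n) (seq z′ n) (seq y n) (seq y′ n) (seq d n) (seq d′ n)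
        cancel : m ≈ q *ᵣ d -ᵣ p *ᵣ d′
        cancel = ≈-combine 1ℝ 0ℝ eq eq λ n →
          parallel-identity (seq p n) (seq q n) (seq y n) (seq y′ n) (seq d n) (seq d′ n)

    *ᵣ-comm : ∀ x y → x *ᵣ y ≈ y *ᵣ x
    *ᵣ-comm x y = mk≈ λ ε ε>0 → 0 , λ n _ → subst (λ t → ∣ t ∣ ℚ.< ε)
      (solve 2 (λ x y → con 0ℚ := x :* y :- y :* x) refl (seq x n) (seq y n)) ε>0

    ∥-refl : ∀ u → u ∥ u
    ∥-refl (p , q) = par (*ᵣ-comm q p)

    ∥-exchange : ∀ {x y z w} → (x , y) ∥ (z , w) → (x , z) ∥ (y , w)
    ∥-exchange {x} {y} {z} {w} h = par (≈-trans (*ᵣ-comm z y) (ratio h))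

    ∥-sym : ∀ {u v} → u ∥ v → v ∥ u
    ∥-sym {p , q} {a , b} h = par (≈-combine (-ᵣ 1ℝ) 0ℝ (ratio h) (ratio h) λ n →
      solve 4 (λ p q a b → con (ℚ.- 1ℚ) :* (q :* a :- p :* b) :+ con 0ℚ :* (q :* a :- p :* b)
          := b :* p :- a :* q)
        refl (seq p n) (seq q n) (seq a n) (seq b n))

    -- The pair (0 , 0) is parallel to every pair, so the middle pair has to be nonzero; its second
    -- coordinate is the factor cancelled.
    ∥-trans : ∀ {u v w} → NonZeroPair v → u ∥ v → v ∥ w → u ∥ w
    ∥-trans {p , q} {r , s} {a , b} (_ , s≉0) h k =
      par (≈-combine-cancel s b q s≉0 (ratio h) (ratio k) λ n →
        ∥-trans-identity (seq p n) (seq q n) (seq r n) (seq s n) (seq a n) (seq b n))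

  ⊀⇒≺⊎≈ : ∀ {x y} → ¬ (y ≺ x) → x ≺ y ⊎ x ≈ y
  ⊀⇒≺⊎≈ {x} {y} y≮x with compare x y
  ... | inj₁ x<y        = inj₁ x<y
  ... | inj₂ (inj₁ x≈y) = inj₂ x≈y
  ... | inj₂ (inj₂ y<x) = contradiction y<x y≮x

  ≺-⊀-trans : ∀ {x y z} → x ≺ y → ¬ (z ≺ y) → x ≺ z
  ≺-⊀-trans x<y z≮y with ⊀⇒≺⊎≈ z≮y
  ... | inj₁ y<z = ≺-trans x<y y<z
  ... | inj₂ y≈z = ≺-respʳ-≈ y≈z x<y

  ≺-irrefl : ∀ {x} → ¬ (x ≺ x)
  ≺-irrefl x<x = ≺-asym x<x x<x

  -- Rich lines in a grid: ranks, blocks and cells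

  module Rank (A : List ℝ) (A! : Unique A) where

    rank : ℝ → ℕ
    rank a = ∑[ x ∈ A ] χ (em {x ≺ a})

    rank-mono : ∀ {a b} → ¬ (b ≺ a) → rank a ≤ rank b
    rank-mono b≮a = ∑-mono A λ x → χ-mono em em λ x<a → ≺-⊀-trans x<a b≮a

    private
      rank-strict : ∀ {xs a b} → a ∈ₚ xs → a ≺ b →
                    (∑[ x ∈ xs ] χ (em {x ≺ a})) ℕ.< (∑[ x ∈ xs ] χ (em {x ≺ b}))
      rank-strict {x ∷ xs} {a} {b} (here refl) x<b = +-mono-<-≤
        (subst₂ ℕ._<_ (sym (n≤0⇒n≡0 (χ-≤ em λ x<x → contradiction x<x ≺-irrefl))) (sym (χ-yes (em {x ≺ b}) x<b)) (s≤s z≤n))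
        (∑-mono xs λ y → χ-mono em em λ y<a → ≺-trans y<a x<b)
      rank-strict {x ∷ xs} (there i) a<b = +-mono-≤-< (χ-mono em em λ x<a → ≺-trans x<a a<b) (rank-strict i a<b)

    rank-injective : ∀ {a b} → a ∈ₚ A → b ∈ₚ A → rank a ≡ rank b → a ≈ b
    rank-injective {a} {b} i j eq with compare a b
    ... | inj₁ a<b        = contradiction eq (<⇒≢ (rank-strict i a<b))
    ... | inj₂ (inj₁ a≈b) = a≈b
    ... | inj₂ (inj₂ b<a) = contradiction (sym eq) (<⇒≢ (rank-strict j b<a))

    rank<length : ∀ {a} → a ∈ₚ A → rank a ℕ.< length A
    rank<length {a} i = go i
      where
      go : ∀ {xs} → a ∈ₚ xs → (∑[ x ∈ xs ] χ (em {x ≺ a})) ℕ.< length xs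
      go {x ∷ xs} (here refl) = s≤s (≤-trans
        (+-monoˡ-≤ _ (χ-≤ (em {x ≺ x}) {0} λ x<x → contradiction x<x ≺-irrefl)) (∑χ≤length (λ _ → em) xs))
      go {x ∷ xs} (there j) = +-mono-≤-< (χ≤1 em) (go j)

    module Blocks (m : ℕ) .{{_ : NonZero m}} where

      block : ℝ → ℕ
      block a = rank a / m

      block-mono : ∀ {a b} → ¬ (b ≺ a) → block a ≤ block b
      block-mono b≮a = /-monoˡ-≤ m (rank-mono b≮a)

      block< : ∀ {a r} → a ∈ₚ A → length A ≤ r * m → block a ℕ.< r
      block< i le = m<n*o⇒m/o<n (<-≤-trans (rank<length i) le)

      -- Block i consists of the m ranks j + i m with j < m, and no rank is taken twice.
      block-size : ∀ i → ∑[ a ∈ A ] χ (block a ≟ i) ≤ m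
      block-size i = begin
        ∑[ a ∈ A ] χ (block a ≟ i)                                ≤⟨ ∑-mono A (λ a → χ-≤ (block a ≟ i) (position a)) ⟩
        ∑[ a ∈ A ] ∑[ j ∈ upTo m ] χ (rank a ≟ j + i * m)          ≡⟨ ∑-swap A (upTo m) _ ⟩
        ∑[ j ∈ upTo m ] ∑[ a ∈ A ] χ (rank a ≟ j + i * m)          ≤⟨ ∑-bound (upTo m) (λ {j} _ → one (j + i * m)) ⟩
        length (upTo m) * 1                                       ≡⟨ trans (*-identityʳ _) (length-upTo m) ⟩
        m                                                         ∎
        where
        open ≤-Reasoning
        position : ∀ a → block a ≡ i → 1 ≤ ∑[ j ∈ upTo m ] χ (rank a ≟ j + i * m)
        position a refl = 1≤∑χ (λ j → rank a ≟ j + i * m) (∈-upTo⁺ (m%n<n (rank a) m)) (m≡m%n+[m/n]*n (rank a) m)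
        one : ∀ k → ∑[ a ∈ A ] χ (rank a ≟ k) ≤ 1
        one k = ∑χ≤1 (λ a → rank a ≟ k) A! λ i j eq eq′ a≉b → a≉b (rank-injective i j (trans eq (sym eq′)))

  -- Two common points must have the same first coordinate. Phrased through incidences, this treats
  -- parallel and crossing lines alike, and it is all that the counting of pairs of points requires.
  Distinct : Line → Line → Set
  Distinct ℓ ℓ′ = ∀ a b a′ b′ → On ℓ a b → On ℓ a′ b′ → On ℓ′ a b → On ℓ′ a′ b′ → ¬ ¬ (a ≈ a′)

  count : List ℝ → List ℝ → Line → ℕ
  count A B ℓ = ∑[ a ∈ A ] ∑[ b ∈ B ] χ (em {On ℓ a b})

  count≤lengthˡ : ∀ {A B ℓ} → Unique B → NonZeroPair (proj₁ ℓ) → count A B ℓ ≤ length A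
  count≤lengthˡ {A} B! (p≉0 , _) = ≤-trans
    (∑-bound A λ {a} _ → ∑χ≤1 (λ b → em) B! λ _ _ h h′ b≉b′ → b≉b′ (On-injˡ h h′ p≉0 ≈-refl))
    (≤-reflexive (*-identityʳ _))

  count≤lengthʳ : ∀ {A B ℓ} → Unique A → NonZeroPair (proj₁ ℓ) → count A B ℓ ≤ length B
  count≤lengthʳ {A} {B} {ℓ} A! (_ , q≉0) = ≤-trans (≤-reflexive (∑-swap A B _)) (≤-trans
    (∑-bound B λ {b} _ → ∑χ≤1 (λ a → em {On ℓ a b}) A! λ _ _ h h′ a≉a′ → a≉a′ (On-injʳ h h′ q≉0 ≈-refl))
    (≤-reflexive (*-identityʳ _)))

  -- The grid A × B is cut into r × r cells by blocks of consecutive elements.  A line is a chain for one of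
  -- the two diagonal orders, so it meets fewer than 2r cells.
  module Grid {A B : List ℝ} (A! : Unique A) (B! : Unique B) (r m n : ℕ) .{{_ : NonZero m}} .{{_ : NonZero n}}
              (A≤ : length A ≤ r * m) (B≤ : length B ≤ r * n) where

    open Rank A A! using () renaming (module Blocks to Blocksᴬ)
    open Rank B B! using () renaming (module Blocks to Blocksᴮ)
    open Blocksᴬ m using () renaming (block to α; block-mono to α-mono; block< to α<; block-size to α-size)
    open Blocksᴮ n using () renaming (block to β; block-mono to β-mono; block< to β<; block-size to β-size)

    points : List (ℝ × ℝ)
    points = cartesianProduct A B

    module _ (ℓ : Line) where

      weight : ℝ × ℝ → ℕ
      weight (a , b) = χ (em {On ℓ a b})

      -- A numbering, with fewer than 2r + 1 values, that tells apart the cells met by ℓ. It encodes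
      -- that ℓ meets few cells without listing them.
      Key : (ℝ × ℝ → ℕ) → Set
      Key κ = (∀ {a b} → a ∈ₚ A → b ∈ₚ B → κ (a , b) ℕ.< 2 * r) ×
              (∀ {a b a′ b′} → On ℓ a b → On ℓ a′ b′ → a ∈ₚ A → b ∈ₚ B → a′ ∈ₚ A → b′ ∈ₚ B →
                 κ (a , b) ≡ κ (a′ , b′) → α a ≡ α a′ × β b ≡ β b′)

      private
        +-rigid : ∀ {x y x′ y′} → x ≤ x′ → y ≤ y′ → x + y ≡ x′ + y′ → x ≡ x′ × y ≡ y′
        +-rigid {x} {y} {x′} {y′} x≤ y≤ eq with m≤n⇒m<n∨m≡n x≤
        ... | inj₁ x<x′ = contradiction eq (<⇒≢ (+-mono-<-≤ x<x′ y≤))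
        ... | inj₂ refl = refl , +-cancelˡ-≡ x y y′ eq

        ≈⇒⊀ : ∀ {x y} → x ≈ y → ¬ (x ≺ y)
        ≈⇒⊀ x≈y x<y = ≺⇒≉ x<y x≈y

      -- Along an increasing line both block numbers are weakly monotone, so equal sums force equal
      -- summands. Along a decreasing line r ∸ β restores the monotonicity; the truncation never
      -- acts because β < r.
      line-key : NonZeroPair (proj₁ ℓ) → ∃[ κ ] Key κ
      line-key nz@(p≉0 , q≉0) with On-monotone {ℓ} nz
      ... | inj₁ inc = (λ (a , b) → α a + β b) , bound , rigid
        where
        bound : ∀ {a b} → a ∈ₚ A → b ∈ₚ B → α a + β b ℕ.< 2 * r
        bound i j = ≤-trans (+-mono-<-≤ (α< {r = r} i A≤) (<⇒≤ (β< {r = r} j B≤))) (≤-reflexive (cong (r +_) (sym (+-identityʳ r))))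
        rigid : ∀ {a b a′ b′} → On ℓ a b → On ℓ a′ b′ → a ∈ₚ A → b ∈ₚ B → a′ ∈ₚ A → b′ ∈ₚ B →
                α a + β b ≡ α a′ + β b′ → α a ≡ α a′ × β b ≡ β b′
        rigid {a} {b} {a′} {b′} h h′ _ _ _ _ eq with compare a a′
        ... | inj₁ a<a′ = +-rigid (α-mono (≺-asym a<a′)) (β-mono (inc h h′ a<a′)) eq
        ... | inj₂ (inj₁ a≈a′) = +-rigid (α-mono (≈⇒⊀ (≈-sym a≈a′))) (β-mono (≈⇒⊀ (≈-sym (On-injˡ h h′ p≉0 a≈a′)))) eq
        ... | inj₂ (inj₂ a′<a) = let e , e′ = +-rigid (α-mono (≺-asym a′<a)) (β-mono (inc h′ h a′<a)) (sym eq) in sym e , sym e′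
      ... | inj₂ dec = (λ (a , b) → α a + (r ∸ β b)) , bound , rigid
        where
        bound : ∀ {a b} → a ∈ₚ A → b ∈ₚ B → α a + (r ∸ β b) ℕ.< 2 * r
        bound {b = b} i _ = ≤-trans (+-mono-<-≤ (α< {r = r} i A≤) (m∸n≤m r (β b))) (≤-reflexive (cong (r +_) (sym (+-identityʳ r))))
        flip : ∀ {b b′} → b ∈ₚ B → b′ ∈ₚ B → r ∸ β b ≡ r ∸ β b′ → β b ≡ β b′
        flip i j = ∸-cancelˡ-≡ (<⇒≤ (β< {r = r} i B≤)) (<⇒≤ (β< {r = r} j B≤))
        rigid : ∀ {a b a′ b′} → On ℓ a b → On ℓ a′ b′ → a ∈ₚ A → b ∈ₚ B → a′ ∈ₚ A → b′ ∈ₚ B →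
                α a + (r ∸ β b) ≡ α a′ + (r ∸ β b′) → α a ≡ α a′ × β b ≡ β b′
        rigid {a} {b} {a′} {b′} h h′ _ j _ j′ eq with compare a a′
        ... | inj₁ a<a′ = let e , e′ = +-rigid (α-mono (≺-asym a<a′)) (∸-monoʳ-≤ r (β-mono (dec h h′ a<a′))) eq in e , flip j j′ e′
        ... | inj₂ (inj₁ a≈a′) = let e , e′ = +-rigid (α-mono (≈⇒⊀ (≈-sym a≈a′))) (∸-monoʳ-≤ r (β-mono (≈⇒⊀ (On-injˡ h h′ p≉0 a≈a′)))) eq
                                 in e , flip j j′ e′
        ... | inj₂ (inj₂ a′<a) = let e , e′ = +-rigid (α-mono (≺-asym a′<a)) (∸-monoʳ-≤ r (β-mono (dec h′ h a′<a))) (sym eq)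
                                 in sym e , sym (flip j′ j e′)

      cell : ℝ × ℝ → ℝ × ℝ → ℕ
      cell (a , b) (a′ , b′) = χ (α a′ ≟ α a) * χ (β b′ ≟ β b)

      joint : ℝ × ℝ → ℝ × ℝ → ℕ
      joint x y = weight x * weight y * χ (em {proj₁ x ≉ proj₁ y})

      collinear-pairs : ℕ
      collinear-pairs = ∑[ x ∈ points ] ∑[ y ∈ points ] (cell x y * joint x y)

      count≡weight : count A B ℓ ≡ ∑ points weight
      count≡weight = sym (∑-cartesianProduct A B weight)

      -- Cauchy-Schwarz over the 2r keys gives w² ≤ 2r (o + w), where o counts pairs in one cell
      -- with different first coordinates and w absorbs the remaining ones, at most one per point.
      -- As 4r ≤ w, doubling this lets 4r w be absorbed into w².
      rich⇒pairs : NonZeroPair (proj₁ ℓ) → 4 * r ≤ count A B ℓ → count A B ℓ ^ 2 ≤ 4 * r * collinear-pairs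
      rich⇒pairs nz@(p≉0 , _) 4r≤ = subst (λ w → w ^ 2 ≤ 4 * r * collinear-pairs) (sym count≡weight)
        (absorb (∑ points weight) collinear-pairs (subst (4 * r ≤_) count≡weight 4r≤) (begin
          ∑ points weight * ∑ points weight
            ≤⟨ collisions points weight κ (2 * r) (λ i _ → let i₁ , i₂ = ∈-cartesianProduct⁻ A B i in bound i₁ i₂) ⟩
          2 * r * (∑[ x ∈ points ] ∑[ y ∈ points ] (weight x * weight y * χ (κ x ≟ κ y)))
            ≤⟨ *-monoʳ-≤ (2 * r) (∑-mono-∈ points λ i → ∑-mono-∈ points λ j → separate i j) ⟩
          2 * r * (∑[ x ∈ points ] ∑[ y ∈ points ] (cell x y * joint x y + weight x * diagonal x y))
            ≡⟨ cong (2 * r *_) (trans (∑-cong points (λ x → ∑-distrib-+ points _ _)) (∑-distrib-+ points _ _)) ⟩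
          2 * r * (collinear-pairs + (∑[ x ∈ points ] ∑[ y ∈ points ] (weight x * diagonal x y)))
            ≤⟨ *-monoʳ-≤ (2 * r) (+-monoʳ-≤ collinear-pairs (∑-mono points λ x → ≤-trans
                 (≤-reflexive (sym (*-distribˡ-∑ (weight x) points _)))
                 (≤-trans (*-monoʳ-≤ (weight x) (one x)) (≤-reflexive (*-identityʳ _))))) ⟩
          2 * r * (collinear-pairs + ∑ points weight) ∎))
        where
        open ≤-Reasoning
        key = line-key nz
        κ = proj₁ key
        bound = λ {a} {b} → proj₁ (proj₂ key) {a} {b}
        rigid = λ {a} {b} {a′} {b′} → proj₂ (proj₂ key) {a} {b} {a′} {b′}
        diagonal : ℝ × ℝ → ℝ × ℝ → ℕ
        diagonal (a , _) (a′ , b′) = χ (em {a ≈ a′}) * χ (em {On ℓ a′ b′})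
        separate : ∀ {x y} → x ∈ₚ points → y ∈ₚ points →
                   weight x * weight y * χ (κ x ≟ κ y) ≤ cell x y * joint x y + weight x * diagonal x y
        separate {x@(a , b)} {y@(a′ , b′)} i j = ≤-trans (≤-reflexive (*-assoc (weight x) _ _))
          (χ*-≤ (em {On ℓ a b}) λ h → χ*-≤ (em {On ℓ a′ b′}) λ h′ → χ-≤ (κ x ≟ κ y) λ eq → split h h′ eq em)
          where
          split : On ℓ a b → On ℓ a′ b′ → κ x ≡ κ y → Dec (a ≈ a′) → 1 ≤ cell x y * joint x y + weight x * diagonal x y
          split h h′ eq (yes a≈a′) = ≤-trans
            (≤-reflexive (sym (cong₂ _*_ (χ-yes (em {On ℓ a b}) h)
              (cong₂ _*_ (χ-yes (em {a ≈ a′}) a≈a′) (χ-yes (em {On ℓ a′ b′}) h′)))))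
            (m≤n+m _ (cell x y * joint x y))
          split h h′ eq (no a≉a′) =
            let i₁ , i₂ = ∈-cartesianProduct⁻ A B i
                j₁ , j₂ = ∈-cartesianProduct⁻ A B j
                e₁ , e₂ = rigid h h′ i₁ i₂ j₁ j₂ eq
            in ≤-trans
              (≤-reflexive (sym (cong₂ _*_
                (cong₂ _*_ (χ-yes (α a′ ≟ α a) (sym e₁)) (χ-yes (β b′ ≟ β b) (sym e₂)))
                (cong₂ _*_ (cong₂ _*_ (χ-yes (em {On ℓ a b}) h) (χ-yes (em {On ℓ a′ b′}) h′)) (χ-yes (em {a ≉ a′}) a≉a′)))))
              (m≤m+n _ _)
        one : ∀ x → ∑[ y ∈ points ] diagonal x y ≤ 1
        one x@(a , _) = begin
          ∑[ y ∈ points ] diagonal x y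
            ≡⟨ ∑-cartesianProduct A B (diagonal x) ⟩
          ∑[ a′ ∈ A ] ∑[ b′ ∈ B ] (χ (em {a ≈ a′}) * χ (em {On ℓ a′ b′}))
            ≡⟨ ∑-cong A (λ a′ → sym (*-distribˡ-∑ (χ (em {a ≈ a′})) B _)) ⟩
          ∑[ a′ ∈ A ] (χ (em {a ≈ a′}) * (∑[ b′ ∈ B ] χ (em {On ℓ a′ b′})))
            ≤⟨ ∑-mono A (λ a′ → ≤-trans (*-monoʳ-≤ (χ (em {a ≈ a′}))
                 (∑χ≤1 (λ b′ → em {On ℓ a′ b′}) B! λ _ _ h h′ b≉b′ → b≉b′ (On-injˡ h h′ p≉0 ≈-refl)))
                 (≤-reflexive (*-identityʳ _))) ⟩
          ∑[ a′ ∈ A ] χ (em {a ≈ a′})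
            ≤⟨ ∑χ≤1 (λ a′ → em {a ≈ a′}) A! (λ _ _ e e′ ne → ne (≈-trans (≈-sym e) e′)) ⟩
          1 ∎
        absorb : ∀ w o → 4 * r ≤ w → w * w ≤ 2 * r * (o + w) → w ^ 2 ≤ 4 * r * o
        absorb w o 4r≤w le = +-cancelʳ-≤ (w * w) _ _ (begin
          w ^ 2 + w * w               ≡⟨ solve 1 (λ w → w :^ 2 :+ w :* w := con 2 :* (w :* w)) refl w ⟩
          2 * (w * w)                 ≤⟨ *-monoʳ-≤ 2 le ⟩
          2 * (2 * r * (o + w))       ≡⟨ solve 3 (λ r o w → con 2 :* (con 2 :* r :* (o :+ w)) := con 4 :* r :* o :+ con 4 :* r :* w) refl r o w ⟩
          4 * r * o + 4 * r * w       ≤⟨ +-monoʳ-≤ (4 * r * o) (*-monoˡ-≤ w 4r≤w) ⟩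
          4 * r * o + w * w           ∎)
          where open +-*-Solver

    -- A pair of points with different first coordinates lies on at most one of the lines, and a
    -- point shares its cell with at most m n points.
    ∑-collinear-pairs : ∀ {Ls} → AllPairs Distinct Ls →
                        ∑[ ℓ ∈ Ls ] collinear-pairs ℓ ≤ length A * length B * (m * n)
    ∑-collinear-pairs {Ls} Ls! = begin
      ∑[ ℓ ∈ Ls ] ∑[ x ∈ points ] ∑[ y ∈ points ] (cell₀ x y * joint ℓ x y)
        ≡⟨ trans (∑-swap Ls points _) (∑-cong points λ x → ∑-swap Ls points _) ⟩
      ∑[ x ∈ points ] ∑[ y ∈ points ] ∑[ ℓ ∈ Ls ] (cell₀ x y * joint ℓ x y)
        ≤⟨ ∑-mono points (λ x → ∑-mono points λ y → ≤-trans
             (≤-reflexive (sym (*-distribˡ-∑ (cell₀ x y) Ls _)))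
             (≤-trans (*-monoʳ-≤ (cell₀ x y) (one x y)) (≤-reflexive (*-identityʳ _)))) ⟩
      ∑[ x ∈ points ] ∑[ y ∈ points ] cell₀ x y
        ≤⟨ ∑-mono points cell-size ⟩
      ∑[ x ∈ points ] m * n
        ≡⟨ trans (∑-cartesianProduct A B _) (trans (∑-cong A λ _ → ∑-const B (m * n)) (trans (∑-const A _) (sym (*-assoc (length A) _ _)))) ⟩
      length A * length B * (m * n) ∎
      where
      open ≤-Reasoning
      cell₀ : ℝ × ℝ → ℝ × ℝ → ℕ
      cell₀ (a , b) (a′ , b′) = χ (α a′ ≟ α a) * χ (β b′ ≟ β b)
      cell-size : ∀ x → ∑[ y ∈ points ] cell₀ x y ≤ m * n
      cell-size x@(a , b) = ≤-trans (≤-reflexive (trans (∑-cartesianProduct A B (cell₀ x)) (sym (∑-* A B _ _))))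
        (*-mono-≤ (α-size (α a)) (β-size (β b)))
      one : ∀ x y → ∑[ ℓ ∈ Ls ] joint ℓ x y ≤ 1
      one x@(a , b) y@(a′ , b′) = ≤-trans
        (∑-mono Ls λ ℓ → ≤-trans (*-monoˡ-≤ (χ (em {a ≉ a′})) (χ-*-mono (em {On ℓ a b}) (em {On ℓ a′ b′}) (em {On ℓ a b × On ℓ a′ b′}) _,_))
          (χ-*-mono (em {On ℓ a b × On ℓ a′ b′}) (em {a ≉ a′}) (em {(On ℓ a b × On ℓ a′ b′) × a ≉ a′}) _,_))
        (∑χ≤1 (λ ℓ → em {(On ℓ a b × On ℓ a′ b′) × a ≉ a′}) Ls!
          λ _ _ ((h , h′) , a≉a′) ((k , k′) , _) distinct → distinct a b a′ b′ h h′ k k′ a≉a′)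

  -- The Szemerédi–Trotter bound for a grid.
  rich-lines : ∀ {A B} → Unique A → Unique B → ∀ k → 4 ≤ k → ∀ Ls → AllPairs Distinct Ls →
               (∀ {ℓ} → ℓ ∈ₚ Ls → NonZeroPair (proj₁ ℓ)) → (∀ {ℓ} → ℓ ∈ₚ Ls → k ≤ count A B ℓ) →
               k ^ 3 * length Ls ≤ 128 * (length A * length B) ^ 2
  rich-lines _ _ k _ [] _ _ _ = ≤-trans (≤-reflexive (*-zeroʳ (k ^ 3))) z≤n
  rich-lines {A} {B} A! B! k 4≤k Ls@(_ ∷ _) Ls! nz rich = begin
    k ^ 3 * N                                    ≡⟨ solve 2 (λ k N → k :^ 3 :* N := k :* (N :* k :^ 2)) refl k N ⟩
    k * (N * k ^ 2)                              ≤⟨ *-mono-≤ k≤8r total ⟩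
    8 * r * (4 * r * (a * b * (m * n)))          ≡⟨ solve 5 (λ r a b m n → con 8 :* r :* (con 4 :* r :* (a :* b :* (m :* n)))
                                                      := con 32 :* (a :* b) :* (r :* m :* (r :* n))) refl r a b m n ⟩
    32 * (a * b) * (r * m * (r * n))             ≤⟨ *-monoʳ-≤ (32 * (a * b)) (*-mono-≤ (rm≤ a k≤a) (rm≤ b k≤b)) ⟩
    32 * (a * b) * (2 * a * (2 * b))             ≡⟨ solve 2 (λ a b → con 32 :* (a :* b) :* (con 2 :* a :* (con 2 :* b))
                                                      := con 128 :* (a :* b) :^ 2) refl a b ⟩
    128 * (a * b) ^ 2                            ∎
    where
    open ≤-Reasoning
    open +-*-Solver
    N = length Ls
    a = length A
    b = length B
    k≤a : k ≤ a
    k≤a = ≤-trans (rich (here refl)) (count≤lengthˡ {A} {B} B! (nz (here refl)))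
    k≤b : k ≤ b
    k≤b = ≤-trans (rich (here refl)) (count≤lengthʳ {A} {B} A! (nz (here refl)))
    -- The largest r allowed by the condition 4r ≤ k of `rich⇒pairs`, so that r is comparable to k.
    -- Since r ≤ k ≤ a and k ≤ b, rounding the block sizes up at most doubles r m and r n. Together
    -- 128 = 8 · 4 · 2 · 2, from k ≤ 8r, from the 4r of `rich⇒pairs`, and from the two doublings.
    r = k / 4
    1≤r : 1 ≤ r
    1≤r = /-monoˡ-≤ 4 4≤k
    instance
      r≢0 : NonZero r
      r≢0 = ℕ.>-nonZero 1≤r
    m = suc (a / r)
    n = suc (b / r)
    4r≤k : 4 * r ≤ k
    4r≤k = ≤-trans (≤-reflexive (*-comm 4 r)) (m/n*n≤m k 4)
    k≤8r : k ≤ 8 * r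
    k≤8r = begin
      k                ≡⟨ m≡m%n+[m/n]*n k 4 ⟩
      k % 4 + r * 4    ≤⟨ +-monoˡ-≤ (r * 4) (≤-trans (<⇒≤ (m%n<n k 4)) (*-monoʳ-≤ 4 1≤r)) ⟩
      4 * r + r * 4    ≡⟨ solve 1 (λ r → con 4 :* r :+ r :* con 4 := con 8 :* r) refl r ⟩
      8 * r            ∎
    cover : ∀ a → a ≤ r * suc (a / r)
    cover a = begin
      a                    ≡⟨ m≡m%n+[m/n]*n a r ⟩
      a % r + a / r * r    ≤⟨ +-monoˡ-≤ _ (<⇒≤ (m%n<n a r)) ⟩
      r + a / r * r        ≡⟨ solve 2 (λ r q → r :+ q :* r := r :* (con 1 :+ q)) refl r (a / r) ⟩
      r * suc (a / r)      ∎
    rm≤ : ∀ a → k ≤ a → r * suc (a / r) ≤ 2 * a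
    rm≤ a k≤a = begin
      r * suc (a / r)   ≡⟨ solve 2 (λ r q → r :* (con 1 :+ q) := r :+ q :* r) refl r (a / r) ⟩
      r + a / r * r     ≤⟨ +-mono-≤ (≤-trans (≤-trans (m≤n*m r 4) 4r≤k) k≤a) (m/n*n≤m a r) ⟩
      a + a             ≡⟨ cong (a +_) (+-identityʳ a) ⟨
      2 * a             ∎
    open Grid A! B! r m n (cover a) (cover b)
    total : N * k ^ 2 ≤ 4 * r * (a * b * (m * n))
    total = begin
      N * k ^ 2                                    ≡⟨ ∑-const Ls (k ^ 2) ⟨
      ∑[ ℓ ∈ Ls ] k ^ 2                            ≤⟨ ∑-mono-∈ Ls (λ {ℓ} i → ≤-trans (^-monoˡ-≤ 2 (rich i))
                                                        (rich⇒pairs ℓ (nz i) (≤-trans 4r≤k (rich i)))) ⟩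
      ∑[ ℓ ∈ Ls ] (4 * r * collinear-pairs ℓ)      ≡⟨ *-distribˡ-∑ (4 * r) Ls collinear-pairs ⟨
      4 * r * ∑ Ls collinear-pairs                 ≤⟨ *-monoʳ-≤ (4 * r) (∑-collinear-pairs Ls!) ⟩
      4 * r * (a * b * (m * n))                    ∎

  -- Choosing representatives

  record Representatives {X : Set} (R : X → X → Set) (xs : List X) : Set where
    field
      elements : List X
      ⊆-source : ∀ {y} → y ∈ₚ elements → y ∈ₚ xs
      separate : AllPairs (λ y z → ¬ R z y) elements
      covering : ∀ {x} → x ∈ₚ xs → ∃[ y ] (y ∈ₚ elements × R y x)
      length≤  : length elements ≤ length xs

  open Representatives public

  -- A greedy choice from the end of the list, with excluded middle deciding whether an entry is
  -- already covered. R is not an equivalence in general, as `∥` is transitive only through nonzero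
  -- pairs.
  representatives : {X : Set} {R : X → X → Set} → (∀ x → R x x) → ∀ xs → Representatives R xs
  representatives _ [] = record
    { elements = [] ; ⊆-source = λ () ; separate = [] ; covering = λ () ; length≤ = z≤n }
  representatives {X} {R} R-refl (x ∷ xs) = extend em
    where
    rec : Representatives R xs
    rec = representatives R-refl xs
    extend : Dec (∃[ y ] (y ∈ₚ elements rec × R y x)) → Representatives R (x ∷ xs)
    extend (yes old) = record
      { elements = elements rec
      ; ⊆-source = there ∘ ⊆-source rec
      ; separate = separate rec
      ; covering = λ { (here refl) → old ; (there i) → covering rec i }
      ; length≤  = m≤n⇒m≤1+n (length≤ rec)
      }
    extend (no new) = record
      { elements = x ∷ elements rec
      ; ⊆-source = λ { (here refl) → here refl ; (there i) → there (⊆-source rec i) }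
      ; separate = All.tabulate (λ i r → new (_ , i , r)) ∷ separate rec
      ; covering = λ { (here refl) → x , here refl , R-refl x
                     ; (there i) → let y , j , r = covering rec i in y , there j , r }
      ; length≤  = s≤s (length≤ rec)
      }

  -- Ratios and multiplicative energy

  AllNonZero : List ℝ → Set
  AllNonZero Y = ∀ {y} → y ∈ₚ Y → y ≉ 0ℝ

  cartesianProduct-nonZero : ∀ {Y Z} → AllNonZero Y → AllNonZero Z →
                             ∀ {u} → u ∈ₚ cartesianProduct Y Z → NonZeroPair u
  cartesianProduct-nonZero {Y} {Z} nzY nzZ i = let j , k = ∈-cartesianProduct⁻ Y Z i in nzY j , nzZ k

  ρ : List (ℝ × ℝ) → ℝ × ℝ → ℕ
  ρ P k = ∑[ u ∈ P ] χ (em {k ∥ u})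

  parallels : List (ℝ × ℝ) → List (ℝ × ℝ) → ℕ
  parallels P Q = ∑[ u ∈ P ] ∑[ v ∈ Q ] χ (em {u ∥ v})

  module _ {P : List (ℝ × ℝ)} (nz : ∀ {u} → u ∈ₚ P → NonZeroPair u) where

    ratios : Representatives _∥_ P
    ratios = representatives ∥-refl P

    -- The representative k of u is also parallel to every v parallel to u.
    parallels≤∑ρρ : ∀ Q → parallels P Q ≤ ∑[ k ∈ elements ratios ] (ρ P k * ρ Q k)
    parallels≤∑ρρ Q = begin
      ∑[ u ∈ P ] ∑[ v ∈ Q ] χ (em {u ∥ v})
        ≤⟨ ∑-mono-∈ P (λ {u} i → ∑-mono Q λ v → through u v i) ⟩
      ∑[ u ∈ P ] ∑[ v ∈ Q ] ∑[ k ∈ ks ] (χ (em {k ∥ u}) * χ (em {k ∥ v}))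
        ≡⟨ ∑-cong P (λ u → ∑-swap Q ks _) ⟩
      ∑[ u ∈ P ] ∑[ k ∈ ks ] ∑[ v ∈ Q ] (χ (em {k ∥ u}) * χ (em {k ∥ v}))
        ≡⟨ ∑-swap P ks _ ⟩
      ∑[ k ∈ ks ] ∑[ u ∈ P ] ∑[ v ∈ Q ] (χ (em {k ∥ u}) * χ (em {k ∥ v}))
        ≡⟨ ∑-cong ks (λ k → ∑-* P Q _ _) ⟨
      ∑[ k ∈ ks ] (ρ P k * ρ Q k) ∎
      where
      open ≤-Reasoning
      ks = elements ratios
      through : ∀ u v → u ∈ₚ P → χ (em {u ∥ v}) ≤ ∑[ k ∈ ks ] (χ (em {k ∥ u}) * χ (em {k ∥ v}))
      through u v i = let k , j , k∥u = covering ratios i in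
        χ-≤ (em {u ∥ v}) λ u∥v → ≤-trans
          (≤-reflexive (sym (cong₂ _*_ (χ-yes (em {k ∥ u}) k∥u) (χ-yes (em {k ∥ v}) (∥-trans (nz i) k∥u u∥v)))))
          (term≤∑ (λ k → χ (em {k ∥ u}) * χ (em {k ∥ v})) j)

    ∑ρ²≤parallels : ∀ {Q} → (∀ {u} → u ∈ₚ Q → NonZeroPair u) →
                    ∑[ k ∈ elements ratios ] (ρ Q k * ρ Q k) ≤ parallels Q Q
    ∑ρ²≤parallels {Q} nzQ = begin
      ∑[ k ∈ ks ] (ρ Q k * ρ Q k)
        ≡⟨ ∑-cong ks (λ k → ∑-* Q Q _ _) ⟩
      ∑[ k ∈ ks ] ∑[ u ∈ Q ] ∑[ v ∈ Q ] (χ (em {k ∥ u}) * χ (em {k ∥ v}))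
        ≡⟨ ∑-swap ks Q _ ⟩
      ∑[ u ∈ Q ] ∑[ k ∈ ks ] ∑[ v ∈ Q ] (χ (em {k ∥ u}) * χ (em {k ∥ v}))
        ≡⟨ ∑-cong Q (λ u → ∑-swap ks Q _) ⟩
      ∑[ u ∈ Q ] ∑[ v ∈ Q ] ∑[ k ∈ ks ] (χ (em {k ∥ u}) * χ (em {k ∥ v}))
        ≤⟨ ∑-mono-∈ Q (λ {u} i → ∑-mono Q λ v → joint u v i) ⟩
      ∑[ u ∈ Q ] ∑[ v ∈ Q ] χ (em {u ∥ v}) ∎
      where
      open ≤-Reasoning
      ks = elements ratios
      joint : ∀ u v → u ∈ₚ Q → ∑[ k ∈ ks ] (χ (em {k ∥ u}) * χ (em {k ∥ v})) ≤ χ (em {u ∥ v})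
      joint u v i = begin
        ∑[ k ∈ ks ] (χ (em {k ∥ u}) * χ (em {k ∥ v}))
          ≤⟨ ∑-mono-∈ ks (λ {k} j → χ*-≤ (em {k ∥ u}) λ k∥u → χ-≤ (em {k ∥ v}) λ k∥v → ≤-reflexive (sym (cong₂ _*_
               (χ-yes (em {u ∥ v}) (∥-trans (nz (⊆-source ratios j)) (∥-sym k∥u) k∥v)) (χ-yes (em {k ∥ u}) k∥u)))) ⟩
        ∑[ k ∈ ks ] (χ (em {u ∥ v}) * χ (em {k ∥ u}))
          ≡⟨ *-distribˡ-∑ (χ (em {u ∥ v})) ks _ ⟨
        χ (em {u ∥ v}) * (∑[ k ∈ ks ] χ (em {k ∥ u}))
          ≤⟨ *-monoʳ-≤ (χ (em {u ∥ v})) (∑χ≤1 (λ k → em {k ∥ u}) (separate ratios)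
               λ _ _ k∥u k′∥u k′∦k → k′∦k (∥-trans (nzQ i) k′∥u (∥-sym k∥u))) ⟩
        χ (em {u ∥ v}) * 1
          ≡⟨ *-identityʳ _ ⟩
        χ (em {u ∥ v}) ∎

    -- Cauchy-Schwarz for the representation functions over the ratios of P. Ratios that occur only
    -- in Q merely enlarge the right-hand side.
    parallels-cauchy-schwarz : ∀ {Q} → (∀ {u} → u ∈ₚ Q → NonZeroPair u) →
                               parallels P Q * parallels P Q ≤ parallels P P * parallels Q Q
    parallels-cauchy-schwarz {Q} nzQ = ≤-trans (*-mono-≤ (parallels≤∑ρρ Q) (parallels≤∑ρρ Q))
      (≤-trans
        (cauchy-schwarz (elements ratios) {λ k → ρ P k * ρ Q k} {λ k → ρ P k * ρ P k} {λ k → ρ Q k * ρ Q k}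
          λ k → ≤-reflexive (solve 2 (λ a b → a :* b :* (a :* b) := a :* a :* (b :* b)) refl (ρ P k) (ρ Q k)))
        (*-mono-≤ (∑ρ²≤parallels nz) (∑ρ²≤parallels nzQ)))
      where open +-*-Solver

  equalRatios : (A B C D : List ℝ) → ℕ
  equalRatios A B C D = ∑[ x ∈ A ] ∑[ y ∈ B ] ∑[ z ∈ C ] ∑[ w ∈ D ] χ (em {(x , y) ∥ (z , w)})

  -- Multiplicative energy written with equal ratios instead of equal products: in this form it is a
  -- sum of squares over ratios, to which Cauchy-Schwarz applies.
  energy : List ℝ → ℕ
  energy Y = equalRatios Y Y Y Y

  equalRatios≡parallels : ∀ A B C D → equalRatios A B C D ≡ parallels (cartesianProduct A B) (cartesianProduct C D)
  equalRatios≡parallels A B C D = sym (trans (∑-cartesianProduct A B _)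
    (∑-cong A λ x → ∑-cong B λ y → ∑-cartesianProduct C D _))

  module _ {A B : List ℝ} (nzA : AllNonZero A) (nzB : AllNonZero B) where

    equalRatios-cauchy-schwarz : ∀ {C D} → AllNonZero C → AllNonZero D → equalRatios A B C D * equalRatios A B C D ≤ equalRatios A B A B * equalRatios C D C D
    equalRatios-cauchy-schwarz {C} {D} nzC nzD
      rewrite equalRatios≡parallels A B C D | equalRatios≡parallels A B A B | equalRatios≡parallels C D C D =
      parallels-cauchy-schwarz (cartesianProduct-nonZero nzA nzB) (cartesianProduct-nonZero nzC nzD)

    equalRatios-exchange : equalRatios A B A B ≤ equalRatios A A B B
    equalRatios-exchange = ∑-mono A λ x → ≤-trans (≤-reflexive (∑-swap B A _))
      (∑-mono A λ z → ∑-mono B λ y → ∑-mono B λ w → χ-mono em em ∥-exchange)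

  -- Expanding the energy of U ++ V yields sixteen mixed counts. Each is at most β / N times the
  -- product of its four lengths, and these products sum to the fourth power of the total length.
  module Subadditive (N β : ℕ) {U V : List ℝ} (nzU : AllNonZero U) (nzV : AllNonZero V)
                     (U≤ : N * energy U ≤ β * length U ^ 4) (V≤ : N * energy V ≤ β * length V ^ 4) where

    private
      W = U ++ V

      Part : List ℝ → Set
      Part A = A ≡ U ⊎ A ≡ V

      nonZero : ∀ {A} → Part A → AllNonZero A
      nonZero (inj₁ refl) = nzU
      nonZero (inj₂ refl) = nzV

      diagonal : ∀ {A} → Part A → N * energy A ≤ β * length A ^ 4
      diagonal (inj₁ refl) = U≤
      diagonal (inj₂ refl) = V≤

      geometric : ∀ m x y X Y → m * m ≤ x * y → N * x ≤ β * X ^ 2 → N * y ≤ β * Y ^ 2 → N * m ≤ β * (X * Y)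
      geometric m x y X Y mm≤ x≤ y≤ = square-cancel-≤ (N * m) (β * (X * Y)) (begin
        N * m * (N * m)             ≡⟨ solve 2 (λ N m → N :* m :* (N :* m) := N :* N :* (m :* m)) refl N m ⟩
        N * N * (m * m)             ≤⟨ *-monoʳ-≤ (N * N) mm≤ ⟩
        N * N * (x * y)             ≡⟨ solve 3 (λ N x y → N :* N :* (x :* y) := N :* x :* (N :* y)) refl N x y ⟩
        N * x * (N * y)             ≤⟨ *-mono-≤ x≤ y≤ ⟩
        β * X ^ 2 * (β * Y ^ 2)     ≡⟨ solve 3 (λ b X Y → b :* X :^ 2 :* (b :* Y :^ 2) := b :* (X :* Y) :* (b :* (X :* Y))) refl β X Y ⟩
        β * (X * Y) * (β * (X * Y)) ∎)
        where
        open ≤-Reasoning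
        open +-*-Solver

      -- Exchanging the middle variables turns x / y = z / w, with x, z in A and y, w in B, into a
      -- ratio within A equal to a ratio within B. Cauchy-Schwarz then separates A from B.
      two : ∀ {A B} → Part A → Part B → N * equalRatios A B A B ≤ β * (length A * length B) ^ 2
      two {A} {B} a b = ≤-trans (*-monoʳ-≤ N (equalRatios-exchange (nonZero a) (nonZero b)))
        (≤-trans (geometric (equalRatios A A B B) (energy A) (energy B) (length A ^ 2) (length B ^ 2) (equalRatios-cauchy-schwarz (nonZero a) (nonZero a) (nonZero b) (nonZero b))
                   (≤-trans (diagonal a) (≤-reflexive (fourth (length A)))) (≤-trans (diagonal b) (≤-reflexive (fourth (length B)))))
          (≤-reflexive (cong (β *_) (sym (^-distribʳ-* 2 (length A) (length B))))))
        where
        open +-*-Solver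
        fourth : ∀ l → β * l ^ 4 ≡ β * (l ^ 2) ^ 2
        fourth l = cong (β *_) (sym (^-*-assoc l 2 2))

      four : ∀ {A B C D} → Part A → Part B → Part C → Part D →
             N * equalRatios A B C D ≤ β * (length A * length B * (length C * length D))
      four {A} {B} {C} {D} a b c d = geometric (equalRatios A B C D) (equalRatios A B A B) (equalRatios C D C D) (length A * length B) (length C * length D)
        (equalRatios-cauchy-schwarz (nonZero a) (nonZero b) (nonZero c) (nonZero d)) (two a b) (two c d)

      -- One argument at a time, the parts are replaced by their union.
      combine : ∀ {m x y} K → m ≡ x + y → N * x ≤ β * (length U * K) → N * y ≤ β * (length V * K) →
                N * m ≤ β * (length W * K)
      combine {x = x} {y} K refl x≤ y≤ = begin
        N * (x + y)                                 ≡⟨ *-distribˡ-+ N x y ⟩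
        N * x + N * y                               ≤⟨ +-mono-≤ x≤ y≤ ⟩
        β * (length U * K) + β * (length V * K)     ≡⟨ solve 4 (λ b u v k → b :* (u :* k) :+ b :* (v :* k) := b :* ((u :+ v) :* k))
                                                         refl β (length U) (length V) K ⟩
        β * ((length U + length V) * K)             ≡⟨ cong (λ l → β * (l * K)) (sym (length-++ U)) ⟩
        β * (length W * K)                          ∎
        where
        open ≤-Reasoning
        open +-*-Solver

      rearrange : ∀ {m k k′} → k ≡ k′ → N * m ≤ β * k → N * m ≤ β * k′
      rearrange refl le = le

      open +-*-Solver

      step₁ : ∀ {B C D} → Part B → Part C → Part D →
              N * equalRatios W B C D ≤ β * (length W * (length B * (length C * length D)))
      step₁ {B} {C} {D} b c d = combine (length B * (length C * length D)) (∑-++ U V _)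
        (rearrange (*-assoc (length U) _ _) (four (inj₁ refl) b c d))
        (rearrange (*-assoc (length V) _ _) (four (inj₂ refl) b c d))

      step₂ : ∀ {C D} → Part C → Part D → N * equalRatios W W C D ≤ β * (length W * (length W * (length C * length D)))
      step₂ {C} {D} c d = combine (length W * (length C * length D))
        (trans (∑-cong W λ x → ∑-++ U V _) (∑-distrib-+ W _ _))
        (rearrange (exchange (length W) (length U) _) (step₁ (inj₁ refl) c d))
        (rearrange (exchange (length W) (length V) _) (step₁ (inj₂ refl) c d))
        where
        exchange : ∀ a b k → a * (b * k) ≡ b * (a * k)
        exchange = solve 3 (λ a b k → a :* (b :* k) := b :* (a :* k)) refl

      step₃ : ∀ {D} → Part D → N * equalRatios W W W D ≤ β * (length W * (length W * (length W * length D)))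
      step₃ {D} d = combine (length W * (length W * length D))
        (trans (∑-cong W λ x → trans (∑-cong W λ y → ∑-++ U V _) (∑-distrib-+ W _ _)) (∑-distrib-+ W _ _))
        (rearrange (exchange (length W) (length U) _) (step₂ (inj₁ refl) d))
        (rearrange (exchange (length W) (length V) _) (step₂ (inj₂ refl) d))
        where
        exchange : ∀ a b k → a * (a * (b * k)) ≡ b * (a * (a * k))
        exchange = solve 3 (λ a b k → a :* (a :* (b :* k)) := b :* (a :* (a :* k))) refl

    energy-++ : N * energy (U ++ V) ≤ β * length (U ++ V) ^ 4
    energy-++ = rearrange (solve 1 (λ w → w :* (w :* (w :* w)) := w :^ 4) refl (length W)) (combine (length W * (length W * length W))
      (trans (∑-cong W λ x → trans (∑-cong W λ y → trans (∑-cong W λ z → ∑-++ U V _) (∑-distrib-+ W _ _)) (∑-distrib-+ W _ _))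
        (∑-distrib-+ W _ _))
      (rearrange (exchange (length W) (length U)) (step₃ (inj₁ refl)))
      (rearrange (exchange (length W) (length V)) (step₃ (inj₂ refl))))
      where
      exchange : ∀ a b → a * (a * (a * b)) ≡ b * (a * (a * a))
      exchange = solve 2 (λ a b → a :* (a :* (a :* b)) := b :* (a :* (a :* a))) refl

  -- Pencils of parallel lines through the points of Z × Z

  module _ (Z : List ℝ) where

    intercepts : (u : ℝ × ℝ) → Representatives _≈_ (map (intercept u) (cartesianProduct Z Z))
    intercepts u = representatives (λ _ → ≈-refl) _

    pencil : ℝ × ℝ → List Line
    pencil u = map (u ,_) (elements (intercepts u))

    lines : List (ℝ × ℝ) → List Line
    lines = concatMap pencil

    lines-slope : ∀ us {ℓ} → ℓ ∈ₚ lines us → proj₁ ℓ ∈ₚ us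
    lines-slope us i with find (∈-concatMap⁻ pencil {xs = us} i)
    ... | u , j , k with ∈-map⁻ (u ,_) k
    ...   | _ , _ , refl = j

    ∑-lines : ∀ us f → ∑ (lines us) f ≡ ∑[ u ∈ us ] ∑[ c ∈ elements (intercepts u) ] f (u , c)
    ∑-lines []       f = refl
    ∑-lines (u ∷ us) f = trans (∑-++ (pencil u) (lines us) f)
      (cong₂ _+_ (∑-map (u ,_) (elements (intercepts u)) f) (∑-lines us f))

    length-lines : ∀ us → length (lines us) ≤ length us * length Z ^ 2
    length-lines []       = z≤n
    length-lines (u ∷ us) = ≤-trans (≤-reflexive (length-++ (pencil u))) (+-mono-≤ (begin
        length (pencil u)                                  ≡⟨ length-map (u ,_) (elements (intercepts u)) ⟩
        length (elements (intercepts u))                   ≤⟨ length≤ (intercepts u) ⟩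
        length (map (intercept u) (cartesianProduct Z Z))  ≡⟨ trans (length-map (intercept u) (cartesianProduct Z Z)) (length-cartesianProduct Z Z) ⟩
        length Z * length Z                                ≡⟨ cong (length Z *_) (*-identityʳ (length Z)) ⟨
        length Z ^ 2                                       ∎)
      (length-lines us))
      where open ≤-Reasoning

    parallel-distinct : ∀ {u c c′} → ¬ (c′ ≈ c) → Distinct (u , c) (u , c′)
    parallel-distinct c′≉c _ _ _ _ h _ k _ _ = c′≉c (intercept-unique k h)

    transversal-distinct : ∀ {u v c c′} → ¬ (v ∥ u) → Distinct (u , c) (v , c′)
    transversal-distinct v∦u _ _ _ _ h h′ k k′ a≉a′ = v∦u (slope-unique h h′ k k′ a≉a′)

    lines-distinct : ∀ {us} → AllPairs (λ u v → ¬ (v ∥ u)) us → AllPairs Distinct (lines us)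
    lines-distinct {us} us! = AllPairs.concat⁺
      (All.map⁺ (All.tabulate λ {u} _ → AllPairs.map⁺ {f = u ,_}
        (AllPairs.map (λ {c} {c′} c′≉c → parallel-distinct {u} {c} {c′} c′≉c) (separate (intercepts u)))))
      (AllPairs.map⁺ {f = pencil} (AllPairs.map crossing us!))
      where
      crossing : ∀ {u v} → ¬ (v ∥ u) → All (λ ℓ → All (Distinct ℓ) (pencil v)) (pencil u)
      crossing {u} {v} v∦u = All.map⁺ (All.tabulate λ {c} _ → All.map⁺ (All.tabulate λ {c′} _ →
        transversal-distinct {u} {v} {c} {c′} v∦u))

    -- A point lies on at most one line of each pencil.
    ∑-count-lines : ∀ A us → ∑ (lines us) (count A A) ≤ length us * length A ^ 2
    ∑-count-lines A us = ≤-trans (≤-reflexive (∑-lines us (count A A))) (∑-bound us λ {u} _ → begin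
      ∑[ c ∈ elements (intercepts u) ] ∑[ a ∈ A ] ∑[ b ∈ A ] χ (em {On (u , c) a b})
        ≡⟨ trans (∑-swap (elements (intercepts u)) A _) (∑-cong A λ a → ∑-swap (elements (intercepts u)) A _) ⟩
      ∑[ a ∈ A ] ∑[ b ∈ A ] ∑[ c ∈ elements (intercepts u) ] χ (em {On (u , c) a b})
        ≤⟨ ∑-bound A (λ {a} _ → ∑-bound A λ {b} _ → ∑χ≤1 (λ c → em {On (u , c) a b}) (separate (intercepts u))
             λ _ _ h h′ c′≉c → c′≉c (intercept-unique h′ h)) ⟩
      length A * (length A * 1) ∎)
      where open ≤-Reasoning

  -- If many pairs of differences z - y = d have y in Y, then the ratios of Y produce many pairs of points,
  -- in Z × Z and in D × D, on a common line.
  module _ (Z D : List ℝ) where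

    private
      ZD = cartesianProduct Z D

    translate : ℝ → ℝ × ℝ → ℕ
    translate y (z , d) = χ (em {Difference z y d})

    degree : ℝ → ℕ
    degree y = ∑ ZD (translate y)

    -- The number of pairs of a point of Z × Z and a point of D × D on one line of direction u.
    common : ℝ × ℝ → ℕ
    common u = ∑[ c ∈ elements (intercepts Z u) ] (count Z Z (u , c) * count D D (u , c))

    private
      common-at : ℝ × ℝ → ℝ × ℝ → ℝ × ℝ → ℕ
      common-at u (z , d) (z′ , d′) = ∑[ c ∈ elements (intercepts Z u) ] (χ (em {On (u , c) z z′}) * χ (em {On (u , c) d d′}))

      1≤common-at : ∀ {u y y′ z d z′ d′} → z ∈ₚ Z → z′ ∈ₚ Z → Difference z y d → Difference z′ y′ d′ → u ∥ (y , y′) →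
                    1 ≤ common-at u (z , d) (z′ , d′)
      1≤common-at {u} {y} {y′} {z} {d} {z′} {d′} i i′ t t′ par =
        let c , j , c≈ = covering (intercepts Z u) (∈-map⁺ (intercept u) (∈-cartesianProduct⁺ i i′))
            onZ = On-resp-≈ {u} (≈-sym c≈) (On-intercept {u} {z} {z′})
            onD = On-resp-≈ {u} (≈-sym c≈) (translate-line {u} {z} {z′} {y} {y′} {d} {d′} t t′ par)
        in ≤-trans (≤-reflexive (sym (cong₂ _*_ (χ-yes (em {On (u , c) z z′}) onZ) (χ-yes (em {On (u , c) d d′}) onD))))
             (term≤∑ (λ c → χ (em {On (u , c) z z′}) * χ (em {On (u , c) d d′})) j)

      ∑-common-at : ∀ u → ∑[ x ∈ ZD ] ∑[ x′ ∈ ZD ] common-at u x x′ ≡ common u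
      ∑-common-at u = begin
        ∑[ x ∈ ZD ] ∑[ x′ ∈ ZD ] ∑[ c ∈ cs ] (f c x x′)
          ≡⟨ trans (∑-cong ZD λ x → ∑-swap ZD cs _) (∑-swap ZD cs _) ⟩
        ∑[ c ∈ cs ] ∑[ x ∈ ZD ] ∑[ x′ ∈ ZD ] (f c x x′)
          ≡⟨ ∑-cong cs (λ c → trans (∑-cartesianProduct Z D _) (∑-cong Z λ z → ∑-cong D λ d → ∑-cartesianProduct Z D _)) ⟩
        ∑[ c ∈ cs ] ∑[ z ∈ Z ] ∑[ d ∈ D ] ∑[ z′ ∈ Z ] ∑[ d′ ∈ D ] (f c (z , d) (z′ , d′))
          ≡⟨ ∑-cong cs (λ c → ∑-cong Z λ z → ∑-swap D Z _) ⟩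
        ∑[ c ∈ cs ] ∑[ z ∈ Z ] ∑[ z′ ∈ Z ] ∑[ d ∈ D ] ∑[ d′ ∈ D ] (f c (z , d) (z′ , d′))
          ≡⟨ ∑-cong cs (λ c → trans (∑-cong Z λ z → ∑-cong Z λ z′ → trans
               (∑-cong D λ d → sym (*-distribˡ-∑ (χ (em {On (u , c) z z′})) D _))
               (sym (*-distribˡ-∑ (χ (em {On (u , c) z z′})) D _)))
               (trans (∑-cong Z λ z → sym (*-distribʳ-∑ (count D D (u , c)) Z _)) (sym (*-distribʳ-∑ (count D D (u , c)) Z _)))) ⟩
        common u ∎
        where
        open ≡-Reasoning
        cs = elements (intercepts Z u)
        f : ℝ → ℝ × ℝ → ℝ × ℝ → ℕ
        f c (z , d) (z′ , d′) = χ (em {On (u , c) z z′}) * χ (em {On (u , c) d d′})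

    -- Each (y , y′) of ratio u has at least q² choices of z - y = d and z′ - y′ = d′, and each
    -- choice gives a pair counted by `common u`. Nothing is counted twice: z and d determine y, as
    -- z′ and d′ determine y′.
    ratios≤common : ∀ {Y q} → Unique Y → (∀ {y} → y ∈ₚ Y → q ≤ degree y) → ∀ u →
                    q ^ 2 * ρ (cartesianProduct Y Y) u ≤ common u
    ratios≤common {Y} {q} Y! q≤ u = begin
      q ^ 2 * ρ (cartesianProduct Y Y) u
        ≡⟨ cong (q ^ 2 *_) (∑-cartesianProduct Y Y _) ⟩
      q ^ 2 * (∑[ y ∈ Y ] ∑[ y′ ∈ Y ] par-χ y y′)
        ≡⟨ trans (*-distribˡ-∑ (q ^ 2) Y _) (∑-cong Y λ y → *-distribˡ-∑ (q ^ 2) Y _) ⟩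
      ∑[ y ∈ Y ] ∑[ y′ ∈ Y ] (q ^ 2 * par-χ y y′)
        ≤⟨ ∑-mono-∈ Y (λ i → ∑-mono-∈ Y λ j → *-monoˡ-≤ _ (square (q≤ i) (q≤ j))) ⟩
      ∑[ y ∈ Y ] ∑[ y′ ∈ Y ] (∑ ZD (translate y) * ∑ ZD (translate y′) * par-χ y y′)
        ≡⟨ ∑-cong Y (λ y → ∑-cong Y λ y′ → trans (cong (_* par-χ y y′) (∑-* ZD ZD _ _))
             (trans (*-distribʳ-∑ (par-χ y y′) ZD _) (∑-cong ZD λ x → *-distribʳ-∑ (par-χ y y′) ZD _))) ⟩
      ∑[ y ∈ Y ] ∑[ y′ ∈ Y ] ∑[ x ∈ ZD ] ∑[ x′ ∈ ZD ] (translate y x * translate y′ x′ * par-χ y y′)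
        ≤⟨ ∑-mono Y (λ y → ∑-mono Y λ y′ → ∑-mono-∈ ZD λ i → ∑-mono-∈ ZD λ j → pointwise y y′ i j) ⟩
      ∑[ y ∈ Y ] ∑[ y′ ∈ Y ] ∑[ x ∈ ZD ] ∑[ x′ ∈ ZD ] (translate y x * translate y′ x′ * common-at u x x′)
        ≡⟨ trans (∑-cong Y λ y → trans (∑-swap Y ZD _) (∑-cong ZD λ x → ∑-swap Y ZD _))
             (trans (∑-swap Y ZD _) (∑-cong ZD λ x → ∑-swap Y ZD _)) ⟩
      ∑[ x ∈ ZD ] ∑[ x′ ∈ ZD ] ∑[ y ∈ Y ] ∑[ y′ ∈ Y ] (translate y x * translate y′ x′ * common-at u x x′)
        ≤⟨ ∑-mono ZD (λ x → ∑-mono ZD λ x′ → collapse x x′) ⟩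
      ∑[ x ∈ ZD ] ∑[ x′ ∈ ZD ] common-at u x x′
        ≡⟨ ∑-common-at u ⟩
      common u ∎
      where
      open ≤-Reasoning
      par-χ : ℝ → ℝ → ℕ
      par-χ y y′ = χ (em {u ∥ (y , y′)})
      square : ∀ {a b} → q ≤ a → q ≤ b → q ^ 2 ≤ a * b
      square q≤a q≤b = *-mono-≤ q≤a (≤-trans (≤-reflexive (*-identityʳ q)) q≤b)
      pointwise : ∀ y y′ {x x′} → x ∈ₚ ZD → x′ ∈ₚ ZD →
                  translate y x * translate y′ x′ * par-χ y y′ ≤ translate y x * translate y′ x′ * common-at u x x′
      pointwise y y′ {z , d} {z′ , d′} i j = begin
        t * t′ * s       ≡⟨ *-assoc t t′ s ⟩
        t * (t′ * s)     ≤⟨ χ*-≤ (em {Difference z y d}) (λ h → χ*-≤ (em {Difference z′ y′ d′}) λ h′ → χ-≤ (em {u ∥ (y , y′)}) λ par →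
                              ≤-trans (1≤common-at {u} {y} {y′} {z} {d} {z′} {d′}
                                  (proj₁ (∈-cartesianProduct⁻ Z D i)) (proj₁ (∈-cartesianProduct⁻ Z D j)) h h′ par)
                                (≤-reflexive (sym (trans (cong₂ (λ a b → a * b * g) (χ-yes (em {Difference z y d}) h)
                                    (χ-yes (em {Difference z′ y′ d′}) h′))
                                  (*-identityˡ g))))) ⟩
        t * t′ * g ∎
        where
        t = translate y (z , d)
        t′ = translate y′ (z′ , d′)
        s = par-χ y y′
        g = common-at u (z , d) (z′ , d′)
      one : ∀ x → ∑[ y ∈ Y ] translate y x ≤ 1
      one (z , d) = ∑χ≤1 (λ y → em {Difference z y d}) Y! λ {y} {y′} _ _ h h′ y≉y′ → y≉y′ (difference-injective h h′)
      collapse : ∀ x x′ → ∑[ y ∈ Y ] ∑[ y′ ∈ Y ] (translate y x * translate y′ x′ * common-at u x x′) ≤ common-at u x x′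
      collapse x x′ = begin
        ∑[ y ∈ Y ] ∑[ y′ ∈ Y ] (translate y x * translate y′ x′ * g)
          ≡⟨ trans (*-distribʳ-∑ g Y _) (∑-cong Y λ y → *-distribʳ-∑ g Y _) ⟨
        (∑[ y ∈ Y ] ∑[ y′ ∈ Y ] (translate y x * translate y′ x′)) * g
          ≡⟨ cong (_* g) (∑-* Y Y _ _) ⟨
        (∑[ y ∈ Y ] translate y x) * (∑[ y′ ∈ Y ] translate y′ x′) * g
          ≤⟨ *-monoˡ-≤ g (*-mono-≤ (one x) (one x′)) ⟩
        1 * g
          ≡⟨ *-identityˡ g ⟩
        g ∎
        where g = common-at u x x′

  -- Third moments of richness and the incidence bound

  count≤ : ∀ A ℓ → count A A ℓ ≤ length A ^ 2
  count≤ A ℓ = ∑-bound A λ {a} _ → ≤-trans (∑χ≤length (λ b → em {On ℓ a b}) A) (≤-reflexive (sym (*-identityʳ (length A))))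

  module _ (h K : ℕ) (hK : h * 1024 ≤ K) where

    -- For k ≥ 4, k³ times the number of k-rich lines is at most 128 |A|⁴ whatever k is, so only the
    -- number h of scales is lost. Smaller k are paid for by the assumed bound on the number of
    -- lines. The factor 1024 is 2³ · 128, with 2³ from the pigeonholing of cubes.
    ∑-count³≤ : ∀ {A} → Unique A → length A ^ 2 ℕ.< 2 ^ h → ∀ {Ls} → AllPairs Distinct Ls →
                (∀ {ℓ} → ℓ ∈ₚ Ls → NonZeroPair (proj₁ ℓ)) → 4 ^ 3 * length Ls ≤ 128 * (length A * length A) ^ 2 →
                ∑[ ℓ ∈ Ls ] count A A ℓ ^ 3 ≤ K * length A ^ 4
    ∑-count³≤ {A} A! A<2^h {Ls} Ls! nz few = begin
      ∑[ ℓ ∈ Ls ] count A A ℓ ^ 3                 ≤⟨ proj₂ pigeonhole ⟩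
      8 * h * (k ^ 3 * length rich)               ≤⟨ *-monoʳ-≤ (8 * h) (rich≤ (≤-total 4 k)) ⟩
      8 * h * (128 * (length A * length A) ^ 2)   ≡⟨ solve 2 (λ h a → con 8 :* h :* (con 128 :* (a :* a) :^ 2) := h :* con 1024 :* a :^ 4)
                                                       refl h (length A) ⟩
      h * 1024 * length A ^ 4                     ≤⟨ *-monoˡ-≤ (length A ^ 4) hK ⟩
      K * length A ^ 4                            ∎
      where
      open ≤-Reasoning
      open +-*-Solver
      pigeonhole = dyadic-pigeonhole (count A A) 3 h Ls (λ {ℓ} _ → ≤-<-trans (count≤ A ℓ) A<2^h)
      k = proj₁ pigeonhole
      rich = level (count A A) k Ls
      rich≤ : 4 ≤ k ⊎ k ≤ 4 → k ^ 3 * length rich ≤ 128 * (length A * length A) ^ 2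
      rich≤ (inj₁ 4≤k) = rich-lines A! A! k 4≤k rich (AllPairs.filter⁺ _ Ls!)
        (λ i → nz (level-⊆ (count A A) k Ls i)) (level-∈ (count A A) k Ls)
      rich≤ (inj₂ k≤4) = ≤-trans (*-mono-≤ (^-monoˡ-≤ 3 k≤4) (length-filter _ Ls)) few

    module _ (1≤h : 1 ≤ h) {Z D : List ℝ} (Z! : Unique Z) (D! : Unique D)
             (Z<2^h : length Z ^ 2 ℕ.< 2 ^ h) (D<2^h : length D ^ 2 ℕ.< 2 ^ h)
             {us : List (ℝ × ℝ)} (us! : AllPairs (λ u v → ¬ (v ∥ u)) us) (nz : ∀ {u} → u ∈ₚ us → NonZeroPair u)
             (us≤ : length us ≤ length Z ^ 2) where

      private
        n = length Z
        d = length D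
        N = length us
        Ls = lines Z us
        w = count Z Z
        v = count D D
        -- For Z² the lines number at most N n² ≤ n⁴, which covers poor lines as well. No such bound
        -- in terms of d is available, so lines with fewer than 4 points of D² are split off; of
        -- these only the ones with at least one point contribute.
        Ls₄ = level v 4 Ls
        Ls₁ = level v 1 Ls
        J₁ = ∑[ ℓ ∈ Ls₄ ] (w ℓ * v ℓ)
        J₂ = ∑ Ls₁ w

        nzLs : ∀ {ℓ} → ℓ ∈ₚ Ls → NonZeroPair (proj₁ ℓ)
        nzLs i = nz (lines-slope Z us i)

        Ls! : AllPairs Distinct Ls
        Ls! = lines-distinct Z us!

        1≤K : 1 ≤ K
        1≤K = ≤-trans 1≤h (≤-trans (m≤m*n h 1024) hK)

        5≤K : 5 ≤ K
        5≤K = ≤-trans (m≤m+n 5 1019) (≤-trans (≤-reflexive (sym (*-identityˡ 1024))) (≤-trans (*-monoˡ-≤ 1024 1≤h) hK))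

        ∑w³≤ : ∑[ ℓ ∈ Ls ] w ℓ ^ 3 ≤ K * n ^ 4
        ∑w³≤ = ∑-count³≤ Z! Z<2^h Ls! nzLs (begin
          64 * length Ls          ≤⟨ *-mono-≤ (m≤m+n 64 64) (length-lines Z us) ⟩
          128 * (N * n ^ 2)       ≤⟨ *-monoʳ-≤ 128 (*-monoˡ-≤ (n ^ 2) us≤) ⟩
          128 * (n ^ 2 * n ^ 2)   ≡⟨ solve 1 (λ n → con 128 :* (n :^ 2 :* n :^ 2) := con 128 :* (n :* n) :^ 2) refl n ⟩
          128 * (n * n) ^ 2       ∎)
          where
          open ≤-Reasoning
          open +-*-Solver

        ∑v³≤ : ∑[ ℓ ∈ Ls₄ ] v ℓ ^ 3 ≤ K * d ^ 4
        -- Every line of `Ls₄` has 4 points of D², so `rich-lines` with k = 4 bounds the number of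
        -- these lines.
        ∑v³≤ = ∑-count³≤ D! D<2^h Ls₄! nzLs₄ (rich-lines D! D! 4 ≤-refl Ls₄ Ls₄! nzLs₄ (level-∈ v 4 Ls))
          where
          Ls₄! = AllPairs.filter⁺ _ Ls!
          nzLs₄ : ∀ {ℓ} → ℓ ∈ₚ Ls₄ → NonZeroPair (proj₁ ℓ)
          nzLs₄ i = nzLs (level-⊆ v 4 Ls i)

        bound : ℕ
        bound = K ^ 3 * (N ^ 3 * (n ^ 10 * d ^ 8))

        J₁^6≤ : J₁ ^ 6 ≤ bound
        J₁^6≤ = begin
          J₁ ^ 6                                            ≡⟨ solve 1 (λ j → j :^ 6 := (j :* j) :^ 3) refl J₁ ⟩
          (J₁ * J₁) ^ 3                                     ≤⟨ ^-monoˡ-≤ 3 (cauchy-schwarz Ls₄ {λ ℓ → w ℓ * v ℓ} {w} {λ ℓ → w ℓ * v ℓ ^ 2}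
                                                                 λ ℓ → ≤-reflexive (pointwise (w ℓ) (v ℓ))) ⟩
          (∑ Ls₄ w * (∑[ ℓ ∈ Ls₄ ] (w ℓ * v ℓ ^ 2))) ^ 3    ≡⟨ ^-distribʳ-* 3 (∑ Ls₄ w) _ ⟩
          ∑ Ls₄ w ^ 3 * (∑[ ℓ ∈ Ls₄ ] (w ℓ * v ℓ ^ 2)) ^ 3  ≤⟨ *-mono-≤ (^-monoˡ-≤ 3 (≤-trans (∑-level≤ v 4 Ls w) (∑-count-lines Z Z us)))
                                                                 (hölder Ls₄ w v) ⟩
          (N * n ^ 2) ^ 3 * ((∑[ ℓ ∈ Ls₄ ] v ℓ ^ 3) ^ 2 * (∑[ ℓ ∈ Ls₄ ] w ℓ ^ 3))
                                                            ≤⟨ *-monoʳ-≤ ((N * n ^ 2) ^ 3) (*-mono-≤ (^-monoˡ-≤ 2 ∑v³≤)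
                                                                 (≤-trans (∑-level≤ v 4 Ls _) ∑w³≤)) ⟩
          (N * n ^ 2) ^ 3 * ((K * d ^ 4) ^ 2 * (K * n ^ 4)) ≡⟨ collect N n d K ⟩
          bound                                             ∎
          where
          open ≤-Reasoning
          open +-*-Solver
          pointwise : ∀ w v → w * v * (w * v) ≡ w * (w * v ^ 2)
          pointwise = solve 2 (λ w v → w :* v :* (w :* v) := w :* (w :* v :^ 2)) refl
          collect : ∀ N n d K → (N * n ^ 2) ^ 3 * ((K * d ^ 4) ^ 2 * (K * n ^ 4)) ≡ K ^ 3 * (N ^ 3 * (n ^ 10 * d ^ 8))
          collect = solve 4 (λ N n d K → (N :* n :^ 2) :^ 3 :* ((K :* d :^ 4) :^ 2 :* (K :* n :^ 4))
            := K :^ 3 :* (N :^ 3 :* (n :^ 10 :* d :^ 8))) refl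

        -- Hölder against the constant 1. The lines of `Ls₁` contain a point of D² each, so their
        -- number is at most ∑ v ≤ N d².
        J₂³≤ : J₂ ^ 3 ≤ (N * d ^ 2) ^ 2 * (K * n ^ 4)
        J₂³≤ = begin
          J₂ ^ 3                                             ≡⟨ cong (_^ 3) (∑-cong Ls₁ λ ℓ → *-identityʳ (w ℓ)) ⟨
          (∑[ ℓ ∈ Ls₁ ] (w ℓ * 1 ^ 2)) ^ 3                   ≤⟨ hölder Ls₁ w (λ _ → 1) ⟩
          (∑[ ℓ ∈ Ls₁ ] 1) ^ 2 * (∑[ ℓ ∈ Ls₁ ] w ℓ ^ 3)      ≤⟨ *-mono-≤ (^-monoˡ-≤ 2 (≤-trans (∑-mono-∈ Ls₁ (level-∈ v 1 Ls))
                                                                  (≤-trans (∑-level≤ v 1 Ls v) (∑-count-lines Z D us))))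
                                                                  (≤-trans (∑-level≤ v 1 Ls _) ∑w³≤) ⟩
          (N * d ^ 2) ^ 2 * (K * n ^ 4) ∎
          where open ≤-Reasoning

        -- Squaring gives N⁴ n⁸ d⁸; trading one N for n² restores the shape of the bound for `J₁`.
        J₂^6≤ : J₂ ^ 6 ≤ bound
        J₂^6≤ = begin
          J₂ ^ 6                                      ≡⟨ ^-*-assoc J₂ 3 2 ⟨
          (J₂ ^ 3) ^ 2                                ≤⟨ ^-monoˡ-≤ 2 J₂³≤ ⟩
          ((N * d ^ 2) ^ 2 * (K * n ^ 4)) ^ 2         ≡⟨ collect N n d K ⟩
          N * (K ^ 2 * (N ^ 3 * (n ^ 8 * d ^ 8)))     ≤⟨ *-mono-≤ us≤ (≤-trans (m≤n*m _ K {{ℕ.>-nonZero 1≤K}}) ≤-refl) ⟩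
          n ^ 2 * (K * (K ^ 2 * (N ^ 3 * (n ^ 8 * d ^ 8)))) ≡⟨ collect′ N n d K ⟩
          bound                                       ∎
          where
          open ≤-Reasoning
          open +-*-Solver
          collect : ∀ N n d K → ((N * d ^ 2) ^ 2 * (K * n ^ 4)) ^ 2 ≡ N * (K ^ 2 * (N ^ 3 * (n ^ 8 * d ^ 8)))
          collect = solve 4 (λ N n d K → ((N :* d :^ 2) :^ 2 :* (K :* n :^ 4)) :^ 2
            := N :* (K :^ 2 :* (N :^ 3 :* (n :^ 8 :* d :^ 8)))) refl
          collect′ : ∀ N n d K → n ^ 2 * (K * (K ^ 2 * (N ^ 3 * (n ^ 8 * d ^ 8)))) ≡ K ^ 3 * (N ^ 3 * (n ^ 10 * d ^ 8))
          collect′ = solve 4 (λ N n d K → n :^ 2 :* (K :* (K :^ 2 :* (N :^ 3 :* (n :^ 8 :* d :^ 8))))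
            := K :^ 3 :* (N :^ 3 :* (n :^ 10 :* d :^ 8))) refl

        split : ∀ w v → w * v ≤ χ (4 ≤? v) * (w * v) + 4 * (χ (1 ≤? v) * w)
        split w v with ≤-total 4 v
        ... | inj₁ 4≤v = ≤-trans (≤-reflexive (sym (trans (cong (_* (w * v)) (χ-yes (4 ≤? v) 4≤v)) (*-identityˡ _)))) (m≤m+n _ _)
        ... | inj₂ v≤4 = ≤-trans (small v v≤4) (m≤n+m (4 * (χ (1 ≤? v) * w)) (χ (4 ≤? v) * (w * v)))
          where
          small : ∀ v → v ≤ 4 → w * v ≤ 4 * (χ (1 ≤? v) * w)
          small zero    _   = ≤-trans (≤-reflexive (*-zeroʳ w)) z≤n
          small (suc v) v≤4 = ≤-trans (*-monoʳ-≤ w v≤4) (≤-reflexive (trans (*-comm w 4) (cong (4 *_) (sym (*-identityˡ w)))))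

        J≤ : ∑[ ℓ ∈ Ls ] (w ℓ * v ℓ) ≤ J₁ + 4 * J₂
        J≤ = ≤-trans (∑-mono Ls λ ℓ → split (w ℓ) (v ℓ)) (≤-reflexive (trans (∑-distrib-+ Ls _ _)
          (cong₂ _+_ (sym (∑-filter (λ ℓ → 4 ≤? v ℓ) Ls _))
            (trans (sym (*-distribˡ-∑ 4 Ls _)) (cong (4 *_) (sym (∑-filter (λ ℓ → 1 ≤? v ℓ) Ls w)))))))

        sixth-power : ∀ x y {B} → x ^ 6 ≤ B → y ^ 6 ≤ B → (x + 4 * y) ^ 6 ≤ K ^ 6 * B
        sixth-power x y {B} x≤ y≤ = bound-by (≤-total x y)
          where
          power : ∀ m → x + 4 * y ≤ 5 * m → m ^ 6 ≤ B → (x + 4 * y) ^ 6 ≤ K ^ 6 * B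
          power m le m≤ = ≤-trans (^-monoˡ-≤ 6 {x + 4 * y} {K * m} (≤-trans le (*-monoˡ-≤ m 5≤K)))
            (≤-trans (≤-reflexive (^-distribʳ-* 6 K m)) (*-monoʳ-≤ (K ^ 6) m≤))
          bound-by : x ≤ y ⊎ y ≤ x → (x + 4 * y) ^ 6 ≤ K ^ 6 * B
          bound-by (inj₁ x≤y) = power y (+-monoˡ-≤ (4 * y) x≤y) y≤
          bound-by (inj₂ y≤x) = power x (+-monoʳ-≤ x (*-monoʳ-≤ 4 y≤x)) x≤

      -- On poor lines v ≤ 4, hence the weight 4 of `J₂`. Since x + 4 y is at most 5 times the
      -- maximum and 5 ≤ K, recombining turns K³ into K⁹.
      incidences≤ : (∑[ ℓ ∈ lines Z us ] (count Z Z ℓ * count D D ℓ)) ^ 6 ≤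
                    K ^ 9 * (length us ^ 3 * (length Z ^ 10 * length D ^ 8))
      incidences≤ = begin
        (∑[ ℓ ∈ Ls ] (w ℓ * v ℓ)) ^ 6                   ≤⟨ ^-monoˡ-≤ 6 J≤ ⟩
        (J₁ + 4 * J₂) ^ 6                               ≤⟨ sixth-power J₁ J₂ J₁^6≤ J₂^6≤ ⟩
        K ^ 6 * (K ^ 3 * (N ^ 3 * (n ^ 10 * d ^ 8)))    ≡⟨ trans (sym (*-assoc (K ^ 6) (K ^ 3) _)) (cong (_* (N ^ 3 * (n ^ 10 * d ^ 8))) (sym (^-distribˡ-+-* K 6 3))) ⟩
        K ^ 9 * (N ^ 3 * (n ^ 10 * d ^ 8))              ∎
        where open ≤-Reasoning

  -- Differences and additive energy

  r : List ℝ → ℝ → ℕ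
  r X d = ∑[ a ∈ X ] ∑[ b ∈ X ] χ (em {Difference a b d})

  opaque

    E₃ : List ℝ → ℕ
    E₃ X = ∑[ d ∈ differences X ] r X d ^ 3

    E₃≡ : ∀ X → E₃ X ≡ ∑[ d ∈ differences X ] r X d ^ 3
    E₃≡ X = refl

  differences-unique : ∀ X → Unique (differences X)
  differences-unique X = deduplicate-! decSetoid (map (uncurry _-ᵣ_) (cartesianProduct X X))
    where
    decSetoid : DecSetoid 0ℓ 0ℓ
    decSetoid = record
      { Carrier = ℝ ; _≈_ = _≈_
      ; isDecEquivalence = record
        { isEquivalence = record { refl = ≈-refl ; sym = ≈-sym ; trans = ≈-trans } ; _≟_ = λ _ _ → em } }

  length-differences : ∀ X → length (differences X) ≤ length X * length X
  length-differences X = ≤-trans (length-deduplicate (λ x y → em) (map (uncurry _-ᵣ_) (cartesianProduct X X)))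
    (≤-reflexive (trans (length-map (uncurry _-ᵣ_) (cartesianProduct X X)) (length-cartesianProduct X X)))

  r≤ : ∀ X d → r X d ≤ length X * length X
  r≤ X d = ∑-bound X λ {a} _ → ∑χ≤length (λ b → em {Difference a b d}) X

  1≤E₃ : ∀ {X} → 1 ≤ length X → 1 ≤ E₃ X
  1≤E₃ {z ∷ X} _ = ≤-trans (≤-trans (^-monoˡ-≤ 3 1≤r) (term≤∑ {xs = differences (z ∷ X)} (λ d → r (z ∷ X) d ^ 3) (here refl)))
    (≤-reflexive (sym (E₃≡ (z ∷ X))))
    where
    1≤r : 1 ≤ r (z ∷ X) (z -ᵣ z)
    1≤r = ≤-trans (1≤∑χ (λ b → em {Difference z b (z -ᵣ z)}) {xs = z ∷ X} (here refl) (difference⁺ z z (z -ᵣ z) ≈-refl))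
      (term≤∑ {xs = z ∷ X} (λ a → ∑[ b ∈ z ∷ X ] χ (em {Difference a b (z -ᵣ z)})) (here refl))

  -- Double counting of the solutions of z - y = d.
  ∑-degree : ∀ Z D → ∑ Z (degree Z D) ≡ ∑ D (r Z)
  ∑-degree Z D = trans (∑-cong Z λ y → ∑-cartesianProduct Z D _)
    (trans (∑-swap Z Z _) (trans (∑-cong Z λ z → ∑-swap Z D _) (∑-swap Z D _)))

  -- Extracting a set of small multiplicative energy

  module Extraction (h K : ℕ) (hK : h * 1024 ≤ K) (1≤h : 1 ≤ h) {Z : List ℝ} (Z! : Unique Z) (nzZ : AllNonZero Z)
                    (1≤n : 1 ≤ length Z) (Z<2^h : length Z ^ 4 ℕ.< 2 ^ h) where

    private
      n = length Z

      instance
        n≢0 : NonZero n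
        n≢0 = ℕ.>-nonZero 1≤n

      n^k<2^h : ∀ k → k ≤ 4 → n ^ k ℕ.< 2 ^ h
      n^k<2^h k k≤4 = ≤-<-trans (^-monoʳ-≤ n k≤4) Z<2^h

      n*n≡ : n * n ≡ n ^ 2
      n*n≡ = cong (n *_) (sym (*-identityʳ n))

      popular-differences = dyadic-pigeonhole (r Z) 3 h (differences Z)
        (λ {d} _ → ≤-<-trans (≤-trans (r≤ Z d) (≤-reflexive n*n≡)) (n^k<2^h 2 (m≤m+n 2 2)))
      τ = proj₁ popular-differences
      D = level (r Z) τ (differences Z)

      D! : Unique D
      D! = AllPairs.filter⁺ _ (differences-unique Z)

      D≤ : length D ≤ n ^ 2
      D≤ = ≤-trans (length-filter _ (differences Z)) (≤-trans (length-differences Z) (≤-reflexive n*n≡))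

      D<2^h : length D ^ 2 ℕ.< 2 ^ h
      D<2^h = ≤-<-trans (≤-trans (^-monoˡ-≤ 2 D≤) (≤-reflexive (^-*-assoc n 2 2))) Z<2^h

      degree≤ : ∀ y → degree Z D y ≤ n ^ 3
      degree≤ y = ≤-trans (∑-bound (cartesianProduct Z D) (λ { {z , d} _ → χ≤1 (em {Difference z y d}) }))
        (≤-trans (≤-reflexive (trans (*-identityʳ _) (length-cartesianProduct Z D))) (*-monoʳ-≤ n D≤))

      popular-elements = dyadic-pigeonhole (degree Z D) 1 h Z (λ {y} _ → ≤-<-trans (degree≤ y) (n^k<2^h 3 (m≤m+n 3 1)))

    q : ℕ
    q = proj₁ popular-elements

    f : ℝ → ℕ
    f = degree Z D

    Y : List ℝ
    Y = level f q Z

    private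
      s = length Y
      P = cartesianProduct Y Y

      Y! : Unique Y
      Y! = AllPairs.filter⁺ _ Z!

      nzP : ∀ {u} → u ∈ₚ P → NonZeroPair u
      nzP = cartesianProduct-nonZero (λ i → nzZ (level-⊆ f q Z i)) (λ i → nzZ (level-⊆ f q Z i))

      P≤ : length P ≤ n ^ 2
      P≤ = ≤-trans (≤-reflexive (length-cartesianProduct Y Y))
        (≤-trans (*-mono-≤ (length-filter _ Z) (length-filter _ Z)) (≤-reflexive n*n≡))

      ks = elements (ratios nzP)

      popular-ratios = dyadic-pigeonhole (ρ P) 2 h ks
        (λ {u} _ → ≤-<-trans (≤-trans (∑χ≤length (λ v → em {u ∥ v}) P) P≤) (n^k<2^h 2 (m≤m+n 2 2)))
      t = proj₁ popular-ratios
      us = level (ρ P) t ks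
      N = length us

      us! : AllPairs (λ u v → ¬ (v ∥ u)) us
      us! = AllPairs.filter⁺ _ (separate (ratios nzP))

      nzus : ∀ {u} → u ∈ₚ us → NonZeroPair u
      nzus i = nzP (⊆-source (ratios nzP) (level-⊆ (ρ P) t ks i))

      us≤ : N ≤ n ^ 2
      us≤ = ≤-trans (length-filter _ ks) (≤-trans (length≤ (ratios nzP)) P≤)

      ch≤K : ∀ {c} → c ≤ 1024 → ∀ x → c * h * x ≤ K * x
      ch≤K {c} c≤ x = *-monoˡ-≤ x (≤-trans (≤-trans (*-monoˡ-≤ h c≤) (≤-reflexive (*-comm 1024 h))) hK)

      E₃≤ : E₃ Z ≤ K * (τ ^ 3 * length D)
      E₃≤ = ≤-trans (≤-reflexive (E₃≡ Z)) (≤-trans (proj₂ popular-differences) (ch≤K (m≤m+n 8 1016) _))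

      dτ≤ : length D * τ ≤ K * (q * s)
      dτ≤ = begin
        length D * τ                  ≡⟨ ∑-const D τ ⟨
        ∑[ d ∈ D ] τ                  ≤⟨ ∑-mono-∈ D (level-∈ (r Z) τ (differences Z)) ⟩
        ∑ D (r Z)                     ≡⟨ ∑-degree Z D ⟨
        ∑ Z f                         ≡⟨ ∑-cong Z (λ y → *-identityʳ (f y)) ⟨
        ∑[ y ∈ Z ] f y ^ 1            ≤⟨ proj₂ popular-elements ⟩
        2 * h * (q ^ 1 * s)           ≤⟨ ch≤K (m≤m+n 2 1022) _ ⟩
        K * (q ^ 1 * s)               ≡⟨ cong (λ x → K * (x * s)) (*-identityʳ q) ⟩
        K * (q * s)                   ∎
        where open ≤-Reasoning

      energy≤ : energy Y ≤ K * (t ^ 2 * N)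
      energy≤ = begin
        energy Y                        ≡⟨ equalRatios≡parallels Y Y Y Y ⟩
        parallels P P                   ≤⟨ parallels≤∑ρρ nzP P ⟩
        ∑[ k ∈ ks ] (ρ P k * ρ P k)     ≡⟨ ∑-cong ks (λ k → cong (ρ P k *_) (*-identityʳ (ρ P k))) ⟨
        ∑[ k ∈ ks ] ρ P k ^ 2           ≤⟨ proj₂ popular-ratios ⟩
        4 * h * (t ^ 2 * N)             ≤⟨ ch≤K (m≤m+n 4 1020) _ ⟩
        K * (t ^ 2 * N)                 ∎
        where open ≤-Reasoning

      incidences≥ : q ^ 2 * t * N ≤ ∑[ ℓ ∈ lines Z us ] (count Z Z ℓ * count D D ℓ)
      incidences≥ = begin
        q ^ 2 * t * N                     ≡⟨ *-comm (q ^ 2 * t) N ⟩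
        N * (q ^ 2 * t)                   ≡⟨ ∑-const us (q ^ 2 * t) ⟨
        ∑[ u ∈ us ] q ^ 2 * t             ≤⟨ ∑-mono-∈ us (λ i → *-monoʳ-≤ (q ^ 2) (level-∈ (ρ P) t ks i)) ⟩
        ∑[ u ∈ us ] q ^ 2 * ρ P u         ≤⟨ ∑-mono us (ratios≤common Z D Y! (level-∈ f q Z)) ⟩
        ∑[ u ∈ us ] common Z D u          ≡⟨ ∑-lines Z us _ ⟨
        ∑[ ℓ ∈ lines Z us ] (count Z Z ℓ * count D D ℓ) ∎
        where open ≤-Reasoning

    extract-≤ : energy Y ^ 3 * E₃ Z ^ 4 ≤ K ^ 28 * (length Y ^ 12 * length Z ^ 10)
    extract-≤ = eliminate-parameters (energy Y) (E₃ Z) n (length D) N s q t τ K E₃≤ dτ≤ energy≤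
      (≤-trans (^-monoˡ-≤ 6 incidences≥)
        (incidences≤ h K hK 1≤h Z! D! (n^k<2^h 2 (m≤m+n 2 2)) D<2^h us! nzus us≤))

    -- An empty Y would force |D| τ = 0 and hence E₃ = 0, although a nonempty Z has the difference
    -- 0. This makes each removal strict and the iteration finite.
    1≤length-Y : 1 ≤ length Y
    1≤length-Y = size-positive s (length D) τ E₃≤ dτ≤ (1≤E₃ {Z} 1≤n)
      where
      size-positive : ∀ s d τ {e} → e ≤ K * (τ ^ 3 * d) → d * τ ≤ K * (q * s) → 1 ≤ e → 1 ≤ s
      size-positive (suc _) _ _ _ _ _ = s≤s z≤n
      size-positive zero zero τ e≤ _ 1≤e = contradiction (≤-trans 1≤e e≤) (<⇒≱ (s≤s (≤-reflexive (trans (cong (K *_) (*-zeroʳ (τ ^ 3))) (*-zeroʳ K)))))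
      size-positive zero (suc d) zero e≤ _ 1≤e = contradiction (≤-trans 1≤e e≤) (<⇒≱ (s≤s (≤-reflexive (*-zeroʳ K))))
      size-positive zero (suc d) (suc τ) _ dτ≤ _ = contradiction dτ≤
        (<⇒≱ (s≤s (≤-trans (≤-reflexive (trans (cong (K *_) (*-zeroʳ q)) (*-zeroʳ K))) z≤n)))

  -- Monotonicity of the additive energy

  r-resp-≈ : ∀ X {d d′} → d ≈ d′ → r X d ≤ r X d′
  r-resp-≈ X {d} {d′} d≈d′ = ∑-mono X λ a → ∑-mono X λ b → χ-mono (em {Difference a b d}) (em {Difference a b d′})
    λ h → difference⁺ a b d′ (≈-trans (difference⁻ a b d h) d≈d′)

  differences-mono : ∀ {X X′} → (∀ {a} → a ∈ₚ X′ → a ∈ₚ X) → ∀ {d} → d ∈ₚ differences X′ →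
                     ∃[ d′ ] (d′ ∈ₚ differences X × d ≈ d′)
  differences-mono {X} {X′} sub {d} i =
    let (a , b) , j , eq = ∈-map⁻ (uncurry _-ᵣ_) (Any.deduplicate⁻ (λ _ _ → em) i)
        a∈ , b∈ = ∈-cartesianProduct⁻ X′ X′ j
        d∈ = subst (_∈ₚ map (uncurry _-ᵣ_) (cartesianProduct X X)) (sym eq)
               (∈-map⁺ (uncurry _-ᵣ_) (∈-cartesianProduct⁺ (sub a∈) (sub b∈)))
    in find (Any.deduplicate⁺ (λ _ _ → em) (λ y≈x d≈x → ≈-trans d≈x (≈-sym y≈x)) (lose {P = d ≈_} d∈ ≈-refl))

  -- The two lists of differences may hold different representatives of the same real. Each
  -- difference of the sublist is matched up to `≈` with one of X, and the matching is injective
  -- because the former are pairwise different.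
  E₃-filter≤ : {P : ℝ → Set} (P? : ∀ x → Dec (P x)) → ∀ X → E₃ (filter P? X) ≤ E₃ X
  E₃-filter≤ P? X = begin
    E₃ X′
      ≡⟨ E₃≡ X′ ⟩
    ∑[ d ∈ differences X′ ] r X′ d ^ 3
      ≤⟨ ∑-mono (differences X′) (λ d → ^-monoˡ-≤ 3 (≤-trans (∑-filter≤ P? X _) (∑-mono X λ a → ∑-filter≤ P? X _))) ⟩
    ∑[ d ∈ differences X′ ] r X d ^ 3
      ≤⟨ ∑-mono-∈ (differences X′) representative ⟩
    ∑[ d ∈ differences X′ ] ∑[ d′ ∈ differences X ] (χ (em {d ≈ d′}) * r X d′ ^ 3)
      ≡⟨ ∑-swap (differences X′) (differences X) _ ⟩
    ∑[ d′ ∈ differences X ] ∑[ d ∈ differences X′ ] (χ (em {d ≈ d′}) * r X d′ ^ 3)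
      ≡⟨ ∑-cong (differences X) (λ d′ → sym (*-distribʳ-∑ (r X d′ ^ 3) (differences X′) _)) ⟩
    ∑[ d′ ∈ differences X ] ((∑[ d ∈ differences X′ ] χ (em {d ≈ d′})) * r X d′ ^ 3)
      ≤⟨ ∑-mono (differences X) (λ d′ → ≤-trans (*-monoˡ-≤ (r X d′ ^ 3) (one d′)) (≤-reflexive (*-identityˡ _))) ⟩
    ∑[ d′ ∈ differences X ] r X d′ ^ 3
      ≡⟨ E₃≡ X ⟨
    E₃ X ∎
    where
    open ≤-Reasoning
    X′ = filter P? X
    representative : ∀ {d} → d ∈ₚ differences X′ → r X d ^ 3 ≤ ∑[ d′ ∈ differences X ] (χ (em {d ≈ d′}) * r X d′ ^ 3)
    representative {d} i = let d′ , j , d≈d′ = differences-mono {X} {X′} (λ k → proj₁ (∈-filter⁻ P? k)) i in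
      ≤-trans (^-monoˡ-≤ 3 (r-resp-≈ X d≈d′))
        (≤-trans (≤-reflexive (sym (trans (cong (_* r X d′ ^ 3) (χ-yes (em {d ≈ d′}) d≈d′)) (*-identityˡ _))))
          (term≤∑ (λ d′ → χ (em {d ≈ d′}) * r X d′ ^ 3) j))
    one : ∀ d′ → ∑[ d ∈ differences X′ ] χ (em {d ≈ d′}) ≤ 1
    one d′ = ∑χ≤1 (λ d → em {d ≈ d′}) (differences-unique X′) λ _ _ h h′ ne → ne (≈-trans h (≈-sym h′))

  -- Lets `disjoint′` carry a value of `f` from one entry to another along `≈`.
  Unique-≈⇒≡ : ∀ {X a b} → Unique X → a ∈ₚ X → b ∈ₚ X → a ≈ b → a ≡ b
  Unique-≈⇒≡ _          (here refl) (here refl) _   = refl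
  Unique-≈⇒≡ (x≉ ∷ _)   (here refl) (there j)   a≈b = contradiction a≈b (All.lookup x≉ j)
  Unique-≈⇒≡ (x≉ ∷ _)   (there i)   (here refl) a≈b = contradiction (≈-sym a≈b) (All.lookup x≉ i)
  Unique-≈⇒≡ (_  ∷ X!)  (there i)   (there j)   a≈b = Unique-≈⇒≡ X! i j a≈b

  -- The inequality "energy W ≤ (B / e⁴)^(1/3) |W|⁴", stated through rational upper bounds β / N of the cube
  -- root so that the fourth root of the energy can be used as a norm.
  EnergyBound : (B e : ℕ) → List ℝ → Set
  EnergyBound B e W = ∀ N β → B * N ^ 3 ≤ β ^ 3 * e ^ 4 → N * energy W ≤ β * length W ^ 4

  energyBound-intro : ∀ {B e W} → 1 ≤ B → energy W ^ 3 * e ^ 4 ≤ B * length W ^ 12 → EnergyBound B e W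
  -- For e = 0 the condition on N and β leaves only N = 0, as B is positive; otherwise e⁴ can be
  -- cancelled.
  energyBound-intro {B} {zero} {W} 1≤B _ N β le = bound N le
    where
    bound : ∀ N → B * N ^ 3 ≤ β ^ 3 * 0 → N * energy W ≤ β * length W ^ 4
    bound zero    _  = z≤n
    bound (suc N) le = contradiction (≤-trans le (≤-reflexive (*-zeroʳ (β ^ 3)))) (<⇒≱ (*-mono-≤ 1≤B (m^n>0 (suc N) 3)))
  energyBound-intro {B} {e@(suc _)} {W} 1≤B E≤ N β le = ^-cancelˡ-≤ 3 (*-cancelʳ-≤ _ _ (e ^ 4) {{m^n≢0 e 4}} (begin
    (N * energy W) ^ 3 * e ^ 4           ≡⟨ regroup N (energy W) e ⟩
    N ^ 3 * (energy W ^ 3 * e ^ 4)       ≤⟨ *-monoʳ-≤ (N ^ 3) E≤ ⟩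
    N ^ 3 * (B * length W ^ 12)          ≡⟨ regroup′ N B (length W) ⟩
    B * N ^ 3 * length W ^ 12            ≤⟨ *-monoˡ-≤ (length W ^ 12) le ⟩
    β ^ 3 * e ^ 4 * length W ^ 12        ≡⟨ regroup″ β e (length W) ⟩
    (β * length W ^ 4) ^ 3 * e ^ 4       ∎))
    where
    open ≤-Reasoning
    open +-*-Solver
    regroup : ∀ N E e → (N * E) ^ 3 * e ^ 4 ≡ N ^ 3 * (E ^ 3 * e ^ 4)
    regroup = solve 3 (λ N E e → (N :* E) :^ 3 :* e :^ 4 := N :^ 3 :* (E :^ 3 :* e :^ 4)) refl
    regroup′ : ∀ N B l → N ^ 3 * (B * l ^ 12) ≡ B * N ^ 3 * l ^ 12
    regroup′ = solve 3 (λ N B l → N :^ 3 :* (B :* l :^ 12) := B :* N :^ 3 :* l :^ 12) refl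
    regroup″ : ∀ β e l → β ^ 3 * e ^ 4 * l ^ 12 ≡ (β * l ^ 4) ^ 3 * e ^ 4
    regroup″ = solve 3 (λ β e l → β :^ 3 :* e :^ 4 :* l :^ 12 := (β :* l :^ 4) :^ 3 :* e :^ 4) refl

  energyBound-++ : ∀ {B e U V} → AllNonZero U → AllNonZero V → EnergyBound B e U → EnergyBound B e V → EnergyBound B e (U ++ V)
  energyBound-++ nzU nzV boundU boundV N β le = energy-++
    where open Subadditive N β nzU nzV (boundU N β le) (boundV N β le)

  -- Takes N = e² and β = b + 1 with b the integer part of the cube root of B e²; then β³ / N³ is
  -- close to B / e⁴. Replacing b + 1 by 2 b costs the factor 8, and b = 0 is impossible since B e²
  -- ≥ 1.
  energyBound-elim : ∀ {B e W} → 1 ≤ B → 1 ≤ e → EnergyBound B e W → e ^ 4 * energy W ^ 3 ≤ 8 * (B * length W ^ 12)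
  energyBound-elim {B} {e} {W} 1≤B 1≤e bound with cube-root (B * e ^ 2)
  ... | zero  , _  , hi = contradiction (s≤s⁻¹ hi) (<⇒≱ (*-mono-≤ 1≤B (m^n>0 e {{ℕ.>-nonZero 1≤e}} 2)))
  ... | b@(suc b′) , lo , hi = *-cancelʳ-≤ _ _ (e ^ 2) {{m^n≢0 e 2 {{ℕ.>-nonZero 1≤e}}}} (begin
      e ^ 4 * E ^ 3 * e ^ 2            ≡⟨ solve 2 (λ e E → e :^ 4 :* E :^ 3 :* e :^ 2 := (e :^ 2 :* E) :^ 3) refl e E ⟩
      (e ^ 2 * E) ^ 3                  ≤⟨ ^-monoˡ-≤ 3 (bound (e ^ 2) (suc b) admissible) ⟩
      (suc b * l ^ 4) ^ 3              ≤⟨ ^-monoˡ-≤ 3 (*-monoˡ-≤ (l ^ 4) 1+b≤2b) ⟩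
      (2 * b * l ^ 4) ^ 3              ≡⟨ regroup b l ⟩
      8 * (b ^ 3 * l ^ 12)             ≤⟨ *-monoʳ-≤ 8 (*-monoˡ-≤ (l ^ 12) lo) ⟩
      8 * (B * e ^ 2 * l ^ 12)         ≡⟨ regroup′ B e l ⟩
      8 * (B * l ^ 12) * e ^ 2         ∎)
    where
    open ≤-Reasoning
    open +-*-Solver
    E = energy W
    l = length W
    1+b≤2b : suc b ≤ 2 * b
    1+b≤2b = ≤-trans (+-monoˡ-≤ b (s≤s z≤n)) (≤-reflexive (cong (b +_) (sym (+-identityʳ b))))
    admissible : B * (e ^ 2) ^ 3 ≤ suc b ^ 3 * e ^ 4
    admissible = ≤-trans (≤-reflexive (sixth B e)) (*-monoˡ-≤ (e ^ 4) (<⇒≤ hi))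
      where
      sixth : ∀ B e → B * (e ^ 2) ^ 3 ≡ B * e ^ 2 * e ^ 4
      sixth = solve 2 (λ B e → B :* (e :^ 2) :^ 3 := B :* e :^ 2 :* e :^ 4) refl
    regroup : ∀ b l → (2 * b * l ^ 4) ^ 3 ≡ 8 * (b ^ 3 * l ^ 12)
    regroup = solve 2 (λ b l → (con 2 :* b :* l :^ 4) :^ 3 := con 8 :* (b :^ 3 :* l :^ 12)) refl
    regroup′ : ∀ B e l → 8 * (B * e ^ 2 * l ^ 12) ≡ 8 * (B * l ^ 12) * e ^ 2
    regroup′ = solve 3 (λ B e l → con 8 :* (B :* e :^ 2 :* l :^ 12) := con 8 :* (B :* l :^ 12) :* e :^ 2) refl

  -- Comparison with the energies of the theorem

  E₃⁺≡E₃ : ∀ X → E₃⁺ X ≡ E₃ X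
  E₃⁺≡E₃ X = trans (∑-cong (differences X) λ d → cong (_^ 3) (r₋≡r d)) (sym (E₃≡ X))
    where
    r₋≡r : ∀ d → r₋ X d ≡ r X d
    r₋≡r d = trans (length-filter-χ (λ (a , b) → em {a -ᵣ b ≈ d}) (cartesianProduct X X))
      (trans (∑-cartesianProduct X X _) (∑-cong X λ a → ∑-cong X λ b → ≤-antisym
        (χ-mono (em {a -ᵣ b ≈ d}) (em {Difference a b d}) (difference⁺ a b d))
        (χ-mono (em {Difference a b d}) (em {a -ᵣ b ≈ d}) (difference⁻ a b d))))

  -- The equation y₁ y₂ = y₃ y₄ is read as y₃ / y₁ = y₂ / y₄.
  E×≤energy : ∀ Y → E× Y ≤ energy Y
  E×≤energy Y = begin
    E× Y
      ≡⟨ length-filter-χ equal? quadruples ⟩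
    ∑ quadruples (χ ∘ equal?)
      ≤⟨ ∑-mono quadruples (λ x@((y₁ , y₂) , (y₃ , y₄)) → χ-mono (equal? x) (parallel? x) (par {y₃} {y₁} {y₂} {y₄})) ⟩
    ∑ quadruples (χ ∘ parallel?)
      ≡⟨ trans (∑-cartesianProduct pairs pairs _) (trans (∑-cartesianProduct Y Y _)
           (∑-cong Y λ y₁ → ∑-cong Y λ y₂ → ∑-cartesianProduct Y Y _)) ⟩
    ∑[ y₁ ∈ Y ] ∑[ y₂ ∈ Y ] ∑[ y₃ ∈ Y ] ∑[ y₄ ∈ Y ] χ (em {(y₃ , y₁) ∥ (y₂ , y₄)})
      ≡⟨ trans (∑-cong Y λ y₁ → ∑-swap Y Y _) (∑-swap Y Y _) ⟩
    energy Y ∎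
    where
    open ≤-Reasoning
    pairs = cartesianProduct Y Y
    quadruples = cartesianProduct pairs pairs
    equal? : (x : (ℝ × ℝ) × (ℝ × ℝ)) → Dec (proj₁ (proj₁ x) *ᵣ proj₂ (proj₁ x) ≈ proj₁ (proj₂ x) *ᵣ proj₂ (proj₂ x))
    equal? _ = em
    parallel? : (x : (ℝ × ℝ) × (ℝ × ℝ)) → Dec ((proj₁ (proj₂ x) , proj₁ (proj₁ x)) ∥ (proj₂ (proj₁ x) , proj₂ (proj₂ x)))
    parallel? _ = em

  -- The removal process

  module Decomposition (h K : ℕ) (hK : h * 1024 ≤ K) (1≤h : 1 ≤ h) {A : List ℝ} (nzA : AllNonZero A)
                       (1≤A : 1 ≤ length A) (A<2^h : length A ^ 4 ℕ.< 2 ^ h) where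

    private
      n = length A
      -- Every remaining set has at most n = |A| elements, so a single B serves all removed sets, as
      -- adding their bounds requires.
      B = K ^ 28 * n ^ 10

    1≤K : 1 ≤ K
    1≤K = ≤-trans 1≤h (≤-trans (m≤m*n h 1024) hK)

    1≤B : 1 ≤ B
    1≤B = *-mono-≤ (m^n>0 K {{ℕ.>-nonZero 1≤K}} 28) (m^n>0 n {{ℕ.>-nonZero 1≤A}} 10)

    -- Z is what remains and W what has been removed. The energy bound is kept for all e up to E₃ Z,
    -- so that it passes to a smaller Z by monotonicity alone.
    record State (Z W : List ℝ) : Set where
      field
        Z!       : Unique Z
        W!       : Unique W
        Z⊆A      : ∀ {a} → a ∈ₚ Z → a ∈ₚ A
        W⊆A      : ∀ {a} → a ∈ₚ W → a ∈ₚ A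
        disjoint : ∀ {z w} → z ∈ₚ Z → w ∈ₚ W → w ≉ z
        cover    : ∀ {a} → a ∈ₚ A → a ∈ₚ Z ⊎ a ∈ₚ W
        lengths  : length Z + length W ≡ n
        bounded  : ∀ {e} → e ≤ E₃ Z → EnergyBound B e W

    record Result : Set where
      field
        {X Y}  : List ℝ
        X!     : Unique X
        Y!     : Unique Y
        X⊆A    : ∀ {a} → a ∈ₚ X → a ∈ₚ A
        Y⊆A    : ∀ {a} → a ∈ₚ Y → a ∈ₚ A
        cover  : ∀ {a} → a ∈ₚ A → a ∈ₚ X ⊎ a ∈ₚ Y
        X-half : n ≤ 2 * length X
        Y-half : n ≤ 2 * length Y
        Y≤A    : length Y ≤ n
        bound  : EnergyBound B (E₃ X) Y

    module Step {Z W : List ℝ} (S : State Z W) (Z-half : n ≤ 2 * length Z) where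
      open State S

      private
        m = length Z

        m≤n : m ≤ n
        m≤n = ≤-trans (m≤m+n m (length W)) (≤-reflexive lengths)

        1≤m : 1 ≤ m
        1≤m = size-positive m Z-half
          where
          size-positive : ∀ m → n ≤ 2 * m → 1 ≤ m
          size-positive zero    n≤0 = contradiction (≤-trans 1≤A n≤0) λ ()
          size-positive (suc _) _   = s≤s z≤n

      open Extraction h K hK 1≤h Z! (nzA ∘ Z⊆A) 1≤m (≤-<-trans (^-monoˡ-≤ 4 m≤n) A<2^h)

      Z′ = below f q Z
      W′ = Y ++ W

      private
        Y⊆Z : ∀ {a} → a ∈ₚ Y → a ∈ₚ Z
        Y⊆Z = level-⊆ f q Z

        Z′⊆Z : ∀ {a} → a ∈ₚ Z′ → a ∈ₚ Z
        Z′⊆Z i = proj₁ (∈-filter⁻ (λ x → f x <? q) {xs = Z} i)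

        split : ∀ {a} → a ∈ₚ Z → a ∈ₚ Z′ ⊎ a ∈ₚ Y
        split {a} i = choose (<-≤-connex (f a) q)
          where
          choose : f a ℕ.< q ⊎ q ≤ f a → a ∈ₚ Z′ ⊎ a ∈ₚ Y
          choose (inj₁ lt) = inj₁ (∈-filter⁺ (λ x → f x <? q) i lt)
          choose (inj₂ ge) = inj₂ (∈-filter⁺ (λ x → q ≤? f x) i ge)

        energy-Y : ∀ {e} → e ≤ E₃ Z → EnergyBound B e Y
        energy-Y {e} e≤ = energyBound-intro {B} {e} {Y} 1≤B (begin
          energy Y ^ 3 * e ^ 4                      ≤⟨ *-monoʳ-≤ (energy Y ^ 3) (^-monoˡ-≤ 4 e≤) ⟩
          energy Y ^ 3 * E₃ Z ^ 4                   ≤⟨ extract-≤ ⟩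
          K ^ 28 * (length Y ^ 12 * m ^ 10)         ≤⟨ *-monoʳ-≤ (K ^ 28) (*-monoʳ-≤ (length Y ^ 12) (^-monoˡ-≤ 10 m≤n)) ⟩
          K ^ 28 * (length Y ^ 12 * n ^ 10)         ≡⟨ trans (cong (K ^ 28 *_) (*-comm (length Y ^ 12) (n ^ 10))) (sym (*-assoc (K ^ 28) _ _)) ⟩
          B * length Y ^ 12                         ∎)
          where open ≤-Reasoning

      energy-W′ : ∀ {e} → e ≤ E₃ Z → EnergyBound B e W′
      energy-W′ {e} e≤ = energyBound-++ {B} {e} {Y} {W} (nzA ∘ Z⊆A ∘ Y⊆Z) (nzA ∘ W⊆A) (energy-Y {e} e≤) (bounded {e} e≤)

      lengths′ : length Z′ + length W′ ≡ n
      lengths′ = begin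
        length Z′ + length W′                 ≡⟨ cong (length Z′ +_) (length-++ Y) ⟩
        length Z′ + (length Y + length W)     ≡⟨ +-assoc (length Z′) _ _ ⟨
        length Z′ + length Y + length W       ≡⟨ cong (_+ length W) (trans (+-comm (length Z′) _) (level+below f q Z)) ⟩
        length Z + length W                   ≡⟨ lengths ⟩
        n                                     ∎
        where open ≡-Reasoning

      shrinks : length Z′ ℕ.< length Z
      shrinks = ≤-trans (+-monoˡ-≤ (length Z′) 1≤length-Y) (≤-reflexive (level+below f q Z))

      disjoint′ : ∀ {z w} → z ∈ₚ Z′ → w ∈ₚ W′ → w ≉ z
      disjoint′ {z} {w} i j w≈z = choose (∈-++⁻ Y j)
        where
        choose : ¬ (w ∈ₚ Y ⊎ w ∈ₚ W)
        choose (inj₁ k) = <⇒≱ (proj₂ (∈-filter⁻ (λ x → f x <? q) {xs = Z} i))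
          (subst (λ x → q ≤ f x) (Unique-≈⇒≡ Z! (Y⊆Z k) (Z′⊆Z i) w≈z) (level-∈ f q Z k))
        choose (inj₂ k) = disjoint (Z′⊆Z i) k w≈z

      W′! : Unique W′
      W′! = AllPairs.++⁺ (AllPairs.filter⁺ _ Z!) W!
        (All.tabulate λ i → All.tabulate λ j y≈w → disjoint (Y⊆Z i) j (≈-sym y≈w))

      W′⊆A : ∀ {a} → a ∈ₚ W′ → a ∈ₚ A
      W′⊆A {a} i = choose (∈-++⁻ Y i)
        where
        choose : a ∈ₚ Y ⊎ a ∈ₚ W → a ∈ₚ A
        choose (inj₁ j) = Z⊆A (Y⊆Z j)
        choose (inj₂ j) = W⊆A j

      next : State Z′ W′
      next = record
        { Z!       = AllPairs.filter⁺ _ Z!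
        ; W!       = W′!
        ; Z⊆A      = Z⊆A ∘ Z′⊆Z
        ; W⊆A      = W′⊆A
        ; disjoint = disjoint′
        ; cover    = λ i → cover′ (cover i)
        ; lengths  = lengths′
        ; bounded  = λ {e} e≤ → energy-W′ {e} (≤-trans e≤ (E₃-filter≤ (λ x → f x <? q) Z))
        }
        where
        move : ∀ {a} → a ∈ₚ Z′ ⊎ a ∈ₚ Y → a ∈ₚ Z′ ⊎ a ∈ₚ W′
        move (inj₁ j) = inj₁ j
        move (inj₂ j) = inj₂ (∈-++⁺ˡ j)
        cover′ : ∀ {a} → a ∈ₚ Z ⊎ a ∈ₚ W → a ∈ₚ Z′ ⊎ a ∈ₚ W′
        cover′ (inj₁ j) = move (split j)
        cover′ (inj₂ j) = inj₂ (∈-++⁺ʳ Y j)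

      -- X is the set before the last removal and Y contains the piece just removed, so the two
      -- overlap. That keeps X at half of A or more, puts Y above half, and lets E₃ X be the energy
      -- that bounded every removed piece.
      finish : 2 * length Z′ ℕ.< n → Result
      finish small = record
        { X!     = Z!
        ; Y!     = W′!
        ; X⊆A    = Z⊆A
        ; Y⊆A    = W′⊆A
        ; cover  = λ i → cover′ (cover i)
        ; X-half = Z-half
        ; Y-half = half (length Z′) (length W′) lengths′ small
        ; Y≤A    = ≤-trans (m≤n+m (length W′) (length Z′)) (≤-reflexive lengths′)
        ; bound  = energy-W′ {E₃ Z} ≤-refl
        }
        where
        cover′ : ∀ {a} → a ∈ₚ Z ⊎ a ∈ₚ W → a ∈ₚ Z ⊎ a ∈ₚ W′
        cover′ (inj₁ j) = inj₁ j
        cover′ (inj₂ j) = inj₂ (∈-++⁺ʳ Y j)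
        half : ∀ a b → a + b ≡ n → 2 * a ℕ.< n → n ≤ 2 * b
        half a b eq lt = +-cancelˡ-≤ n _ _ (begin
          n + n              ≡⟨ cong₂ _+_ (sym eq) (sym eq) ⟩
          a + b + (a + b)    ≡⟨ solve 2 (λ a b → a :+ b :+ (a :+ b) := con 2 :* a :+ con 2 :* b) refl a b ⟩
          2 * a + 2 * b      ≤⟨ +-monoˡ-≤ (2 * b) (<⇒≤ lt) ⟩
          n + 2 * b          ∎)
          where
          open ≤-Reasoning
          open +-*-Solver

    -- Recursion on a bound k for the length of Z, which drops with every removal.
    iterate : ∀ k {Z W} → length Z ≤ k → State Z W → n ≤ 2 * length Z → Result
    iterate zero Z≤0 S Z-half = contradiction (≤-trans 1≤A (≤-trans Z-half (*-monoʳ-≤ 2 Z≤0))) λ ()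
    iterate (suc k) {Z} Z≤ S Z-half = continue (<-≤-connex (2 * length Z′) n)
      where
      open Step S Z-half
      continue : 2 * length Z′ ℕ.< n ⊎ n ≤ 2 * length Z′ → Result
      continue (inj₁ small) = finish small
      continue (inj₂ large) = iterate k (s≤s⁻¹ (≤-trans shrinks Z≤)) next large

    decompose : Unique A → Result
    decompose A! = iterate n ≤-refl (record
      { Z! = A! ; W! = [] ; Z⊆A = λ i → i ; W⊆A = λ () ; disjoint = λ _ () ; cover = inj₁
      ; lengths = +-identityʳ n
      -- Nothing has been removed yet, and the energy of the empty list is 0.
      ; bounded = λ _ N β _ → ≤-trans (≤-reflexive (*-zeroʳ N)) z≤n
      }) (m≤n*m n 2)

    energies≤ : (R : Result) → let open Result R in E₃⁺ X ^ 4 * E× Y ^ 3 ≤ 8 * (K ^ 28 * n ^ 22)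
    energies≤ R = begin
      E₃⁺ X ^ 4 * E× Y ^ 3                    ≤⟨ *-mono-≤ (^-monoˡ-≤ 4 (≤-reflexive (E₃⁺≡E₃ X))) (^-monoˡ-≤ 3 (E×≤energy Y)) ⟩
      E₃ X ^ 4 * energy Y ^ 3                 ≤⟨ energyBound-elim {B} {E₃ X} {Y} 1≤B (1≤E₃ {X} (size-positive (length X) X-half)) bound ⟩
      8 * (K ^ 28 * n ^ 10 * length Y ^ 12)   ≤⟨ *-monoʳ-≤ 8 (*-monoʳ-≤ (K ^ 28 * n ^ 10) (^-monoˡ-≤ 12 Y≤A)) ⟩
      8 * (K ^ 28 * n ^ 10 * n ^ 12)          ≡⟨ cong (8 *_) (trans (*-assoc (K ^ 28) (n ^ 10) (n ^ 12))
                                                   (cong (K ^ 28 *_) (sym (^-distribˡ-+-* n 10 12)))) ⟩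
      8 * (K ^ 28 * n ^ 22)                   ∎
      where
      open ≤-Reasoning
      open Result R
      size-positive : ∀ m → n ≤ 2 * m → 1 ≤ m
      size-positive zero    n≤0 = contradiction (≤-trans 1≤A n≤0) λ ()
      size-positive (suc _) _   = s≤s z≤n

  -- Assembling the theorem

  Claim : List ℝ → Set
  Claim A = ∃[ X ] ∃[ Y ] (Unique X × Unique Y × X ⊆ A × Y ⊆ A × A ⊆ (X ++ Y) ×
    length A ≤ 2 * length X × length A ≤ 2 * length Y ×
    LogBound constant 28 (length A) (E₃⁺ X ^ 4 * E× Y ^ 3) (length A ^ 22))

  result⇒claim : ∀ {h K hK 1≤h A} {nzA : AllNonZero A} {1≤A A<2^h} → K ≤ scale * ⌊log₂ (2 + length A) ⌋ →
    Decomposition.Result h K hK 1≤h {A} nzA 1≤A A<2^h → Claim A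
  result⇒claim {h} {K} {hK} {1≤h} {A} {nzA} {1≤A} {A<2^h} K≤ R =
    X , Y , X! , Y! , ⊆ₚ⇒⊆ X⊆A , ⊆ₚ⇒⊆ Y⊆A , ⊆ₚ⇒⊆ (λ i → join (cover i)) , X-half , Y-half ,
    extract-log 28 scale ⌊log₂ (2 + length A) ⌋ K (length A ^ 22) constant≡ K≤ (energies≤ R)
    where
    open Decomposition h K hK 1≤h {A} nzA 1≤A A<2^h
    open Result R
    ⊆ₚ⇒⊆ : ∀ {X Y : List ℝ} → (∀ {a} → a ∈ₚ X → a ∈ₚ Y) → X ⊆ Y
    ⊆ₚ⇒⊆ sub i = let _ , j , x≈ = find i in lose (sub j) x≈
    join : ∀ {a} → a ∈ₚ X ⊎ a ∈ₚ Y → a ∈ₚ X ++ Y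
    join (inj₁ i) = ∈-++⁺ˡ i
    join (inj₂ i) = ∈-++⁺ʳ X i

  claim : ∀ A → Unique A → All (λ a → ¬ (a ≈ 0ℝ)) A → Claim A
  claim []        _  _  = [] , [] , [] , [] , (λ ()) , (λ ()) , (λ ()) , z≤n , z≤n , z≤n
  claim A@(_ ∷ _) A! nz = result⇒claim (scale-log (length A))
    -- The number h of dyadic scales; the reflexivity proof after it fixes K as 1024 h.
    (Decomposition.decompose (4 * suc ⌊log₂ (2 + length A) ⌋) _ ≤-refl (s≤s z≤n)
      (λ i → All.lookup nz i) (s≤s z≤n) (n^4<2^ (length A)) A!)

mainTheorem10 : (em : ExcludedMiddle 0ℓ) → let open Energies em in
    ∃[ C ] ∃[ c ] (0 ℕ.< C × 0 ℕ.< c ×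
    ((A : List ℝ) → Unique A → All (λ a → ¬ (a ≈ 0ℝ)) A →
    ∃[ X ] ∃[ Y ] (Unique X × Unique Y × X ⊆ A × Y ⊆ A × A ⊆ (X ++ Y) ×
    length A ℕ.≤ 2 ℕ.* length X × length A ℕ.≤ 2 ℕ.* length Y ×
    LogBound C c (length A) (E₃⁺ X ℕ.^ 4 ℕ.* E× Y ℕ.^ 3) (length A ℕ.^ 22))))
mainTheorem10 em = constant , 28 , 0<constant , s≤s z≤n , claim em
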